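{- Let $Q:=q^7$. Then $$\frac{(1,0,56)-(5,4,12)}{(7,0,8)+(3,2,19)}=q\frac{E(q^4)E(Q^8)}{E(q^8)E(Q^4)}.$$
   Context: $|q|<1$, $E(q)=(q;q)_\infty=\prod_{k\ge1}(1-q^k)$. For integers $a,b,c$ with $a,c>0$, $b^2-4ac<0$, $(a,b,c)$ denotes $\sum_{n,m=-\infty}^{\infty}q^{an^2+bnm+cm^2}$. -}

module Defs where

open import Data.Nat as ℕ using (ℕ; zero; suc; _∸_; NonZero)
open import Data.Nat.DivMod using (_/_)
open import Data.Nat.Divisibility using (_∣?_)
open import Data.Integer as ℤ using (ℤ; +_; _+_; _*_; _-_; ∣_∣)
open import Data.List using (List; map; concatMap; length; filter; foldr; upTo)
open import Data.Product using (_×_; _,_)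
open import Relation.Nullary using (yes; no)
open import Relation.Binary.PropositionalEquality using (_≡_)

FPS : Set
FPS = ℕ → ℤ

infixl 6 _⊕_ _⊖_
infixl 7 _⊛_

_⊕_ : FPS → FPS → FPS
(f ⊕ g) n = f n + g n

_⊖_ : FPS → FPS → FPS
(f ⊖ g) n = f n - g n

_⊛_ : FPS → FPS → FPS
(f ⊛ g) n = foldr _+_ (+ 0) (map (λ i → f i * g (n ∸ i)) (upTo (suc n)))

qmul : FPS → FPS
qmul f zero = + 0
qmul f (suc n) = f n

mono : ℕ → FPS
mono k n with n ℕ.≟ k
... | yes _ = + 1
... | no _ = + 0

one : FPS
one = mono 0

Efin : ℕ → FPS
Efin zero = one
Efin (suc j) = Efin j ⊛ (one ⊖ mono (suc j))

-- E(q) = (q;q)_∞ = ∏_{k≥1} (1-q^k); its q^n coefficient only involves factors k ≤ n.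
E : FPS
E n = Efin n n

dilate : (k : ℕ) → .{{NonZero k}} → FPS → FPS
dilate k f n with k ∣? n
... | yes _ = f (n / k)
... | no _ = + 0

symRange : ℕ → List ℤ
symRange B = map (λ i → + i - + B) (upTo (suc (2 ℕ.* B)))

qform : ℤ → ℤ → ℤ → ℤ → ℤ → ℤ
qform a b c n m = a * n * n + b * n * m + c * m * m

-- (a,b,c) = Σ_{n,m ∈ ℤ} q^{a n² + b n m + c m²}, for a, c > 0, b² - 4ac < 0.
-- The q^N coefficient is #{(n,m) ∈ ℤ² : a n² + b n m + c m² = N}.  For a positive
-- definite form, 4aN = (2an+bm)² + (4ac-b²)m² ≥ m² gives |m| ≤ 4aN, and likewise
-- |n| ≤ 4cN, so all solutions lie in the box [-B,B]² with B = 4(|a|+|c|)N.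
theta : ℤ → ℤ → ℤ → FPS
theta a b c N =
  + length (filter (λ p → qf p ℤ.≟ + N) pairs)
  where
    B : ℕ
    B = 4 ℕ.* (∣ a ∣ ℕ.+ ∣ c ∣) ℕ.* N
    pairs : List (ℤ × ℤ)
    pairs = concatMap (λ n → map (λ m → n , m) (symRange B)) (symRange B)
    qf : ℤ × ℤ → ℤ
    qf (n , m) = qform a b c n m

{-# OPTIONS --safe #-}
module Submission where

open import Defs
open import Data.Nat using (ℕ)
open import Data.Integer using (+_)
open import Relation.Binary.PropositionalEquality using (_≡_)
import Data.Integer as ℤ
open import Algebra.Solver.Ring.AlmostCommutativeRing using (AlmostCommutativeRing; fromCommutativeRing; _-Raw-AlmostCommutative⟶_)
open import Level using (0ℓ)

-- Write A = (1,0,14), B = (2,0,7), C = (3,2,5), D(q) = E(-q), φ = Σ q^{n²}, ψ = Σ_{k ∈ ℤ} q^{2k²+k},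
-- and E_k, D_k, φ_k, ... for the series in q^k.
--
-- Splitting C modulo 3 gives C = φ₃ φ₄₂ + 2 q⁵ κ κ₁₄ with κ = Σ q^{3k²+2k}. The products φ E₂ = D²,
-- φ₃ E₂ = D D̄ and κ E₂ = D ψ₃(-q), where D = δ₀ + q δ₁ and D̄ = δ₀ - q δ₁ are the two parities of the
-- pentagonal series, show that (A + C) E₂ E₂₈ is D D₁₄ times a binary theta series, and a second
-- splitting of the same lattice modulo 3 identifies that series with 2 E₈ E₇. In the same way
-- (B - C) E₄ E₁₄ = 2 q² E₁ E₅₆ D₂ D₇. Hence
--   (A + C) E₄ E₅₆ = 2 ψ(q) ψ(-q⁷) E₈ E₂₈  and  (B - C) E₈ E₂₈ = 2 q² ψ(-q) ψ(q⁷) E₄ E₅₆.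
-- All the E's here are series in q⁴, so these identities can be dissected modulo 2 and 4. The even
-- parts of A, B, C are B, A, C in q², the parts of A - C in the classes 0, 1 and of B + C in the classes
-- 0, 3 modulo 4 make up the numerator and the denominator of the theorem, and the even part s of
-- ψ(q) ψ(-q⁷) equals its part in the class 1 modulo 4 after q ↦ -q. So all four parts are explicit
-- multiples of s, and the quotient follows.

-- Every theta identity is proved by writing both sides as sums over ℤ² with a quadratic exponent
-- and a sign, and matching these by affine maps of determinant 1 or -1 and by splitting into
-- residue classes; with numeral coefficients the matching holds by computation. Infinite products
-- enter only through Euler's pentagonal series, Gauss's series for `ψ` and E(-q) E(q) E(q⁴) =
-- E(q²)³, each a limit of a finite identity. Quotients are avoided by cancelling series with
-- constant term 1. The constants in the two splittings modulo 3 come from completing squares: for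
-- E(q⁸) E(q⁷) the exponent N satisfies 24 N + 15 = 8 u² + 7 v², against s² + 14 t² on the other
-- side; for q² E(q) E(q⁵⁶) the two shapes of 24 N + 9 are u² + 56 v² and 2 s² + 7 t². The obstacle
-- is that products are found for A + C and B - C, while the theorem needs A - C in the class 1 and
-- B + C in the class 3 modulo 4. In these classes q ↦ -q on the reduced series reverses the
-- relative sign, because all exponents of one summand are even and all those of the other are odd.

module RingIdentities (R : AlmostCommutativeRing 0ℓ 0ℓ) (h : ℤ.+-*-rawRing -Raw-AlmostCommutative⟶ R) where

  open AlmostCommutativeRing R
  open _-Raw-AlmostCommutative⟶_ h using () renaming (⟦_⟧ to ι)
  open import Data.Maybe using (just; nothing; Maybe)
  open import Relation.Nullary using (yes; no)

  private
    _coeff≟_ : ∀ a b → Maybe (ι a ≈ ι b)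
    a coeff≟ b with a ℤ.≟ b
    ... | yes _≡_.refl = just refl
    ... | no _         = nothing

  open import Algebra.Solver.Ring ℤ.+-*-rawRing R h _coeff≟_ using (Polynomial; solve; con; _:+_; _:*_; :-_; _:=_)

  1′ : Carrier
  1′ = ι (+ 1)

  :1 : ∀ {n} → Polynomial n
  :1 = con (+ 1)

  -- Ring identities behind the three finite product formulas.

  pent-base : ∀ P y → P * (1′ + - y) + P * y ≈ P
  pent-base = solve 2 (λ P y → P :* (:1 :+ :- y) :+ P :* y := P) refl

  -- Both sides equal S - C X M w. In `Pentagonal.telescope` the last summand on the left is the new
  -- correction `g`, which cancels the factor 1 - y of the new term; on the right the middle summand
  -- is the old correction and the last one the new term of `S n`.
  pent-step : ∀ S C X M w y →
    S + (- C) * (X * (1′ + - y)) * (M * w) + (- C) * X * (M * w * y) ≈ S + C * ((1′ + - w) * X) * M + (- C) * X * M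
  pent-step = solve 6 (λ S C X M w y →
    S :+ (:- C) :* (X :* (:1 :+ :- y)) :* (M :* w) :+ (:- C) :* X :* (M :* w :* y)
      := S :+ C :* ((:1 :+ :- w) :* X) :* M :+ (:- C) :* X :* M) refl

  gauss-base : ∀ P a z → P * (1′ + - (a * z)) ≈ (1′ + - z) * P + P * (1′ + - a) * z
  gauss-base = solve 3 (λ P a z → P :* (:1 :+ :- (a :* z)) := (:1 :+ :- z) :* P :+ P :* (:1 :+ :- a) :* z) refl

  -- Apart from (1 - z) S both sides are X Y M (1 - a v z): the brackets are (1 - v) + (1 - a z) v
  -- on the left and (1 - z) + (1 - a v) z on the right.
  gauss-step : ∀ S X Y M v a z →
    ((1′ + - z) * S + ((1′ + - v) * X) * Y * M) + (X * (1′ + - (a * z))) * Y * (M * v)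
    ≈ (1′ + - z) * (S + X * Y * M) + X * (Y * (1′ + - (a * v))) * (M * z)
  gauss-step = solve 7 (λ S X Y M v a z →
    ((:1 :+ :- z) :* S :+ ((:1 :+ :- v) :* X) :* Y :* M) :+ (X :* (:1 :+ :- (a :* z))) :* Y :* (M :* v)
    := (:1 :+ :- z) :* (S :+ X :* Y :* M) :+ X :* (Y :* (:1 :+ :- (a :* v))) :* (M :* z)) refl

  gauss-end : ∀ O P z M N → (1′ + - z) * (O * P) + O * (1′ + - z) * M + O * (1′ + - z) * N ≈ O * (1′ + - z) * (N + (M + P))
  gauss-end = solve 5 (λ O P z M N → (:1 :+ :- z) :* (O :* P) :+ O :* (:1 :+ :- z) :* M :+ O :* (:1 :+ :- z) :* N
    := O :* (:1 :+ :- z) :* (N :+ (M :+ P))) refl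

  swap-last : ∀ P x y → x * (P * y) ≈ x * P * y
  swap-last = solve 3 (λ P x y → x :* (P :* y) := x :* P :* y) refl

  odd-even-step : ∀ O W x y → O * x * (W * y) ≈ O * W * x * y
  odd-even-step = solve 4 (λ O W x y → O :* x :* (W :* y) := O :* W :* x :* y) refl

  -- Here a = q^(2n+1) and b = q^(2n+2): the twist turns 1 - a into 1 + a and keeps 1 - b.
  -- `twist-step′` regroups the new factors as (1 - a²)(1 - b²) for E(q²) at double length and (1 -
  -- b)² for the two copies of E(q²) at single length.
  twist-step : ∀ T F G a b →
    (T * (1′ + a) * (1′ + - b)) * (F * (1′ + - a) * (1′ + - b)) * (G * (1′ + - (b * b)))
    ≈ T * F * G * ((1′ + a) * (1′ + - b) * ((1′ + - a) * (1′ + - b)) * (1′ + - (b * b)))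
  twist-step = solve 5 (λ T F G a b →
    (T :* (:1 :+ a) :* (:1 :+ :- b)) :* (F :* (:1 :+ :- a) :* (:1 :+ :- b)) :* (G :* (:1 :+ :- (b :* b)))
    := T :* F :* G :* ((:1 :+ a) :* (:1 :+ :- b) :* ((:1 :+ :- a) :* (:1 :+ :- b)) :* (:1 :+ :- (b :* b)))) refl

  twist-step′ : ∀ H K a b →
    H * (K * K) * ((1′ + a) * (1′ + - b) * ((1′ + - a) * (1′ + - b)) * (1′ + - (b * b)))
    ≈ (H * (1′ + - (a * a)) * (1′ + - (b * b))) * ((K * (1′ + - b)) * (K * (1′ + - b)))
  twist-step′ = solve 4 (λ H K a b →
    H :* (K :* K) :* ((:1 :+ a) :* (:1 :+ :- b) :* ((:1 :+ :- a) :* (:1 :+ :- b)) :* (:1 :+ :- (b :* b)))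
    := (H :* (:1 :+ :- (a :* a)) :* (:1 :+ :- (b :* b))) :* ((K :* (:1 :+ :- b)) :* (K :* (:1 :+ :- b)))) refl

  expand-1- : ∀ f g → f * (1′ + - g) ≈ f + - (f * g)
  expand-1- = solve 2 (λ f g → f :* (:1 :+ :- g) := f :+ :- (f :* g)) refl

  neg-⊛ : ∀ f g → (- f) * g ≈ - (f * g)
  neg-⊛ = solve 2 (λ f g → (:- f) :* g := :- (f :* g)) refl

  one-one : ∀ f → 1′ * f * 1′ ≈ f
  one-one = solve 1 (λ f → :1 :* f :* :1 := f) refl

  one-one′ : ∀ f → f * 1′ * 1′ ≈ f
  one-one′ = solve 1 (λ f → f :* :1 :* :1 := f) refl

  rot : ∀ f g h → f * (g * h) ≈ g * f * h
  rot = solve 3 (λ f g h → f :* (g :* h) := g :* f :* h) refl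

  neg-neg : ∀ f g → - ((- f) * g) ≈ f * g
  neg-neg = solve 2 (λ f g → :- ((:- f) :* g) := f :* g) refl

  -- Eliminations between theta series and eta products.

  -- The variables are named after the series they stand for: E₄ = E(q⁴), D₇ = E(-q⁷), ψ⁻ = ψ(-q), ...

  DE₄-ψE₂ : ∀ {D E₁ E₂ E₄ ψ} → D * E₁ * E₄ ≈ E₂ * (E₂ * E₂) → ψ * E₁ ≈ E₂ * E₂ → (D * E₄) * E₁ ≈ (ψ * E₂) * E₁
  DE₄-ψE₂ {D} {E₁} {E₂} {E₄} {ψ} t g =
    trans (solve 3 (λ D E₁ E₄ → D :* E₄ :* E₁ := D :* E₁ :* E₄) refl D E₁ E₄)
    (trans t (trans (*-cong refl (sym g)) (solve 3 (λ ψ E₁ E₂ → E₂ :* (ψ :* E₁) := ψ :* E₂ :* E₁) refl ψ E₁ E₂)))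

  ψ⁻E₂-E₁E₄ : ∀ {D E₁ E₂ E₄ ψ⁻} → D * E₁ * E₄ ≈ E₂ * (E₂ * E₂) → ψ⁻ * D ≈ E₂ * E₂ → (ψ⁻ * E₂) * D ≈ (E₁ * E₄) * D
  ψ⁻E₂-E₁E₄ {D} {E₁} {E₂} {E₄} {ψ⁻} t g =
    trans (solve 3 (λ ψ⁻ E₂ D → ψ⁻ :* E₂ :* D := E₂ :* (ψ⁻ :* D)) refl ψ⁻ E₂ D)
    (trans (*-cong refl g) (trans (sym t) (solve 3 (λ D E₁ E₄ → D :* E₁ :* E₄ := E₁ :* E₄ :* D) refl D E₁ E₄)))

  E₁D₂E₈-ψ⁻E₄² : ∀ {D₂ E₁ E₂ E₄ E₈ ψ⁻} → D₂ * E₂ * E₈ ≈ E₄ * (E₄ * E₄) → ψ⁻ * E₂ ≈ E₁ * E₄ →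
    (E₁ * D₂ * E₈) * E₂ ≈ (ψ⁻ * (E₄ * E₄)) * E₂
  E₁D₂E₈-ψ⁻E₄² {D₂} {E₁} {E₂} {E₄} {E₈} {ψ⁻} t g =
    trans (solve 4 (λ D₂ E₁ E₂ E₈ → E₁ :* D₂ :* E₈ :* E₂ := E₁ :* (D₂ :* E₂ :* E₈)) refl D₂ E₁ E₂ E₈)
    (trans (*-cong refl t) (trans (solve 2 (λ E₁ E₄ → E₁ :* (E₄ :* (E₄ :* E₄)) := E₁ :* E₄ :* (E₄ :* E₄)) refl E₁ E₄)
    (trans (*-cong (sym g) refl) (solve 3 (λ ψ⁻ E₂ E₄ → ψ⁻ :* E₂ :* (E₄ :* E₄) := ψ⁻ :* (E₄ :* E₄) :* E₂) refl ψ⁻ E₂ E₄))))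

  -- The product for φ(-q⁴) needs no further limit: the factorisation of ψ(q) ψ(-q) determines it
  -- from the products for ψ and its twists, and two instances of E(-q) E(q) E(q⁴) = E(q²)³ collect
  -- the rest. The common factor is left to be cancelled.
  φ⁻₄E₈-E₄² : ∀ {D D₂ E₁ E₂ E₄ E₈ ψ ψ⁻ ψ⁻₂ φ⁻₄} → ψ * ψ⁻ ≈ ψ⁻₂ * φ⁻₄ → ψ⁻₂ * D₂ ≈ E₄ * E₄ → ψ * E₁ ≈ E₂ * E₂ → ψ⁻ * D ≈ E₂ * E₂ →
    D₂ * E₂ * E₈ ≈ E₄ * (E₄ * E₄) → D * E₁ * E₄ ≈ E₂ * (E₂ * E₂) →
    (φ⁻₄ * E₈) * (E₄ * E₄ * (E₁ * D)) ≈ (E₄ * E₄) * (E₄ * E₄ * (E₁ * D))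
  φ⁻₄E₈-E₄² {D} {D₂} {E₁} {E₂} {E₄} {E₈} {ψ} {ψ⁻} {ψ⁻₂} {φ⁻₄} l g₂ g g⁻ t₂ t =
    trans (*-cong refl (*-cong (sym g₂) refl))
    (trans (solve 6 (λ φ⁻₄ E₈ ψ⁻₂ D₂ E₁ D → φ⁻₄ :* E₈ :* (ψ⁻₂ :* D₂ :* (E₁ :* D)) := ψ⁻₂ :* φ⁻₄ :* (D₂ :* E₈ :* (E₁ :* D))) refl φ⁻₄ E₈ ψ⁻₂ D₂ E₁ D)
    (trans (*-cong (sym l) refl)
    (trans (solve 6 (λ ψ ψ⁻ D₂ E₈ E₁ D → ψ :* ψ⁻ :* (D₂ :* E₈ :* (E₁ :* D)) := ψ :* E₁ :* (ψ⁻ :* D) :* (D₂ :* E₈)) refl ψ ψ⁻ D₂ E₈ E₁ D)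
    (trans (*-cong (*-cong g g⁻) refl)
    (trans (solve 3 (λ E₂ D₂ E₈ → E₂ :* E₂ :* (E₂ :* E₂) :* (D₂ :* E₈) := E₂ :* (E₂ :* E₂) :* (D₂ :* E₂ :* E₈)) refl E₂ D₂ E₈)
    (trans (*-cong (sym t) t₂)
    (solve 3 (λ D E₁ E₄ → D :* E₁ :* E₄ :* (E₄ :* (E₄ :* E₄)) := E₄ :* E₄ :* (E₄ :* E₄ :* (E₁ :* D))) refl D E₁ E₄)))))))

  DD̄ : ∀ {D D̄ d₀ d₁ m m²} → D ≈ d₀ + m * d₁ → D̄ ≈ d₀ + - (m * d₁) → m * m ≈ m² → d₀ * d₀ + - (m² * (d₁ * d₁)) ≈ D * D̄
  DD̄ {D} {D̄} {d₀} {d₁} {m} {m²} p p̄ mm = trans (+-cong refl (-‿cong (*-cong (sym mm) refl)))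
    (trans (solve 3 (λ d₀ d₁ m → d₀ :* d₀ :+ :- (m :* m :* (d₁ :* d₁)) := (d₀ :+ m :* d₁) :* (d₀ :+ :- (m :* d₁))) refl d₀ d₁ m)
    (sym (*-cong p p̄)))

  Dp : ∀ {D d₀ d₁ m} p → D ≈ d₀ + m * d₁ → d₀ * p + m * (d₁ * p) ≈ D * p
  Dp {D} {d₀} {d₁} {m} p q = trans (solve 4 (λ d₀ d₁ m p → d₀ :* p :+ m :* (d₁ :* p) := (d₀ :+ m :* d₁) :* p) refl d₀ d₁ m p)
    (*-cong (sym q) refl)

  -- Adding D D′ and D̄ D̄′ cancels the cross terms d₀ d₁′ and d₁ d₀′, so what remains is twice the
  -- left side of the lattice identity `E₈E₇`.
  sum-EE : ∀ {D D̄ D′ D̄′ d₀ d₁ d₀′ d₁′ m m′ mm′ n p E₈ E₇ x₀ x₁ k} →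
    D ≈ d₀ + m * d₁ → D̄ ≈ d₀ + - (m * d₁) → D′ ≈ d₀′ + m′ * d₁′ → D̄′ ≈ d₀′ + - (m′ * d₁′) → m * m′ ≈ mm′ →
    d₀ * d₀′ + (mm′ * (d₁ * d₁′) + n * p) ≈ E₈ * x₀ + - (k * (E₈ * x₁)) → E₇ ≈ x₀ + - (k * x₁) →
    D * D′ + (D̄ * D̄′ + (n * p + n * p)) ≈ E₈ * E₇ + E₈ * E₇
  sum-EE {D} {D̄} {D′} {D̄′} {d₀} {d₁} {d₀′} {d₁′} {m} {m′} {mm′} {n} {p} {E₈} {E₇} {x₀} {x₁} {k} a b c d e f g =
    trans (+-cong (*-cong a c) (+-cong (*-cong b d) refl))
    (trans (solve 8 (λ d₀ d₁ d₀′ d₁′ m m′ n p →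
        (d₀ :+ m :* d₁) :* (d₀′ :+ m′ :* d₁′) :+ ((d₀ :+ :- (m :* d₁)) :* (d₀′ :+ :- (m′ :* d₁′)) :+ (n :* p :+ n :* p))
        := (d₀ :* d₀′ :+ (m :* m′ :* (d₁ :* d₁′) :+ n :* p)) :+ (d₀ :* d₀′ :+ (m :* m′ :* (d₁ :* d₁′) :+ n :* p))) refl d₀ d₁ d₀′ d₁′ m m′ n p)
    (trans (+-cong half half) refl))
    where
    half : d₀ * d₀′ + (m * m′ * (d₁ * d₁′) + n * p) ≈ E₈ * E₇
    half = trans (+-cong refl (+-cong (*-cong e refl) refl)) (trans f
      (trans (solve 4 (λ E₈ x₀ x₁ k → E₈ :* x₀ :+ :- (k :* (E₈ :* x₁)) := E₈ :* (x₀ :+ :- (k :* x₁))) refl E₈ x₀ x₁ k) (*-cong refl (sym g))))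

  -- Complementary to `sum-EE`: in the difference only the cross terms survive, which is the shape
  -- of `E₁E₅₆`.
  diff-EE : ∀ {D D̄ D′ D̄′ d₀ d₁ d₀′ d₁′ m m′ n p E₁ E₅₆ x₀ x₁ k l} →
    D ≈ d₀ + m * d₁ → D̄ ≈ d₀ + - (m * d₁) → D′ ≈ d₀′ + m′ * d₁′ → D̄′ ≈ d₀′ + - (m′ * d₁′) →
    m′ * (d₀ * d₁′) + (m * (d₁ * d₀′) + - (n * p)) ≈ m * (x₀ * E₅₆) + - (l * (x₁ * E₅₆)) → E₁ ≈ x₀ + - (k * x₁) → m * k ≈ l →
    D * D′ + (- 1′) * (D̄ * D̄′ + (n * p + n * p)) ≈ m * (E₁ * E₅₆) + m * (E₁ * E₅₆)
  diff-EE {D} {D̄} {D′} {D̄′} {d₀} {d₁} {d₀′} {d₁′} {m} {m′} {n} {p} {E₁} {E₅₆} {x₀} {x₁} {k} {l} a b c d f g e =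
    trans (+-cong (*-cong a c) (*-cong refl (+-cong (*-cong b d) refl)))
    (trans (solve 8 (λ d₀ d₁ d₀′ d₁′ m m′ n p →
        (d₀ :+ m :* d₁) :* (d₀′ :+ m′ :* d₁′) :+ (:- :1) :* ((d₀ :+ :- (m :* d₁)) :* (d₀′ :+ :- (m′ :* d₁′)) :+ (n :* p :+ n :* p))
        := (m′ :* (d₀ :* d₁′) :+ (m :* (d₁ :* d₀′) :+ :- (n :* p))) :+ (m′ :* (d₀ :* d₁′) :+ (m :* (d₁ :* d₀′) :+ :- (n :* p)))) refl d₀ d₁ d₀′ d₁′ m m′ n p)
    (+-cong half half))
    where
    half : m′ * (d₀ * d₁′) + (m * (d₁ * d₀′) + - (n * p)) ≈ m * (E₁ * E₅₆)
    half = trans f (trans (+-cong refl (-‿cong (*-cong (sym e) refl)))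
      (trans (solve 5 (λ m k x₀ x₁ E₅₆ → m :* (x₀ :* E₅₆) :+ :- (m :* k :* (x₁ :* E₅₆)) := m :* ((x₀ :+ :- (k :* x₁)) :* E₅₆)) refl m k x₀ x₁ E₅₆)
      (*-cong refl (*-cong (sym g) refl))))

  -- Each of the three products has a factor D after multiplication by e, and likewise for the
  -- primed series, so D D′ factors out of the whole combination. The sign `c` is 1 for A + C and -1
  -- for B - C.
  combine : ∀ {φ φ′ ξ ξ′ κ κ′ e e′ D D̄ D′ D̄′ p p′ n g} c →
    φ * e ≈ D * D → φ′ * e′ ≈ D′ * D′ → ξ * e ≈ D * D̄ → ξ′ * e′ ≈ D′ * D̄′ → κ * e ≈ D * p → κ′ * e′ ≈ D′ * p′ →
    D * D′ + c * (D̄ * D̄′ + (n * (p * p′) + n * (p * p′))) ≈ g →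
    (φ * φ′ + c * (ξ * ξ′ + (n * (κ * κ′) + n * (κ * κ′)))) * (e * e′) ≈ (D * D′) * g
  combine {φ} {φ′} {ξ} {ξ′} {κ} {κ′} {e} {e′} {D} {D̄} {D′} {D̄′} {p} {p′} {n} {g} c a a′ b b′ d d′ f =
    trans (solve 10 (λ φ φ′ ξ ξ′ κ κ′ e e′ n c →
        (φ :* φ′ :+ c :* (ξ :* ξ′ :+ (n :* (κ :* κ′) :+ n :* (κ :* κ′)))) :* (e :* e′)
        := φ :* e :* (φ′ :* e′) :+ c :* (ξ :* e :* (ξ′ :* e′) :+ (n :* (κ :* e :* (κ′ :* e′)) :+ n :* (κ :* e :* (κ′ :* e′)))))
        refl φ φ′ ξ ξ′ κ κ′ e e′ n c)
    (trans (+-cong (*-cong a a′) (*-cong refl (+-cong (*-cong b b′) (+-cong nk nk))))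
    (trans (solve 8 (λ D D̄ D′ D̄′ p p′ n c →
        D :* D :* (D′ :* D′) :+ c :* (D :* D̄ :* (D′ :* D̄′) :+ (n :* (D :* p :* (D′ :* p′)) :+ n :* (D :* p :* (D′ :* p′))))
        := D :* D′ :* (D :* D′ :+ c :* (D̄ :* D̄′ :+ (n :* (p :* p′) :+ n :* (p :* p′))))) refl D D̄ D′ D̄′ p p′ n c)
    (*-cong refl f)))
    where
    nk : n * (κ * e * (κ′ * e′)) ≈ n * (D * p * (D′ * p′))
    nk = *-cong refl (*-cong d d′)

  A+C-clear : ∀ {F D D₁₄ E₂ E₄ E₇ E₈ E₂₈ E₅₆ ψ ψ⁻₇} → F * (E₂ * E₂₈) ≈ D * D₁₄ * (E₈ * E₇ + E₈ * E₇) →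
    D * E₄ ≈ ψ * E₂ → E₇ * D₁₄ * E₅₆ ≈ ψ⁻₇ * (E₂₈ * E₂₈) →
    F * (E₄ * E₅₆) * (E₂ * E₂₈) ≈ (ψ * ψ⁻₇ + ψ * ψ⁻₇) * (E₈ * E₂₈) * (E₂ * E₂₈)
  A+C-clear {F} {D} {D₁₄} {E₂} {E₄} {E₇} {E₈} {E₂₈} {E₅₆} {ψ} {ψ⁻₇} a b c =
    trans (solve 5 (λ F E₂ E₂₈ E₄ E₅₆ → F :* (E₄ :* E₅₆) :* (E₂ :* E₂₈) := F :* (E₂ :* E₂₈) :* (E₄ :* E₅₆)) refl F E₂ E₂₈ E₄ E₅₆)
    (trans (*-cong a refl)
    (trans (solve 6 (λ D D₁₄ E₄ E₇ E₈ E₅₆ → D :* D₁₄ :* (E₈ :* E₇ :+ E₈ :* E₇) :* (E₄ :* E₅₆)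
        := D :* E₄ :* (E₇ :* D₁₄ :* E₅₆) :* (E₈ :+ E₈)) refl D D₁₄ E₄ E₇ E₈ E₅₆)
    (trans (*-cong (*-cong b c) refl)
    (solve 5 (λ ψ ψ⁻₇ E₂ E₈ E₂₈ → ψ :* E₂ :* (ψ⁻₇ :* (E₂₈ :* E₂₈)) :* (E₈ :+ E₈)
        := (ψ :* ψ⁻₇ :+ ψ :* ψ⁻₇) :* (E₈ :* E₂₈) :* (E₂ :* E₂₈)) refl ψ ψ⁻₇ E₂ E₈ E₂₈))))

  B-C-clear : ∀ {F D₂ D₇ E₁ E₄ E₈ E₁₄ E₂₈ E₅₆ m ψ⁻ ψ₇} → F * (E₄ * E₁₄) ≈ D₂ * D₇ * (m * (E₁ * E₅₆) + m * (E₁ * E₅₆)) →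
    E₁ * D₂ * E₈ ≈ ψ⁻ * (E₄ * E₄) → D₇ * E₂₈ ≈ ψ₇ * E₁₄ →
    F * (E₈ * E₂₈) * (E₄ * E₁₄) ≈ (ψ⁻ * ψ₇ + ψ⁻ * ψ₇) * (m * (E₄ * E₅₆)) * (E₄ * E₁₄)
  B-C-clear {F} {D₂} {D₇} {E₁} {E₄} {E₈} {E₁₄} {E₂₈} {E₅₆} {m} {ψ⁻} {ψ₇} a b c =
    trans (solve 5 (λ F E₈ E₂₈ E₄ E₁₄ → F :* (E₈ :* E₂₈) :* (E₄ :* E₁₄) := F :* (E₄ :* E₁₄) :* (E₈ :* E₂₈)) refl F E₈ E₂₈ E₄ E₁₄)
    (trans (*-cong a refl)
    (trans (solve 7 (λ D₂ D₇ E₁ E₈ E₂₈ E₅₆ m → D₂ :* D₇ :* (m :* (E₁ :* E₅₆) :+ m :* (E₁ :* E₅₆)) :* (E₈ :* E₂₈)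
        := E₁ :* D₂ :* E₈ :* (D₇ :* E₂₈) :* (m :* E₅₆ :+ m :* E₅₆)) refl D₂ D₇ E₁ E₈ E₂₈ E₅₆ m)
    (trans (*-cong (*-cong b c) refl)
    (solve 6 (λ ψ⁻ ψ₇ E₄ E₁₄ E₅₆ m → ψ⁻ :* (E₄ :* E₄) :* (ψ₇ :* E₁₄) :* (m :* E₅₆ :+ m :* E₅₆)
        := (ψ⁻ :* ψ₇ :+ ψ⁻ :* ψ₇) :* (m :* (E₄ :* E₅₆)) :* (E₄ :* E₁₄)) refl ψ⁻ ψ₇ E₄ E₁₄ E₅₆ m))))

  -- Division of the two hypotheses eliminates s, and replacing D and D₇ by E₂³/(E₁ E₄) and E₁₄³/(E₇
  -- E₂₈) leaves n/d = E₁ E₁₄/(E₂ E₇). `residue₀` arrives at the same quotient up to the factor m;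
  -- this is why the two classes recombine.
  residue₁ : ∀ {n d s D D₇ E₁ E₂ E₄ E₇ E₁₄ E₂₈} → n * (D * E₁₄) ≈ s * (E₂ * D₇) → d * (E₂ * E₂₈) ≈ s * (E₄ * E₁₄) →
    D * E₁ * E₄ ≈ E₂ * (E₂ * E₂) → D₇ * E₇ * E₂₈ ≈ E₁₄ * (E₁₄ * E₁₄) →
    n * (E₂ * E₇) * (D * E₁₄ * (E₂ * E₂₈)) ≈ d * (E₁ * E₁₄) * (D * E₁₄ * (E₂ * E₂₈))
  residue₁ {n} {d} {s} {D} {D₇} {E₁} {E₂} {E₄} {E₇} {E₁₄} {E₂₈} a b t t₇ =
    trans (solve 6 (λ n D E₂ E₇ E₁₄ E₂₈ → n :* (E₂ :* E₇) :* (D :* E₁₄ :* (E₂ :* E₂₈)) := n :* (D :* E₁₄) :* (E₂ :* E₂ :* (E₇ :* E₂₈))) refl n D E₂ E₇ E₁₄ E₂₈)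
    (trans (*-cong a refl)
    (trans (solve 5 (λ s D₇ E₂ E₇ E₂₈ → s :* (E₂ :* D₇) :* (E₂ :* E₂ :* (E₇ :* E₂₈)) := s :* (E₂ :* (E₂ :* E₂) :* (D₇ :* E₇ :* E₂₈))) refl s D₇ E₂ E₇ E₂₈)
    (trans (*-cong refl (*-cong (sym t) t₇))
    (trans (solve 5 (λ s D E₁ E₄ E₁₄ → s :* (D :* E₁ :* E₄ :* (E₁₄ :* (E₁₄ :* E₁₄))) := s :* (E₄ :* E₁₄) :* (D :* E₁ :* (E₁₄ :* E₁₄))) refl s D E₁ E₄ E₁₄)
    (trans (*-cong (sym b) refl)
    (solve 6 (λ d D E₁ E₂ E₁₄ E₂₈ → d :* (E₂ :* E₂₈) :* (D :* E₁ :* (E₁₄ :* E₁₄)) := d :* (E₁ :* E₁₄) :* (D :* E₁₄ :* (E₂ :* E₂₈))) refl d D E₁ E₂ E₁₄ E₂₈))))))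

  residue₀ : ∀ {n d s m D D₇ E₁ E₂ E₄ E₇ E₁₄ E₂₈} → n * (E₄ * E₁₄) ≈ s * (m * (E₂ * E₂₈)) → d * (E₂ * D₇) ≈ s * (D * E₁₄) →
    D * E₁ * E₄ ≈ E₂ * (E₂ * E₂) → D₇ * E₇ * E₂₈ ≈ E₁₄ * (E₁₄ * E₁₄) →
    n * (E₂ * E₇) * (E₄ * E₁₄ * (E₂ * D₇)) ≈ m * d * (E₁ * E₁₄) * (E₄ * E₁₄ * (E₂ * D₇))
  residue₀ {n} {d} {s} {m} {D} {D₇} {E₁} {E₂} {E₄} {E₇} {E₁₄} {E₂₈} a b t t₇ =
    trans (solve 6 (λ n D₇ E₂ E₇ E₄ E₁₄ → n :* (E₂ :* E₇) :* (E₄ :* E₁₄ :* (E₂ :* D₇)) := n :* (E₄ :* E₁₄) :* (E₂ :* E₂ :* (E₇ :* D₇))) refl n D₇ E₂ E₇ E₄ E₁₄)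
    (trans (*-cong a refl)
    (trans (solve 6 (λ s m D₇ E₂ E₇ E₂₈ → s :* (m :* (E₂ :* E₂₈)) :* (E₂ :* E₂ :* (E₇ :* D₇)) := s :* m :* (E₂ :* (E₂ :* E₂) :* (D₇ :* E₇ :* E₂₈))) refl s m D₇ E₂ E₇ E₂₈)
    (trans (*-cong refl (*-cong (sym t) t₇))
    (trans (solve 6 (λ s m D E₁ E₄ E₁₄ → s :* m :* (D :* E₁ :* E₄ :* (E₁₄ :* (E₁₄ :* E₁₄))) := s :* (D :* E₁₄) :* (m :* E₁ :* E₄ :* (E₁₄ :* E₁₄))) refl s m D E₁ E₄ E₁₄)
    (trans (*-cong (sym b) refl)
    (solve 7 (λ d m D₇ E₁ E₂ E₄ E₁₄ → d :* (E₂ :* D₇) :* (m :* E₁ :* E₄ :* (E₁₄ :* E₁₄)) := m :* d :* (E₁ :* E₁₄) :* (E₄ :* E₁₄ :* (E₂ :* D₇))) refl d m D₇ E₁ E₂ E₄ E₁₄))))))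

  theta-diff : ∀ a x c y m → a + m * x + - (c + m * y) ≈ (a + - c) + m * (x + - y)
  theta-diff = solve 5 (λ a x c y m → a :+ m :* x :+ :- (c :+ m :* y) := (a :+ :- c) :+ m :* (x :+ :- y)) refl

  theta-sum : ∀ a x c y m → a + m * x + (c + m * y) ≈ (a + c) + m * (x + y)
  theta-sum = solve 5 (λ a x c y m → a :+ m :* x :+ (c :+ m :* y) := (a :+ c) :+ m :* (x :+ y)) refl

  -- Multiplication by m₁ = q moves the class 0 of the denominator to the class 1 and its class 3 to
  -- the class 0, with the carry m₄ = q⁴. The quotient p/r is common to both classes.
  assemble-dissection : ∀ {n₀ n₁ d₀ d₃ p r m₁ m₃ m₄} → n₀ * p ≈ m₄ * d₃ * r → n₁ * p ≈ d₀ * r → m₁ * m₃ ≈ m₄ →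
    (n₀ + m₁ * n₁) * p ≈ m₁ * r * (d₀ + m₃ * d₃)
  assemble-dissection {n₀} {n₁} {d₀} {d₃} {p} {r} {m₁} {m₃} {m₄} a b c =
    trans (solve 4 (λ n₀ n₁ p m₁ → (n₀ :+ m₁ :* n₁) :* p := n₀ :* p :+ m₁ :* (n₁ :* p)) refl n₀ n₁ p m₁)
    (trans (+-cong (trans a (*-cong (*-cong (sym c) refl) refl)) (*-cong refl b))
    (solve 5 (λ d₀ d₃ r m₁ m₃ → m₁ :* m₃ :* d₃ :* r :+ m₁ :* (d₀ :* r) := m₁ :* r :* (d₀ :+ m₃ :* d₃)) refl d₀ d₃ r m₁ m₃))

open import Data.Bool using (Bool; true; false; _∧_; _xor_; not)
open import Data.Nat as ℕ using (zero; suc; _∸_; NonZero; z≤n; s≤s; _≤_; _<_)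
import Data.Nat.Properties as ℕP
import Data.Nat.DivMod as ℕD
open import Data.Nat.Divisibility using (_∣_; _∣?_; divides; m∣m*n; ∣m+n∣m⇒∣n; ∣1⇒≡1)
open import Data.Nat.Induction using (<-rec)
import Data.Nat.Tactic.RingSolver as ℕR
open ℤ using (ℤ; -[1+_]; -1ℤ; _+_; _*_; _-_; -_; ∣_∣)
import Data.Integer.Properties as ℤP
open import Data.Integer.DivMod using (_/ℕ_; _%ℕ_; a≡a%ℕn+[a/ℕn]*n; n%ℕd<d)
open import Data.Integer.Tactic.RingSolver using (solve-∀)
open import Data.List using (List; []; _∷_; _++_; _∷ʳ_; map; concatMap; length; filter; foldr; upTo; cartesianProduct)
import Data.List.Properties as LP
open import Data.List.Membership.Propositional using (_∈_; find; lose)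
open import Data.List.Membership.Propositional.Properties using (∈-map⁺; ∈-map⁻; ∈-++⁺ˡ; ∈-++⁺ʳ; ∈-++⁻; ∈-concatMap⁺; ∈-concatMap⁻; ∈-cartesianProduct⁺; ∈-cartesianProduct⁻; ∈-filter⁺; ∈-filter⁻; ∈-upTo⁺; ∈-upTo⁻)
open import Data.List.Membership.Propositional.Properties.WithK using (unique∧set⇒bag)
open import Data.List.Relation.Binary.BagAndSetEquality using (∼bag⇒↭)
open import Data.List.Relation.Binary.Permutation.Propositional using (_↭_)
open import Data.List.Relation.Unary.Any using (here; there)
open import Data.List.Relation.Unary.All as All using (All; []; _∷_)
import Data.List.Relation.Unary.All.Properties as AllP
open import Data.List.Relation.Unary.AllPairs as AllPairs using ([]; _∷_)
import Data.List.Relation.Unary.AllPairs.Properties as AllPairsP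
open import Data.List.Relation.Unary.Unique.Propositional using (Unique)
import Data.List.Relation.Unary.Unique.Propositional.Properties as UP
open import Data.Product using (Σ; _×_; _,_; proj₁; proj₂)
open import Data.Sum using (_⊎_; inj₁; inj₂; [_,_])
open import Data.Sum.Properties using (inj₁-injective; inj₂-injective)
open import Data.Unit using (⊤; tt)
open import Data.Empty using (⊥; ⊥-elim)
open import Function using (_∘_; id; mk⇔)
open import Algebra.Bundles using (CommutativeRing)
open import Algebra.Properties.AbelianGroup ℤP.+-0-abelianGroup using () renaming (∙-cancelˡ to +-cancelˡ)
open import Relation.Nullary using (¬_; yes; no; contradiction)
open import Relation.Binary.PropositionalEquality using (_≢_; refl; sym; trans; cong; cong₂; subst; module ≡-Reasoning)

infix 4 _≈_
_≈_ : FPS → FPS → Set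
f ≈ g = ∀ n → f n ≡ g n

-- Weighted finite sums and power series as generating functions.

module _ {I : Set} where

  sumOver : (I → ℤ) → List I → ℤ
  sumOver w xs = foldr _+_ (+ 0) (map w xs)

  sumOver-cong : {w v : I → ℤ} → (∀ i → w i ≡ v i) → ∀ xs → sumOver w xs ≡ sumOver v xs
  sumOver-cong w≗v xs = cong (foldr _+_ (+ 0)) (LP.map-cong w≗v xs)

  sumOver-cong-∈ : {w v : I → ℤ} → ∀ xs → (∀ {i} → i ∈ xs → w i ≡ v i) → sumOver w xs ≡ sumOver v xs
  sumOver-cong-∈ []       p = refl
  sumOver-cong-∈ (x ∷ xs) p = cong₂ _+_ (p (here refl)) (sumOver-cong-∈ xs (λ i∈ → p (there i∈)))

  sumOver-++ : (w : I → ℤ) → ∀ xs ys → sumOver w (xs ++ ys) ≡ sumOver w xs + sumOver w ys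
  sumOver-++ w []       ys = sym (ℤP.+-identityˡ _)
  sumOver-++ w (x ∷ xs) ys = trans (cong (_+_ (w x)) (sumOver-++ w xs ys)) (sym (ℤP.+-assoc (w x) _ _))

  sumOver-↭ : (w : I → ℤ) → ∀ {xs ys} → xs ↭ ys → sumOver w xs ≡ sumOver w ys
  sumOver-↭ w _↭_.refl         = refl
  sumOver-↭ w (_↭_.prep x p)   = cong (_+_ (w x)) (sumOver-↭ w p)
  sumOver-↭ w (_↭_.swap x y p) = trans (lemma (w x) (w y) _) (cong (λ s → w y + (w x + s)) (sumOver-↭ w p))
    where
    lemma : ∀ a b c → a + (b + c) ≡ b + (a + c)
    lemma = solve-∀
  sumOver-↭ w (_↭_.trans p q)  = trans (sumOver-↭ w p) (sumOver-↭ w q)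

  sumOver-set : (w : I → ℤ) → ∀ {xs ys} → Unique xs → Unique ys →
                (∀ {i} → i ∈ xs → i ∈ ys) → (∀ {i} → i ∈ ys → i ∈ xs) →
                sumOver w xs ≡ sumOver w ys
  sumOver-set w uxs uys to from =
    sumOver-↭ w (∼bag⇒↭ (unique∧set⇒bag uxs uys (mk⇔ to from)))

  sumOver-neg : (w : I → ℤ) → ∀ xs → sumOver (λ i → - w i) xs ≡ - sumOver w xs
  sumOver-neg w []       = refl
  sumOver-neg w (x ∷ xs) = trans (cong (_+_ (- w x)) (sumOver-neg w xs)) (sym (ℤP.neg-distrib-+ (w x) _))

  sumOver-*ˡ : ∀ c (w : I → ℤ) xs → sumOver (λ i → c * w i) xs ≡ c * sumOver w xs
  sumOver-*ˡ c w []       = sym (ℤP.*-zeroʳ c)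
  sumOver-*ˡ c w (x ∷ xs) = trans (cong (_+_ (c * w x)) (sumOver-*ˡ c w xs)) (sym (ℤP.*-distribˡ-+ c (w x) _))

  sumOver-+ : (w v : I → ℤ) → ∀ xs → sumOver (λ i → w i + v i) xs ≡ sumOver w xs + sumOver v xs
  sumOver-+ w v []       = refl
  sumOver-+ w v (x ∷ xs) = trans (cong (_+_ (w x + v x)) (sumOver-+ w v xs)) (lemma (w x) (v x) _ _)
    where
    lemma : ∀ a b c d → a + b + (c + d) ≡ a + c + (b + d)
    lemma = solve-∀

sumOver-map : {I J : Set} (w : I → ℤ) (φ : J → I) → ∀ xs → sumOver w (map φ xs) ≡ sumOver (w ∘ φ) xs
sumOver-map w φ xs = cong (foldr _+_ (+ 0)) (sym (LP.map-∘ xs))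

sumOver-concatMap : {I J : Set} (w : I → ℤ) (φ : J → List I) → ∀ xs →
                    sumOver w (concatMap φ xs) ≡ sumOver (λ j → sumOver w (φ j)) xs
sumOver-concatMap w φ []       = refl
sumOver-concatMap w φ (x ∷ xs) = trans (sumOver-++ w (φ x) _) (cong (_+_ (sumOver w (φ x))) (sumOver-concatMap w φ xs))

sumOver-cartesian : {I J : Set} (w : I → ℤ) (v : J → ℤ) → ∀ xs ys →
                    sumOver (λ p → w (proj₁ p) * v (proj₂ p)) (cartesianProduct xs ys) ≡ sumOver w xs * sumOver v ys
sumOver-cartesian w v []       ys = refl
sumOver-cartesian w v (x ∷ xs) ys = begin
  sumOver u (map (x ,_) ys ++ cartesianProduct xs ys)               ≡⟨ sumOver-++ u (map (x ,_) ys) _ ⟩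
  sumOver u (map (x ,_) ys) + sumOver u (cartesianProduct xs ys)    ≡⟨ cong₂ _+_ (sumOver-map u (x ,_) ys) (sumOver-cartesian w v xs ys) ⟩
  sumOver (λ y → w x * v y) ys + sumOver w xs * sumOver v ys        ≡⟨ cong (_+ sumOver w xs * sumOver v ys) (sumOver-*ˡ (w x) v ys) ⟩
  w x * sumOver v ys + sumOver w xs * sumOver v ys                  ≡⟨ ℤP.*-distribʳ-+ (sumOver v ys) (w x) _ ⟨
  (w x + sumOver w xs) * sumOver v ys                               ∎
  where
  open ≡-Reasoning
  u = λ p → w (proj₁ p) * v (proj₂ p)

-- GF e w f says that f = Σ_{i ∈ I} w(i) q^{e(i)}, with finite fibres of e.
record GF {I : Set} (e w : I → ℤ) (f : FPS) : Set where
  field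
    nonneg   : ∀ i → e i ≡ + ∣ e i ∣
    fib      : ℕ → List I
    unique   : ∀ N → Unique (fib N)
    sound    : ∀ {N i} → i ∈ fib N → e i ≡ + N
    complete : ∀ {N} i → e i ≡ + N → i ∈ fib N
    value    : ∀ N → f N ≡ sumOver w (fib N)

open GF

record _≅_ (J I : Set) : Set where
  field
    to      : J → I
    from    : I → J
    to∘from : ∀ i → to (from i) ≡ i
    from∘to : ∀ j → from (to j) ≡ j

open _≅_

id≅ : {I : Set} → I ≅ I
id≅ = record { to = id ; from = id ; to∘from = λ _ → refl ; from∘to = λ _ → refl }

module _ {I : Set} {e w : I → ℤ} where

  gf-resp : ∀ {f g} → f ≈ g → GF e w f → GF e w g
  gf-resp f≈g F = record
    { nonneg = nonneg F ; fib = fib F ; unique = unique F ; sound = sound F ; complete = complete F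
    ; value = λ N → trans (sym (f≈g N)) (value F N) }

  gf-map : ∀ {J : Set} {e′ w′ : J → ℤ} {f} (β : J ≅ I) →
           (∀ j → e (to β j) ≡ e′ j) → (∀ j → w (to β j) ≡ w′ j) → GF e w f → GF e′ w′ f
  gf-map {J} {e′} {w′} {f} β ee ww F = record
    { nonneg   = λ j → subst (λ z → z ≡ + ∣ z ∣) (ee j) (nonneg F (to β j))
    ; fib      = λ N → map (from β) (fib F N)
    ; unique   = λ N → UP.map⁺ from-inj (unique F N)
    ; sound    = snd
    ; complete = λ {N} j ej → subst (_∈ map (from β) (fib F N)) (from∘to β j)
                   (∈-map⁺ (from β) (complete F (to β j) (trans (ee j) ej)))
    ; value    = λ N → begin
        f N                                    ≡⟨ value F N ⟩
        sumOver w (fib F N)                    ≡⟨ sumOver-cong (λ i → cong w (sym (to∘from β i))) (fib F N) ⟩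
        sumOver (w ∘ to β ∘ from β) (fib F N)  ≡⟨ sumOver-cong (λ i → ww (from β i)) (fib F N) ⟩
        sumOver (w′ ∘ from β) (fib F N)        ≡⟨ sumOver-map w′ (from β) (fib F N) ⟨
        sumOver w′ (map (from β) (fib F N))    ∎
    }
    where
    open ≡-Reasoning
    from-inj : ∀ {i j} → from β i ≡ from β j → i ≡ j
    from-inj {i} {j} p = trans (sym (to∘from β i)) (trans (cong (to β) p) (to∘from β j))
    snd : ∀ {N j} → j ∈ map (from β) (fib F N) → e′ j ≡ + N
    snd {N} j∈ with ∈-map⁻ (from β) j∈
    ... | i , i∈ , refl = trans (sym (ee (from β i))) (trans (cong e (to∘from β i)) (sound F i∈))

  -- Fibres over N are duplicate-free and characterised by e i = N, so two of them are permutations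
  -- of each other. Hence an identity of series only requires the same exponents and weights on a
  -- common index set.
  gf-unique : ∀ {f g} → GF e w f → GF e w g → f ≈ g
  gf-unique F G N = trans (value F N) (trans
    (sumOver-set w (unique F N) (unique G N) (λ i∈ → complete G _ (sound F i∈)) (λ i∈ → complete F _ (sound G i∈)))
    (sym (value G N)))

  gf-cong : ∀ {e′ w′ f} → (∀ i → e i ≡ e′ i) → (∀ i → w i ≡ w′ i) → GF e w f → GF e′ w′ f
  gf-cong = gf-map id≅

  gf-⊎ : ∀ {J : Set} {e′ w′ : J → ℤ} {f g} → GF e w f → GF e′ w′ g → GF [ e , e′ ] [ w , w′ ] (f ⊕ g)
  gf-⊎ {J} {e′} {w′} F G = record
    { nonneg   = [ nonneg F , nonneg G ]
    ; fib      = λ N → map inj₁ (fib F N) ++ map inj₂ (fib G N)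
    ; unique   = λ N → UP.++⁺ (UP.map⁺ inj₁-injective (unique F N)) (UP.map⁺ inj₂-injective (unique G N)) disj
    ; sound    = snd
    ; complete = λ { {N} (inj₁ i) ei → ∈-++⁺ˡ (∈-map⁺ inj₁ (complete F i ei))
                   ; {N} (inj₂ j) ej → ∈-++⁺ʳ (map inj₁ (fib F N)) (∈-map⁺ inj₂ (complete G j ej)) }
    ; value    = λ N → trans (cong₂ _+_ (value F N) (value G N)) (sym (trans
        (sumOver-++ [ w , w′ ] (map inj₁ (fib F N)) _)
        (cong₂ _+_ (sumOver-map _ inj₁ (fib F N)) (sumOver-map _ inj₂ (fib G N)))))
    }
    where
    disj : ∀ {N} {v : I ⊎ J} → v ∈ map inj₁ (fib F N) × v ∈ map inj₂ (fib G N) → ⊥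
    disj (p , q) with ∈-map⁻ inj₁ p | ∈-map⁻ inj₂ q
    ... | _ , _ , refl | _ , _ , ()
    snd : ∀ {N} {v : I ⊎ J} → v ∈ map inj₁ (fib F N) ++ map inj₂ (fib G N) → [ e , e′ ] v ≡ + N
    snd {N} v∈ with ∈-++⁻ (map inj₁ (fib F N)) v∈
    ... | inj₁ p with ∈-map⁻ inj₁ p
    ...   | _ , i∈ , refl = sound F i∈
    snd {N} v∈ | inj₂ p with ∈-map⁻ inj₂ p
    ...   | _ , i∈ , refl = sound G i∈

module _ {I J : Set} where

  lefts : List (I ⊎ J) → List I
  lefts []            = []
  lefts (inj₁ i ∷ xs) = i ∷ lefts xs
  lefts (inj₂ _ ∷ xs) = lefts xs

  ∈-lefts⁺ : ∀ {i} xs → inj₁ i ∈ xs → i ∈ lefts xs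
  ∈-lefts⁺ (inj₁ _ ∷ xs) (here refl) = here refl
  ∈-lefts⁺ (inj₁ _ ∷ xs) (there p)   = there (∈-lefts⁺ xs p)
  ∈-lefts⁺ (inj₂ _ ∷ xs) (there p)   = ∈-lefts⁺ xs p

  ∈-lefts⁻ : ∀ {i} xs → i ∈ lefts xs → inj₁ i ∈ xs
  ∈-lefts⁻ (inj₁ _ ∷ xs) (here refl) = here refl
  ∈-lefts⁻ (inj₁ _ ∷ xs) (there p)   = there (∈-lefts⁻ xs p)
  ∈-lefts⁻ (inj₂ _ ∷ xs) p           = there (∈-lefts⁻ xs p)

  lefts-unique : ∀ xs → Unique xs → Unique (lefts xs)
  lefts-unique []            []       = []
  lefts-unique (inj₁ i ∷ xs) (p ∷ ps) =
    All.tabulate (λ j∈ i≡j → All.lookup p (∈-lefts⁻ xs j∈) (cong inj₁ i≡j)) ∷ lefts-unique xs ps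
  lefts-unique (inj₂ _ ∷ xs) (_ ∷ ps) = lefts-unique xs ps

  -- The subseries carried by the left summand of the index set. It exists without any formula for
  -- it, which allows a series to be split before its pieces are identified.
  leftPart : ∀ {e w : I ⊎ J → ℤ} {f} → GF e w f → FPS
  leftPart {w = w} F N = sumOver (w ∘ inj₁) (lefts (fib F N))

  gf-left : ∀ {e w : I ⊎ J → ℤ} {f} (F : GF e w f) → GF (e ∘ inj₁) (w ∘ inj₁) (leftPart F)
  gf-left F = record
    { nonneg   = λ i → nonneg F (inj₁ i)
    ; fib      = λ N → lefts (fib F N)
    ; unique   = λ N → lefts-unique (fib F N) (unique F N)
    ; sound    = λ {N} i∈ → sound F (∈-lefts⁻ (fib F N) i∈)
    ; complete = λ {N} i ei → ∈-lefts⁺ (fib F N) (complete F (inj₁ i) ei)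
    ; value    = λ N → refl }

⊎-swap≅ : {I J : Set} → (I ⊎ J) ≅ (J ⊎ I)
⊎-swap≅ = record { to = sw ; from = sw ; to∘from = λ { (inj₁ _) → refl ; (inj₂ _) → refl }
                 ; from∘to = λ { (inj₁ _) → refl ; (inj₂ _) → refl } }
  where
  sw : {I J : Set} → I ⊎ J → J ⊎ I
  sw = [ inj₂ , inj₁ ]

module _ {I J : Set} {e w : I ⊎ J → ℤ} {f} (F : GF e w f) where

  rightPart : FPS
  rightPart = leftPart (gf-map ⊎-swap≅ (λ _ → refl) (λ _ → refl) F)

  gf-right : GF (e ∘ inj₂) (w ∘ inj₂) rightPart
  gf-right = gf-left (gf-map ⊎-swap≅ (λ _ → refl) (λ _ → refl) F)

  gf-⊎-split : f ≈ leftPart F ⊕ rightPart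
  gf-⊎-split = gf-unique F
    (gf-map {e = [ e ∘ inj₁ , e ∘ inj₂ ]} {w = [ w ∘ inj₁ , w ∘ inj₂ ]} id≅
      (λ { (inj₁ _) → refl ; (inj₂ _) → refl }) (λ { (inj₁ _) → refl ; (inj₂ _) → refl }) (gf-⊎ (gf-left F) gf-right))

module _ {I J : Set} {e w : I → ℤ} {e′ w′ : J → ℤ} {f g} (F : GF e w f) (G : GF e′ w′ g) where

  private
    fibre : ℕ → ℕ → List (I × J)
    fibre N a = cartesianProduct (fib F a) (fib G (N ∸ a))

    E× : I × J → ℤ
    E× (i , j) = e i + e′ j

    sound× : ∀ {N v} → v ∈ concatMap (fibre N) (upTo (suc N)) → E× v ≡ + N
    sound× {N} {i , j} v∈ with ∈-concatMap⁻ (fibre N) {xs = upTo (suc N)} v∈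
    ... | v∈′ with find v∈′
    ... | a , a∈ , v∈a with ∈-cartesianProduct⁻ (fib F a) (fib G (N ∸ a)) v∈a
    ...   | i∈ , j∈ = trans (cong₂ _+_ (sound F i∈) (sound G j∈)) (cong +_ (ℕP.m+[n∸m]≡n (ℕ.≤-pred (∈-upTo⁻ a∈))))

    complete× : ∀ {N} v → E× v ≡ + N → v ∈ concatMap (fibre N) (upTo (suc N))
    complete× {N} (i , j) p = ∈-concatMap⁺ (fibre N) (lose (∈-upTo⁺ (s≤s a≤N))
        (∈-cartesianProduct⁺ (complete F i (nonneg F i)) (complete G j (trans (nonneg G j) (cong +_ (sym b≡))))))
      where
      sum≡ : ∣ e i ∣ ℕ.+ ∣ e′ j ∣ ≡ N
      sum≡ = ℤP.+-injective (trans (sym (cong₂ _+_ (nonneg F i) (nonneg G j))) p)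
      a≤N : ∣ e i ∣ ℕ.≤ N
      a≤N = subst (∣ e i ∣ ℕ.≤_) sum≡ (ℕP.m≤m+n _ _)
      b≡ : N ∸ ∣ e i ∣ ≡ ∣ e′ j ∣
      b≡ = trans (cong (_∸ ∣ e i ∣) (sym sum≡)) (ℕP.m+n∸m≡n ∣ e i ∣ _)

    unique× : ∀ N → Unique (concatMap (fibre N) (upTo (suc N)))
    unique× N = UP.concat⁺
      (AllP.map⁺ (All.tabulate (λ {a} _ → UP.cartesianProduct⁺ (unique F a) (unique G (N ∸ a)))))
      (AllPairsP.map⁺ (AllPairs.map disj (UP.upTo⁺ (suc N))))
      where
      disj : ∀ {a b} → a ≢ b → ∀ {v} → ¬ (v ∈ fibre N a × v ∈ fibre N b)
      disj {a} {b} a≢b (p , q) = a≢b (ℤP.+-injective (trans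
        (sym (sound F (proj₁ (∈-cartesianProduct⁻ (fib F a) _ p))))
        (sound F (proj₁ (∈-cartesianProduct⁻ (fib F b) _ q)))))

  gf-⊛ : GF E× (λ v → w (proj₁ v) * w′ (proj₂ v)) (f ⊛ g)
  gf-⊛ = record
    { nonneg   = λ (i , j) → subst (λ z → z ≡ + ∣ z ∣) (sym (cong₂ _+_ (nonneg F i) (nonneg G j))) refl
    ; fib      = λ N → concatMap (fibre N) (upTo (suc N))
    ; unique   = unique×
    ; sound    = sound×
    ; complete = complete×
    ; value    = λ N → sym (trans (sumOver-concatMap _ (fibre N) (upTo (suc N)))
        (sumOver-cong (λ a → trans (sumOver-cartesian w w′ (fib F a) (fib G (N ∸ a)))
          (sym (cong₂ _*_ (value F a) (value G (N ∸ a))))) (upTo (suc N))))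
    }

-- Taking the coefficients as weights makes an arbitrary series a generating function, so that
-- commutativity and associativity of the convolution and the rules for dilation become reindexings.
gf-ℕ : ∀ f → GF +_ f f
gf-ℕ f = record
  { nonneg = λ _ → refl ; fib = λ N → N ∷ [] ; unique = λ _ → [] ∷ [] ; sound = λ { (here refl) → refl }
  ; complete = λ n p → here (ℤP.+-injective p) ; value = λ N → sym (ℤP.+-identityʳ (f N)) }

gf-mono : ∀ c → GF {⊤} (λ _ → + c) (λ _ → + 1) (mono c)
gf-mono c = record
  { nonneg = λ _ → refl ; fib = fb ; unique = uq ; sound = sd ; complete = cp ; value = vl }
  where
  fb : ℕ → List ⊤
  fb N with N ℕ.≟ c
  ... | yes _ = tt ∷ []
  ... | no  _ = []
  uq : ∀ N → Unique (fb N)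
  uq N with N ℕ.≟ c
  ... | yes _ = [] ∷ []
  ... | no  _ = []
  sd : ∀ {N i} → i ∈ fb N → + c ≡ + N
  sd {N} i∈ with N ℕ.≟ c
  sd {N} i∈ | yes p = cong +_ (sym p)
  sd {N} () | no _
  cp : ∀ {N} i → + c ≡ + N → i ∈ fb N
  cp {N} tt p with N ℕ.≟ c
  ... | yes _ = here refl
  ... | no ¬p = contradiction (sym (ℤP.+-injective p)) ¬p
  vl : ∀ N → mono c N ≡ sumOver (λ _ → + 1) (fb N)
  vl N with N ℕ.≟ c
  ... | yes _ = refl
  ... | no  _ = refl

module _ (k : ℕ) .{{_ : NonZero k}} where

  gf-dilate : ∀ {I : Set} {e w : I → ℤ} {f} → GF e w f → GF (λ i → + k * e i) w (dilate k f)
  gf-dilate {I} {e} {w} {f} F = record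
    { nonneg   = λ i → subst (λ z → + k * z ≡ + ∣ + k * z ∣) (sym (nonneg F i))
                   (trans (sym (ℤP.pos-* k _)) (cong (λ z → + ∣ z ∣) (ℤP.pos-* k _)))
    ; fib      = fb ; unique = uq ; sound = sd ; complete = cp ; value = vl }
    where
    fb : ℕ → List I
    fb N with k ∣? N
    ... | yes _ = fib F (N ℕD./ k)
    ... | no  _ = []
    uq : ∀ N → Unique (fb N)
    uq N with k ∣? N
    ... | yes _ = unique F (N ℕD./ k)
    ... | no  _ = []
    N≡ : ∀ {N} → k ∣ N → + N ≡ + k * + (N ℕD./ k)
    N≡ {N} k∣N = trans (cong +_ (sym (trans (ℕP.*-comm k _) (ℕD.m/n*n≡m k∣N)))) (ℤP.pos-* k _)
    sd : ∀ {N i} → i ∈ fb N → + k * e i ≡ + N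
    sd {N} i∈ with k ∣? N
    sd {N} i∈ | yes k∣N = trans (cong (+ k *_) (sound F i∈)) (sym (N≡ k∣N))
    sd {N} () | no _
    cp : ∀ {N} i → + k * e i ≡ + N → i ∈ fb N
    cp {N} i p with k ∣? N
    ... | yes k∣N = complete F i (ℤP.*-cancelˡ-≡ (+ k) (e i) _ (trans p (N≡ k∣N)))
    ... | no ¬k∣N = contradiction (divides ∣ e i ∣ (ℤP.+-injective (trans (sym p)
                      (trans (cong (+ k *_) (nonneg F i)) (trans (sym (ℤP.pos-* k _)) (cong +_ (ℕP.*-comm k _))))))) ¬k∣N
    vl : ∀ N → dilate k f N ≡ sumOver w (fb N)
    vl N with k ∣? N
    ... | yes _ = value F (N ℕD./ k)
    ... | no  _ = refl

-- The commutative ring of power series.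

≈-refl : ∀ {f} → f ≈ f
≈-refl _ = refl

≈-sym : ∀ {f g} → f ≈ g → g ≈ f
≈-sym p n = sym (p n)

≈-trans : ∀ {f g h} → f ≈ g → g ≈ h → f ≈ h
≈-trans p q n = trans (p n) (q n)

0F : FPS
0F _ = + 0

negF : FPS → FPS
negF f n = - f n

⊛-cong : ∀ {f f′ g g′} → f ≈ f′ → g ≈ g′ → f ⊛ g ≈ f′ ⊛ g′
⊛-cong p q n = sumOver-cong (λ i → cong₂ _*_ (p i) (q (n ∸ i))) (upTo (suc n))

⊕-cong : ∀ {f f′ g g′} → f ≈ f′ → g ≈ g′ → f ⊕ g ≈ f′ ⊕ g′
⊕-cong p q n = cong₂ _+_ (p n) (q n)

⊖-cong : ∀ {f f′ g g′} → f ≈ f′ → g ≈ g′ → f ⊖ g ≈ f′ ⊖ g′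
⊖-cong p q n = cong₂ _-_ (p n) (q n)

×-swap≅ : {I J : Set} → (I × J) ≅ (J × I)
×-swap≅ = record { to = λ (i , j) → j , i ; from = λ (j , i) → i , j ; to∘from = λ _ → refl ; from∘to = λ _ → refl }

×-assoc≅ : {I J K : Set} → (I × (J × K)) ≅ ((I × J) × K)
×-assoc≅ = record { to = λ (i , (j , k)) → (i , j) , k ; from = λ ((i , j) , k) → i , (j , k)
                  ; to∘from = λ _ → refl ; from∘to = λ _ → refl }

⊤×≅ : {I : Set} → I ≅ (⊤ × I)
⊤×≅ = record { to = tt ,_ ; from = proj₂ ; to∘from = λ _ → refl ; from∘to = λ _ → refl }

⊛-comm : ∀ f g → f ⊛ g ≈ g ⊛ f
⊛-comm f g = gf-unique (gf-⊛ (gf-ℕ f) (gf-ℕ g))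
  (gf-map ×-swap≅ (λ (i , j) → ℤP.+-comm (+ j) (+ i)) (λ (i , j) → ℤP.*-comm (g j) (f i)) (gf-⊛ (gf-ℕ g) (gf-ℕ f)))

⊛-assoc : ∀ f g h → (f ⊛ g) ⊛ h ≈ f ⊛ (g ⊛ h)
⊛-assoc f g h = gf-unique
  (gf-map ×-assoc≅ (λ (i , (j , k)) → ℤP.+-assoc (+ i) (+ j) (+ k)) (λ (i , (j , k)) → ℤP.*-assoc (f i) (g j) (h k))
    (gf-⊛ (gf-⊛ (gf-ℕ f) (gf-ℕ g)) (gf-ℕ h)))
  (gf-⊛ (gf-ℕ f) (gf-⊛ (gf-ℕ g) (gf-ℕ h)))

module _ (c : ℕ) {I : Set} {e w : I → ℤ} {f : FPS} where

  gf-mono⊛ : GF e w f → GF (λ i → + c + e i) w (mono c ⊛ f)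
  gf-mono⊛ F = gf-map ⊤×≅ (λ _ → refl) (λ i → ℤP.*-identityˡ (w i)) (gf-⊛ (gf-mono c) F)

one⊛ : ∀ f → one ⊛ f ≈ f
one⊛ f = gf-unique (gf-mono⊛ 0 (gf-ℕ f)) (gf-ℕ f)

mono-⊛ : ∀ a b → mono a ⊛ mono b ≈ mono (a ℕ.+ b)
mono-⊛ a b = gf-unique (gf-mono⊛ a (gf-mono b)) (gf-mono (a ℕ.+ b))

⊛-distribˡ : ∀ f g h → f ⊛ (g ⊕ h) ≈ (f ⊛ g) ⊕ (f ⊛ h)
⊛-distribˡ f g h n = trans
  (sumOver-cong (λ i → ℤP.*-distribˡ-+ (f i) (g (n ∸ i)) (h (n ∸ i))) (upTo (suc n)))
  (sumOver-+ (λ i → f i * g (n ∸ i)) (λ i → f i * h (n ∸ i)) (upTo (suc n)))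

⊛-distribʳ : ∀ f g h → (g ⊕ h) ⊛ f ≈ (g ⊛ f) ⊕ (h ⊛ f)
⊛-distribʳ f g h = ≈-trans (⊛-comm (g ⊕ h) f)
  (≈-trans (⊛-distribˡ f g h) (⊕-cong (⊛-comm f g) (⊛-comm f h)))

FPS-commutativeRing : CommutativeRing 0ℓ 0ℓ
FPS-commutativeRing = record
  { Carrier = FPS ; _≈_ = _≈_ ; _+_ = _⊕_ ; _*_ = _⊛_ ; -_ = negF ; 0# = 0F ; 1# = one
  ; isCommutativeRing = record
    { isRing = record
      { +-isAbelianGroup = record
        { isGroup = record
          { isMonoid = record
            { isSemigroup = record
              { isMagma = record
                { isEquivalence = record { refl = ≈-refl ; sym = ≈-sym ; trans = ≈-trans }
                ; ∙-cong = ⊕-cong }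
              ; assoc = λ f g h n → ℤP.+-assoc (f n) (g n) (h n) }
            ; identity = (λ f n → ℤP.+-identityˡ (f n)) , (λ f n → ℤP.+-identityʳ (f n)) }
          ; inverse = (λ f n → ℤP.+-inverseˡ (f n)) , (λ f n → ℤP.+-inverseʳ (f n))
          ; ⁻¹-cong = λ p n → cong -_ (p n) }
        ; comm = λ f g n → ℤP.+-comm (f n) (g n) }
      ; *-cong = ⊛-cong
      ; *-assoc = ⊛-assoc
      ; *-identity = one⊛ , (λ f → ≈-trans (⊛-comm f one) (one⊛ f))
      ; distrib = ⊛-distribˡ , ⊛-distribʳ }
    ; *-comm = ⊛-comm } }

FPS-ring : AlmostCommutativeRing 0ℓ 0ℓ
FPS-ring = fromCommutativeRing FPS-commutativeRing

-- ι (+ 1) has to be definitionally one, since the solver's constant 1 occurs as one in the identities.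
ι : ℤ → FPS
ι (+ 0) = 0F
ι (+ 1) = one
ι c     = λ n → c * one n

ι≈ : ∀ c n → ι c n ≡ c * one n
ι≈ (+ 0)           n = refl
ι≈ (+ 1)           n = sym (ℤP.*-identityˡ (one n))
ι≈ (+ suc (suc _)) n = refl
ι≈ -[1+ _ ]        n = refl

ι⊛ : ∀ c f n → (ι c ⊛ f) n ≡ c * f n
ι⊛ c f n = trans (sumOver-cong (λ i → trans (cong (_* f (n ∸ i)) (ι≈ c i)) (ℤP.*-assoc c (one i) (f (n ∸ i)))) (upTo (suc n)))
  (trans (sumOver-*ˡ c (λ i → one i * f (n ∸ i)) (upTo (suc n))) (cong (c *_) (one⊛ f n)))

ι-homo : ℤ.+-*-rawRing -Raw-AlmostCommutative⟶ FPS-ring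
ι-homo = record
  { ⟦_⟧    = ι
  ; +-homo = λ a b n → trans (ι≈ (a + b) n) (trans (ℤP.*-distribʳ-+ (one n) a b) (sym (cong₂ _+_ (ι≈ a n) (ι≈ b n))))
  ; *-homo = λ a b n → trans (ι≈ (a * b) n) (trans (ℤP.*-assoc a b (one n)) (sym (trans (ι⊛ a (ι b) n) (cong (a *_) (ι≈ b n)))))
  ; -‿homo = λ a n → trans (ι≈ (- a) n) (trans (sym (ℤP.neg-distribˡ-* a (one n))) (cong -_ (sym (ι≈ a n))))
  ; 0-homo = λ _ → refl
  ; 1-homo = λ _ → refl }

open RingIdentities FPS-ring ι-homo

gf-qmul : ∀ {I : Set} {e w : I → ℤ} {f : FPS} → GF e w f → GF (λ i → + 1 + e i) w (qmul f)
gf-qmul {I} {e} {w} {f} F = record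
  { nonneg = λ i → subst (λ z → + 1 + z ≡ + ∣ + 1 + z ∣) (sym (nonneg F i)) refl
  ; fib = fb ; unique = λ { zero → [] ; (suc N) → unique F N } ; sound = λ {N} → sd {N} ; complete = λ {N} → cp {N}
  ; value = λ { zero → refl ; (suc N) → value F N } }
  where
  fb : ℕ → List I
  fb zero    = []
  fb (suc N) = fib F N
  sd : ∀ {N i} → i ∈ fb N → + 1 + e i ≡ + N
  sd {suc N} i∈ = cong (λ z → + 1 + z) (sound F i∈)
  cp : ∀ {N} i → + 1 + e i ≡ + N → i ∈ fb N
  cp {N} i p with trans (sym (cong (λ z → + 1 + z) (nonneg F i))) p
  cp {suc N} i p | q = complete F i (trans (nonneg F i) (cong +_ (ℕP.suc-injective (ℤP.+-injective q))))

qmul≈ : ∀ f → qmul f ≈ mono 1 ⊛ f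
qmul≈ f = gf-unique (gf-qmul (gf-ℕ f)) (gf-mono⊛ 1 (gf-ℕ f))

mono-suc : ∀ c f n → (mono (suc c) ⊛ f) (suc n) ≡ (mono c ⊛ f) n
mono-suc c f n = gf-unique (gf-mono⊛ (suc c) (gf-ℕ f))
  (gf-cong (λ i → sym (ℤP.+-assoc (+ 1) (+ c) (+ i))) (λ _ → refl) (gf-qmul (gf-mono⊛ c (gf-ℕ f)))) (suc n)

mono-shift : ∀ c f n → (mono c ⊛ f) (c ℕ.+ n) ≡ f n
mono-shift zero    f n = one⊛ f n
mono-shift (suc c) f n = trans (mono-suc c f (c ℕ.+ n)) (mono-shift c f n)

⊛-last : ∀ f g N → (f ⊛ g) N ≡ sumOver (λ i → f i * g (N ∸ i)) (upTo N) + f N * g 0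
⊛-last f g N = begin
  sumOver w (upTo (suc N))                 ≡⟨ cong (sumOver w) (LP.upTo-∷ʳ N) ⟨
  sumOver w (upTo N ∷ʳ N)                  ≡⟨ sumOver-++ w (upTo N) (N ∷ []) ⟩
  sumOver w (upTo N) + (w N + + 0)         ≡⟨ cong (_+_ (sumOver w (upTo N))) (trans (ℤP.+-identityʳ (w N)) (cong (λ z → f N * g z) (ℕP.n∸n≡0 N))) ⟩
  sumOver w (upTo N) + f N * g 0           ∎
  where
  open ≡-Reasoning
  w = λ i → f i * g (N ∸ i)

-- By strong induction: in the coefficient of q^N of f g only the last term f(N) g(0) = f(N)
-- involves a coefficient of f not yet known to agree.
⊛-cancelʳ : ∀ {f f′} g → g 0 ≡ + 1 → f ⊛ g ≈ f′ ⊛ g → f ≈ f′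
⊛-cancelʳ {f} {f′} g g0 p = <-rec (λ N → f N ≡ f′ N) step
  where
  step : ∀ N → (∀ {M} → M ℕ.< N → f M ≡ f′ M) → f N ≡ f′ N
  step N ih = trans (sym (*1 f)) (trans (+-cancelˡ s _ _ eq) (*1 f′))
    where
    *1 : ∀ h → h N * g 0 ≡ h N
    *1 h = trans (cong (h N *_) g0) (ℤP.*-identityʳ (h N))
    s = sumOver (λ i → f i * g (N ∸ i)) (upTo N)
    eq : s + f N * g 0 ≡ s + f′ N * g 0
    eq = trans (sym (⊛-last f g N)) (trans (p N) (trans (⊛-last f′ g N)
      (cong (λ z → z + f′ N * g 0) (sumOver-cong-∈ (upTo N) (λ i∈ → cong (_* g _) (sym (ih (∈-upTo⁻ i∈))))))))

⊛-0 : ∀ f g → (f ⊛ g) 0 ≡ f 0 * g 0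
⊛-0 f g = ℤP.+-identityʳ _

⊛-unit : ∀ {f g} → f 0 ≡ + 1 → g 0 ≡ + 1 → (f ⊛ g) 0 ≡ + 1
⊛-unit {f} {g} p q = trans (⊛-0 f g) (cong₂ _*_ p q)

-- Dilation q ↦ q^k, the twist q ↦ -q, even and odd parts.

module _ (k : ℕ) .{{_ : NonZero k}} where

  private
    gfd : ∀ f → GF (λ n → + k * + n) f (dilate k f)
    gfd f = gf-dilate k (gf-ℕ f)

  dilate-cong : ∀ {f g} → f ≈ g → dilate k f ≈ dilate k g
  dilate-cong p n with k ∣? n
  ... | yes _ = p _
  ... | no  _ = refl

  dilate-⊕ : ∀ f g → dilate k (f ⊕ g) ≈ dilate k f ⊕ dilate k g
  dilate-⊕ f g n with k ∣? n
  ... | yes _ = refl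
  ... | no  _ = refl

  dilate-⊖ : ∀ f g → dilate k (f ⊖ g) ≈ dilate k f ⊖ dilate k g
  dilate-⊖ f g n with k ∣? n
  ... | yes _ = refl
  ... | no  _ = refl

  dilate-⊛ : ∀ f g → dilate k (f ⊛ g) ≈ dilate k f ⊛ dilate k g
  dilate-⊛ f g = gf-unique
    (gf-cong (λ (i , j) → ℤP.*-distribˡ-+ (+ k) (+ i) (+ j)) (λ _ → refl) (gf-dilate k (gf-⊛ (gf-ℕ f) (gf-ℕ g))))
    (gf-⊛ (gfd f) (gfd g))

  dilate-mono : ∀ c → dilate k (mono c) ≈ mono (k ℕ.* c)
  dilate-mono c = gf-unique (gf-dilate k (gf-mono c)) (gf-cong (λ _ → ℤP.pos-* k c) (λ _ → refl) (gf-mono (k ℕ.* c)))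

  dilate-* : ∀ f n → dilate k f (k ℕ.* n) ≡ f n
  dilate-* f n with k ∣? (k ℕ.* n)
  ... | yes _ = cong f (trans (cong (ℕD._/ k) (ℕP.*-comm k n)) (ℕD.m*n/n≡m n k))
  ... | no ¬p = contradiction (m∣m*n n) ¬p

  dilate-∤ : ∀ f n → ¬ k ∣ n → dilate k f n ≡ + 0
  dilate-∤ f n ¬p with k ∣? n
  ... | yes p = contradiction p ¬p
  ... | no  _ = refl

  dilate-injective : ∀ {f g} → dilate k f ≈ dilate k g → f ≈ g
  dilate-injective {f} {g} p n = trans (sym (dilate-* f n)) (trans (p (k ℕ.* n)) (dilate-* g n))

  dilate-0 : ∀ f → dilate k f 0 ≡ f 0
  dilate-0 f = trans (cong (dilate k f) (sym (ℕP.*-zeroʳ k))) (dilate-* f 0)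

dilate-dilate : ∀ k l .{{_ : NonZero k}} .{{_ : NonZero l}} .{{_ : NonZero (k ℕ.* l)}} →
                ∀ f → dilate k (dilate l f) ≈ dilate (k ℕ.* l) f
dilate-dilate k l f = gf-unique
  (gf-dilate k (gf-dilate l (gf-ℕ f)))
  (gf-cong (λ i → trans (cong (_* + i) (ℤP.pos-* k l)) (ℤP.*-assoc (+ k) (+ l) (+ i))) (λ _ → refl) (gf-dilate (k ℕ.* l) (gf-ℕ f)))

sgnℕ : ℕ → ℤ
sgnℕ zero    = + 1
sgnℕ (suc n) = - sgnℕ n

sgn : ℤ → ℤ
sgn k = sgnℕ ∣ k ∣

sgnℕ-+ : ∀ m n → sgnℕ (m ℕ.+ n) ≡ sgnℕ m * sgnℕ n
sgnℕ-+ zero    n = sym (ℤP.*-identityˡ _)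
sgnℕ-+ (suc m) n = trans (cong -_ (sgnℕ-+ m n)) (ℤP.neg-distribˡ-* (sgnℕ m) (sgnℕ n))

sgnℕ² : ∀ n → sgnℕ n * sgnℕ n ≡ + 1
sgnℕ² zero    = refl
sgnℕ² (suc n) = trans (lemma (sgnℕ n)) (sgnℕ² n)
  where
  lemma : ∀ a → - a * - a ≡ a * a
  lemma = solve-∀

sgn-suc : ∀ k → sgn (+ 1 + k) ≡ - sgn k
sgn-suc (+ n)        = refl
sgn-suc -[1+ zero ]  = refl
sgn-suc -[1+ suc n ] = sym (ℤP.neg-involutive _)

sgn-pred : ∀ k → sgn (-[1+ 0 ] + k) ≡ - sgn k
sgn-pred k = trans (sym (ℤP.neg-involutive _)) (cong -_ (trans (sym (sgn-suc (-[1+ 0 ] + k)))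
  (cong sgn (trans (sym (ℤP.+-assoc (+ 1) -[1+ 0 ] k)) (ℤP.+-identityˡ k)))))

sgn-+ : ∀ a b → sgn (a + b) ≡ sgn a * sgn b
sgn-+ (+ zero)  b = trans (cong sgn (ℤP.+-identityˡ b)) (sym (ℤP.*-identityˡ _))
sgn-+ (+ suc n) b = trans (cong sgn (ℤP.+-assoc (+ 1) (+ n) b)) (trans (sgn-suc (+ n + b))
  (trans (cong -_ (sgn-+ (+ n) b)) (ℤP.neg-distribˡ-* (sgnℕ n) (sgn b))))
sgn-+ -[1+ zero ]  b = trans (sgn-pred b) (sym (ℤP.-1*i≡-i _))
sgn-+ -[1+ suc n ] b = trans (cong sgn (ℤP.+-assoc -[1+ 0 ] -[1+ n ] b)) (trans (sgn-pred (-[1+ n ] + b))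
  (trans (cong -_ (sgn-+ -[1+ n ] b)) (ℤP.neg-distribˡ-* (sgnℕ (suc n)) (sgn b))))

-- The substitution of -q for q.
twist : FPS → FPS
twist f n = sgnℕ n * f n

twist-cong : ∀ {f g} → f ≈ g → twist f ≈ twist g
twist-cong p n = cong (sgnℕ n *_) (p n)

gf-twist : ∀ {I : Set} {e w : I → ℤ} {f} → GF e w f → GF e (λ i → sgn (e i) * w i) (twist f)
gf-twist {I} {e} {w} {f} F = record
  { nonneg = nonneg F ; fib = fib F ; unique = unique F ; sound = sound F ; complete = complete F
  ; value = λ N → trans (cong (sgnℕ N *_) (value F N)) (trans (sym (sumOver-*ˡ (sgnℕ N) w (fib F N)))
      (sumOver-cong-∈ (fib F N) (λ i∈ → cong (λ z → sgn z * w _) (sym (sound F i∈))))) }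

twist-⊛ : ∀ f g → twist (f ⊛ g) ≈ twist f ⊛ twist g
twist-⊛ f g = gf-unique
  (gf-cong (λ _ → refl) (λ (i , j) → trans (cong (_* (f i * g j)) (sgnℕ-+ i j)) (lemma (sgnℕ i) (sgnℕ j) (f i) (g j)))
    (gf-twist (gf-⊛ (gf-ℕ f) (gf-ℕ g))))
  (gf-⊛ (gf-ℕ (twist f)) (gf-ℕ (twist g)))
  where
  lemma : ∀ a b c d → a * b * (c * d) ≡ a * c * (b * d)
  lemma = solve-∀

twist-⊕ : ∀ f g → twist (f ⊕ g) ≈ twist f ⊕ twist g
twist-⊕ f g n = ℤP.*-distribˡ-+ (sgnℕ n) (f n) (g n)

twist-⊖ : ∀ f g → twist (f ⊖ g) ≈ twist f ⊖ twist g
twist-⊖ f g n = lemma (sgnℕ n) (f n) (g n)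
  where
  lemma : ∀ a b c → a * (b - c) ≡ a * b - a * c
  lemma = solve-∀

sgnℕ-2* : ∀ n → sgnℕ (2 ℕ.* n) ≡ + 1
sgnℕ-2* n = trans (cong (λ z → sgnℕ (n ℕ.+ z)) (ℕP.+-identityʳ n)) (trans (sgnℕ-+ n n) (sgnℕ² n))

twist-dilate-even : ∀ k .{{_ : NonZero (2 ℕ.* k)}} f → twist (dilate (2 ℕ.* k) f) ≈ dilate (2 ℕ.* k) f
twist-dilate-even k f = gf-unique (gf-cong (λ _ → refl) eq (gf-twist (gf-dilate (2 ℕ.* k) (gf-ℕ f)))) (gf-dilate (2 ℕ.* k) (gf-ℕ f))
  where
  eq : ∀ i → sgn (+ (2 ℕ.* k) * + i) * f i ≡ f i
  eq i = trans (cong (_* f i) (trans (cong sgn (trans (sym (ℤP.pos-* (2 ℕ.* k) i)) (cong +_ (ℕP.*-assoc 2 k i)))) (sgnℕ-2* (k ℕ.* i))))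
               (ℤP.*-identityˡ (f i))

twist-dilate-odd : ∀ k f → twist (dilate (suc (2 ℕ.* k)) f) ≈ dilate (suc (2 ℕ.* k)) (twist f)
twist-dilate-odd k f = gf-unique (gf-cong (λ _ → refl) eq (gf-twist (gf-dilate l (gf-ℕ f)))) (gf-dilate l (gf-ℕ (twist f)))
  where
  l = suc (2 ℕ.* k)
  eq : ∀ i → sgn (+ l * + i) * f i ≡ sgnℕ i * f i
  eq i = cong (λ z → z * f i) (trans (cong sgn (sym (ℤP.pos-* l i))) (trans (sgnℕ-+ i (2 ℕ.* k ℕ.* i))
    (trans (cong (sgnℕ i *_) (trans (cong sgnℕ (ℕP.*-assoc 2 k i)) (sgnℕ-2* (k ℕ.* i)))) (ℤP.*-identityʳ (sgnℕ i)))))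

ev od : FPS → FPS
ev f n = f (2 ℕ.* n)
od f n = f (suc (2 ℕ.* n))

2∤odd : ∀ n → ¬ 2 ∣ suc (2 ℕ.* n)
2∤odd n p with ∣1⇒≡1 (∣m+n∣m⇒∣n (subst (2 ∣_) (ℕP.+-comm 1 (2 ℕ.* n)) p) (m∣m*n n))
... | ()

module _ (a b : FPS) where

  private
    F = dilate 2 a ⊕ (mono 1 ⊛ dilate 2 b)

    qodd : ∀ n → (mono 1 ⊛ dilate 2 b) (2 ℕ.* n) ≡ + 0
    qodd zero    = sym (qmul≈ (dilate 2 b) 0)
    qodd (suc n) = trans (cong (mono 1 ⊛ dilate 2 b) (ℕP.*-suc 2 n))
      (trans (mono-shift 1 (dilate 2 b) (suc (2 ℕ.* n))) (dilate-∤ 2 b _ (2∤odd n)))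

  ev-assemble : ev F ≈ a
  ev-assemble n = trans (cong₂ _+_ (dilate-* 2 a n) (qodd n)) (ℤP.+-identityʳ (a n))

  od-assemble : od F ≈ b
  od-assemble n = trans (cong₂ _+_ (dilate-∤ 2 a _ (2∤odd n)) (trans (mono-shift 1 (dilate 2 b) (2 ℕ.* n)) (dilate-* 2 b n)))
    (ℤP.+-identityˡ (b n))

data Half : ℕ → Set where
  even : ∀ n → Half (2 ℕ.* n)
  odd  : ∀ n → Half (suc (2 ℕ.* n))

half : ∀ n → Half n
half zero    = even 0
half (suc n) with half n
... | even m = odd m
... | odd m  = subst Half (ℕP.*-suc 2 m) (even (suc m))

assemble : ∀ f → f ≈ dilate 2 (ev f) ⊕ (mono 1 ⊛ dilate 2 (od f))
assemble f n with half n
... | even m = sym (ev-assemble (ev f) (od f) m)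
... | odd m  = sym (od-assemble (ev f) (od f) m)

module _ (f g : FPS) where

  private

    eq : f ⊛ dilate 2 g ≈ dilate 2 (ev f ⊛ g) ⊕ (mono 1 ⊛ dilate 2 (od f ⊛ g))
    eq = ≈-trans (⊛-cong (assemble f) (≈-refl {dilate 2 g})) (≈-trans (⊛-distribʳ (dilate 2 g) (dilate 2 (ev f)) (mono 1 ⊛ dilate 2 (od f)))
      (⊕-cong (≈-sym (dilate-⊛ 2 (ev f) g))
        (≈-trans (⊛-assoc (mono 1) (dilate 2 (od f)) (dilate 2 g))
          (⊛-cong (≈-refl {mono 1}) (≈-sym (dilate-⊛ 2 (od f) g))))))

  ev-⊛-dilate : ev (f ⊛ dilate 2 g) ≈ ev f ⊛ g
  ev-⊛-dilate n = trans (eq (2 ℕ.* n)) (ev-assemble (ev f ⊛ g) (od f ⊛ g) n)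

  od-⊛-dilate : od (f ⊛ dilate 2 g) ≈ od f ⊛ g
  od-⊛-dilate n = trans (eq (suc (2 ℕ.* n))) (od-assemble (ev f ⊛ g) (od f ⊛ g) n)

-- Binary theta series: quadratic exponents, signs, affine substitutions.

-- quad a b c d e f is a x² + b x y + c y² + d x + e y + f.
record Quad : Set where
  constructor quad
  field xx xy yy x¹ y¹ x⁰ : ℤ

⟦_⟧ : Quad → ℤ × ℤ → ℤ
⟦ quad a b c d e f ⟧ (x , y) = a * (x * x) + b * (x * y) + c * (y * y) + d * x + e * y + f

-- aff a b u c d v is (x , y) ↦ (a x + b y + u , c x + d y + v).
record Aff : Set where
  constructor aff
  field a b u c d v : ℤ

infixr 9 _·_
_·_ : Aff → ℤ × ℤ → ℤ × ℤ
aff a b u c d v · (x , y) = a * x + b * y + u , c * x + d * y + v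

det : Aff → ℤ
det (aff a b u c d v) = a * d - b * c

infixl 8 _∘q_ _∘σ_
-- The substituted polynomial is given by its coefficients, so that for numerals it reduces to a
-- `Quad` of numerals and two parametrisations of one sum can be compared by computation.
_∘q_ : Quad → Aff → Quad
quad A B C D E F ∘q aff a b u c d v = quad
  (A * (a * a) + B * (a * c) + C * (c * c))
  (+ 2 * A * (a * b) + B * (a * d + b * c) + + 2 * C * (c * d))
  (A * (b * b) + B * (b * d) + C * (d * d))
  (+ 2 * A * (a * u) + B * (a * v + c * u) + + 2 * C * (c * v) + D * a + E * c)
  (+ 2 * A * (b * u) + B * (b * v + d * u) + + 2 * C * (d * v) + D * b + E * d)
  (A * (u * u) + B * (u * v) + C * (v * v) + D * u + E * v + F)

∘q-eval : ∀ Q M p → ⟦ Q ⟧ (M · p) ≡ ⟦ Q ∘q M ⟧ p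
∘q-eval (quad A B C D E F) (aff a b u c d v) (x , y) = lemma A B C D E F a b u c d v x y
  where
  lemma : ∀ A B C D E F a b u c d v x y →
    A * ((a * x + b * y + u) * (a * x + b * y + u)) + B * ((a * x + b * y + u) * (c * x + d * y + v))
      + C * ((c * x + d * y + v) * (c * x + d * y + v)) + D * (a * x + b * y + u) + E * (c * x + d * y + v) + F
    ≡ (A * (a * a) + B * (a * c) + C * (c * c)) * (x * x)
      + (+ 2 * A * (a * b) + B * (a * d + b * c) + + 2 * C * (c * d)) * (x * y)
      + (A * (b * b) + B * (b * d) + C * (d * d)) * (y * y)
      + (+ 2 * A * (a * u) + B * (a * v + c * u) + + 2 * C * (c * v) + D * a + E * c) * x
      + (+ 2 * A * (b * u) + B * (b * v + d * u) + + 2 * C * (d * v) + D * b + E * d) * y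
      + (A * (u * u) + B * (u * v) + C * (v * v) + D * u + E * v + F)
  lemma = solve-∀

-- Signs (-1)^(p x + r y + c), with p, r, c reduced modulo 2

oddℕ : ℕ → Bool
oddℕ zero    = false
oddℕ (suc n) = not (oddℕ n)

odd? : ℤ → Bool
odd? z = oddℕ ∣ z ∣

χ : Bool → ℤ → ℤ
χ false _ = + 1
χ true  z = sgn z

χ-+ : ∀ p y z → χ p (y + z) ≡ χ p y * χ p z
χ-+ false y z = refl
χ-+ true  y z = sgn-+ y z

χ-xor : ∀ p r z → χ (p xor r) z ≡ χ p z * χ r z
χ-xor false r     z = sym (ℤP.*-identityˡ _)
χ-xor true  false z = sym (ℤP.*-identityʳ _)
χ-xor true  true  z = sym (sgnℕ² ∣ z ∣)

sgn-neg : ∀ z → sgn (- z) ≡ sgn z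
sgn-neg z = cong sgnℕ (ℤP.∣-i∣≡∣i∣ z)

χ-ℕ* : ∀ n z → sgn (+ n * z) ≡ χ (oddℕ n) z
χ-ℕ* zero    z = refl
χ-ℕ* (suc n) z = trans (cong sgn (ℤP.suc-* (+ n) z)) (trans (sgn-+ z (+ n * z))
  (trans (cong (sgn z *_) (χ-ℕ* n z)) (lemma (oddℕ n))))
  where
  lemma : ∀ b → sgn z * χ b z ≡ χ (not b) z
  lemma false = ℤP.*-identityʳ _
  lemma true  = sgnℕ² ∣ z ∣

sgn-* : ∀ a z → sgn (a * z) ≡ χ (odd? a) z
sgn-* (+ n)    z = χ-ℕ* n z
sgn-* -[1+ n ] z = trans (cong sgn (sym (ℤP.neg-distribˡ-* (+ suc n) z))) (trans (sgn-neg (+ suc n * z)) (χ-ℕ* (suc n) z))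

χ-* : ∀ p a z → χ p (a * z) ≡ χ (p ∧ odd? a) z
χ-* false a z = refl
χ-* true  a z = sgn-* a z

record Sign : Set where
  constructor sg
  field p r c : Bool

wt : Sign → ℤ × ℤ → ℤ
wt (sg p r c) (x , y) = χ p x * χ r y * χ c (+ 1)

_∘σ_ : Sign → Aff → Sign
sg p r s ∘σ aff a b u c d v = sg ((p ∧ odd? a) xor (r ∧ odd? c)) ((p ∧ odd? b) xor (r ∧ odd? d))
                                 (((p ∧ odd? u) xor (r ∧ odd? v)) xor s)

χ-lin : ∀ p a b u x y → χ p (a * x + b * y + u) ≡ χ (p ∧ odd? a) x * χ (p ∧ odd? b) y * χ (p ∧ odd? u) (+ 1)
χ-lin p a b u x y = trans (χ-+ p (a * x + b * y) u) (cong₂ _*_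
  (trans (χ-+ p (a * x) (b * y)) (cong₂ _*_ (χ-* p a x) (χ-* p b y)))
  (trans (cong (χ p) (sym (ℤP.*-identityʳ u))) (χ-* p u (+ 1))))

∘σ-eval : ∀ σ M v → wt σ (M · v) ≡ wt (σ ∘σ M) v
∘σ-eval (sg p r s) (aff a b u c d v) (x , y) = trans
  (cong (λ z → z * χ s (+ 1)) (cong₂ _*_ (χ-lin p a b u x y) (χ-lin r c d v x y)))
  (trans (lemma (χ (p ∧ odd? a) x) (χ (p ∧ odd? b) y) (χ (p ∧ odd? u) (+ 1)) (χ (r ∧ odd? c) x) (χ (r ∧ odd? d) y) (χ (r ∧ odd? v) (+ 1)) (χ s (+ 1)))
  (sym (cong₂ _*_ (cong₂ _*_ (χ-xor (p ∧ odd? a) (r ∧ odd? c) x) (χ-xor (p ∧ odd? b) (r ∧ odd? d) y))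
    (trans (χ-xor ((p ∧ odd? u) xor (r ∧ odd? v)) s (+ 1)) (cong (_* χ s (+ 1)) (χ-xor (p ∧ odd? u) (r ∧ odd? v) (+ 1)))))))
  where
  lemma : ∀ a b c d e f g → a * b * c * (d * e * f) * g ≡ a * d * (b * e) * (c * f * g)
  lemma = solve-∀

record PT (Q : Quad) (σ : Sign) (f : FPS) : Set where
  constructor pt
  field gf : GF ⟦ Q ⟧ (wt σ) f

open PT

pt-unique : ∀ {Q σ f g} → PT Q σ f → PT Q σ g → f ≈ g
pt-unique P P′ = gf-unique (gf P) (gf P′)

-- A determinant with square 1 is its own inverse, so the inverse matrix is the determinant times
-- the adjugate and no division occurs.
aff≅ : ∀ M → det M * det M ≡ + 1 → (ℤ × ℤ) ≅ (ℤ × ℤ)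
aff≅ M@(aff a b u c d v) unit = record
  { to = M ·_ ; from = inv
  ; to∘from = λ (x , y) → cong₂ _,_
      (trans (lem₁ a b u c d v x y) (trans (cong (λ z → z * (x - u) + u) unit) (lem₀ x u)))
      (trans (lem₂ a b u c d v x y) (trans (cong (λ z → z * (y - v) + v) unit) (lem₀ y v)))
  ; from∘to = λ (x , y) → cong₂ _,_
      (trans (lem₃ a b u c d v x y) (trans (cong (_* x) unit) (ℤP.*-identityˡ x)))
      (trans (lem₄ a b u c d v x y) (trans (cong (_* y) unit) (ℤP.*-identityˡ y))) }
  where
  inv : ℤ × ℤ → ℤ × ℤ
  inv (x , y) = (a * d - b * c) * (d * (x - u) - b * (y - v)) , (a * d - b * c) * (a * (y - v) - c * (x - u))
  lem₀ : ∀ x u → + 1 * (x - u) + u ≡ x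
  lem₀ = solve-∀
  lem₁ : ∀ a b u c d v x y →
    a * ((a * d - b * c) * (d * (x - u) - b * (y - v))) + b * ((a * d - b * c) * (a * (y - v) - c * (x - u))) + u
    ≡ (a * d - b * c) * (a * d - b * c) * (x - u) + u
  lem₁ = solve-∀
  lem₂ : ∀ a b u c d v x y →
    c * ((a * d - b * c) * (d * (x - u) - b * (y - v))) + d * ((a * d - b * c) * (a * (y - v) - c * (x - u))) + v
    ≡ (a * d - b * c) * (a * d - b * c) * (y - v) + v
  lem₂ = solve-∀
  lem₃ : ∀ a b u c d v x y →
    (a * d - b * c) * (d * (a * x + b * y + u - u) - b * (c * x + d * y + v - v))
    ≡ (a * d - b * c) * (a * d - b * c) * x
  lem₃ = solve-∀
  lem₄ : ∀ a b u c d v x y →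
    (a * d - b * c) * (a * (c * x + d * y + v - v) - c * (a * x + b * y + u - u))
    ≡ (a * d - b * c) * (a * d - b * c) * y
  lem₄ = solve-∀

pt-aff : ∀ {Q σ f} M → det M * det M ≡ + 1 → PT Q σ f → PT (Q ∘q M) (σ ∘σ M) f
pt-aff {Q} {σ} M unit P = pt (gf-map (aff≅ M unit) (∘q-eval Q M) (∘σ-eval σ M) (gf P))

residue : ℕ → ℕ → Aff
residue m r = aff (+ m) (+ 0) (+ r) (+ 0) (+ 1) (+ 0)

residue-disjoint : ∀ m x x′ {r r′} → r ℕ.< m → r′ ℕ.< m → r ℕ.< r′ → ¬ (+ m * x + + r ≡ + m * x′ + + r′)
residue-disjoint m x x′ {r} {r′} r<m r′<m r<r′ p = ℕP.<-irrefl refl (ℕP.<-≤-trans d<m (m≤d ∣ x - x′ ∣ abs))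
  where
  lemma : ∀ m x x′ r → m * (x - x′) ≡ (m * x + r) - (m * x′ + r)
  lemma = solve-∀
  lemma′ : ∀ m x′ r d → m * x′ + (r + d) - (m * x′ + r) ≡ d
  lemma′ = solve-∀
  d = r′ ∸ r
  r+d : r ℕ.+ d ≡ r′
  r+d = ℕP.m+[n∸m]≡n (ℕP.<⇒≤ r<r′)
  eq : + m * (x - x′) ≡ + d
  eq = trans (lemma (+ m) x x′ (+ r)) (trans (cong (λ z → z - (+ m * x′ + + r)) (trans p (cong (λ z → + m * x′ + + z) (sym r+d))))
         (lemma′ (+ m) x′ (+ r) (+ d)))
  abs : m ℕ.* ∣ x - x′ ∣ ≡ d
  abs = trans (sym (ℤP.abs-* (+ m) (x - x′))) (cong ∣_∣ eq)
  d<m : d ℕ.< m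
  d<m = ℕP.≤-<-trans (ℕP.m∸n≤m r′ r) r′<m
  m≤d : ∀ k → m ℕ.* k ≡ d → m ℕ.≤ d
  m≤d zero    q = contradiction (trans (sym (ℕP.*-zeroʳ m)) q) (λ 0≡d → ℕP.<-irrefl (trans (sym (ℕP.+-identityʳ r)) (trans (cong (r ℕ.+_) 0≡d) r+d)) r<r′)
  m≤d (suc k) q = subst (m ℕ.≤_) (trans (sym (ℕP.*-suc m k)) q) (ℕP.m≤m+n m _)

residue-injective : ∀ m .{{_ : NonZero m}} r {v w} → residue m r · v ≡ residue m r · w → v ≡ w
residue-injective m r {x , y} {x′ , y′} p = cong₂ _,_
  (ℤP.*-cancelˡ-≡ (+ m) x x′ (trans (sym (l₁ (+ m) x y (+ r))) (trans (cong (λ v → proj₁ v - + r) p) (l₁ (+ m) x′ y′ (+ r)))))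
  (trans (sym (l₂ x y)) (trans (cong proj₂ p) (l₂ x′ y′)))
  where
  l₁ : ∀ m x y r → m * x + + 0 * y + r - r ≡ m * x
  l₁ = solve-∀
  l₂ : ∀ x y → + 0 * x + + 1 * y + + 0 ≡ y
  l₂ = solve-∀

residue-≢ : ∀ m {r r′} → r ℕ.< m → r′ ℕ.< m → r ℕ.< r′ → ∀ v w → residue m r · v ≢ residue m r′ · w
residue-≢ m {r} {r′} p q s (x , y) (x′ , y′) eq = residue-disjoint m x x′ p q s
  (trans (sym (l (+ m) x y (+ r))) (trans (cong proj₁ eq) (l (+ m) x′ y′ (+ r′))))
  where
  l : ∀ m x y r → m * x + + 0 * y + r ≡ m * x + r
  l = solve-∀

residue-surjective : ∀ m .{{_ : NonZero m}} x y → Σ ℕ λ r → r ℕ.< m × residue m r · ((x /ℕ m) , y) ≡ (x , y)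
residue-surjective m x y = x %ℕ m , n%ℕd<d x m , cong₂ _,_
  (trans (l₁ (+ m) (x /ℕ m) y (+ (x %ℕ m))) (sym (a≡a%ℕn+[a/ℕn]*n x m))) (l₂ (x /ℕ m) y)
  where
  l₁ : ∀ m q y r → m * q + + 0 * y + r ≡ r + q * m
  l₁ = solve-∀
  l₂ : ∀ x y → + 0 * x + + 1 * y + + 0 ≡ y
  l₂ = solve-∀

bijection : {I J : Set} (to : J → I) (from : I → J) → (∀ i → to (from i) ≡ i) → (∀ {j k} → to j ≡ to k → j ≡ k) → J ≅ I
bijection to from tf inj = record { to = to ; from = from ; to∘from = tf ; from∘to = λ j → inj (tf (to j)) }

halves≅ : (ℤ × ℤ ⊎ ℤ × ℤ) ≅ (ℤ × ℤ)
halves≅ = bijection t fr tf inj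
  where
  t : ℤ × ℤ ⊎ ℤ × ℤ → ℤ × ℤ
  t = [ residue 2 0 ·_ , residue 2 1 ·_ ]
  choose : ∀ v → Σ (ℤ × ℤ ⊎ ℤ × ℤ) λ j → t j ≡ v
  choose (x , y) with residue-surjective 2 x y
  ... | 0 , _ , p = inj₁ (x /ℕ 2 , y) , p
  ... | 1 , _ , p = inj₂ (x /ℕ 2 , y) , p
  ... | suc (suc _) , s≤s (s≤s ()) , _
  fr = λ v → proj₁ (choose v)
  tf = λ v → proj₂ (choose v)
  inj : ∀ {j k} → t j ≡ t k → j ≡ k
  inj {inj₁ v} {inj₁ w} p = cong inj₁ (residue-injective 2 0 {v} {w} p)
  inj {inj₂ v} {inj₂ w} p = cong inj₂ (residue-injective 2 1 {v} {w} p)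
  inj {inj₁ v} {inj₂ w} p = ⊥-elim (residue-≢ 2 (s≤s z≤n) (s≤s (s≤s z≤n)) (s≤s z≤n) v w p)
  inj {inj₂ v} {inj₁ w} p = ⊥-elim (residue-≢ 2 (s≤s z≤n) (s≤s (s≤s z≤n)) (s≤s z≤n) w v (sym p))

thirds≅ : (ℤ × ℤ ⊎ (ℤ × ℤ ⊎ ℤ × ℤ)) ≅ (ℤ × ℤ)
thirds≅ = bijection t (λ v → proj₁ (choose v)) (λ v → proj₂ (choose v)) inj
  where
  t : ℤ × ℤ ⊎ (ℤ × ℤ ⊎ ℤ × ℤ) → ℤ × ℤ
  t = [ residue 3 0 ·_ , [ residue 3 1 ·_ , residue 3 2 ·_ ] ]
  choose : ∀ v → Σ (ℤ × ℤ ⊎ (ℤ × ℤ ⊎ ℤ × ℤ)) λ j → t j ≡ v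
  choose (x , y) with residue-surjective 3 x y
  ... | 0 , _ , p = inj₁ (x /ℕ 3 , y) , p
  ... | 1 , _ , p = inj₂ (inj₁ (x /ℕ 3 , y)) , p
  ... | 2 , _ , p = inj₂ (inj₂ (x /ℕ 3 , y)) , p
  ... | suc (suc (suc _)) , s≤s (s≤s (s≤s ())) , _
  0<3 : 0 ℕ.< 3
  0<3 = s≤s z≤n
  1<3 : 1 ℕ.< 3
  1<3 = s≤s (s≤s z≤n)
  2<3 : 2 ℕ.< 3
  2<3 = s≤s (s≤s (s≤s z≤n))
  inj : ∀ {j k} → t j ≡ t k → j ≡ k
  inj {inj₁ v}        {inj₁ w}        p = cong inj₁ (residue-injective 3 0 {v} {w} p)
  inj {inj₁ v}        {inj₂ (inj₁ w)} p = ⊥-elim (residue-≢ 3 0<3 1<3 (s≤s z≤n) v w p)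
  inj {inj₁ v}        {inj₂ (inj₂ w)} p = ⊥-elim (residue-≢ 3 0<3 2<3 (s≤s z≤n) v w p)
  inj {inj₂ (inj₁ v)} {inj₁ w}        p = ⊥-elim (residue-≢ 3 0<3 1<3 (s≤s z≤n) w v (sym p))
  inj {inj₂ (inj₁ v)} {inj₂ (inj₁ w)} p = cong (inj₂ ∘ inj₁) (residue-injective 3 1 {v} {w} p)
  inj {inj₂ (inj₁ v)} {inj₂ (inj₂ w)} p = ⊥-elim (residue-≢ 3 1<3 2<3 (s≤s (s≤s z≤n)) v w p)
  inj {inj₂ (inj₂ v)} {inj₁ w}        p = ⊥-elim (residue-≢ 3 0<3 2<3 (s≤s z≤n) w v (sym p))
  inj {inj₂ (inj₂ v)} {inj₂ (inj₁ w)} p = ⊥-elim (residue-≢ 3 1<3 2<3 (s≤s (s≤s z≤n)) w v (sym p))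
  inj {inj₂ (inj₂ v)} {inj₂ (inj₂ w)} p = cong (inj₂ ∘ inj₂) (residue-injective 3 2 {v} {w} p)

≅-sym : {I J : Set} → I ≅ J → J ≅ I
≅-sym β = record { to = from β ; from = to β ; to∘from = from∘to β ; from∘to = to∘from β }

module _ (Q : Quad) (σ : Sign) where

  private
    push : ∀ {J : Set} {e w : J → ℤ} {f} (β : J ≅ (ℤ × ℤ)) → (∀ j → ⟦ Q ⟧ (to β j) ≡ e j) → (∀ j → wt σ (to β j) ≡ w j) →
           GF e w f → PT Q σ f
    push {e = e} {w} β p q F = pt (gf-map (≅-sym β)
      (λ v → trans (sym (p (from β v))) (cong ⟦ Q ⟧ (to∘from β v)))
      (λ v → trans (sym (q (from β v))) (cong (wt σ) (to∘from β v))) F)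

    ev₂ = λ r → ∘q-eval Q (residue 2 r)
    ev₃ = λ r → ∘q-eval Q (residue 3 r)
    σ₂ = λ r → ∘σ-eval σ (residue 2 r)
    σ₃ = λ r → ∘σ-eval σ (residue 3 r)

  pt-join₂ : ∀ {f₀ f₁} → PT (Q ∘q residue 2 0) (σ ∘σ residue 2 0) f₀ → PT (Q ∘q residue 2 1) (σ ∘σ residue 2 1) f₁ →
             PT Q σ (f₀ ⊕ f₁)
  pt-join₂ F₀ F₁ = push halves≅ [ ev₂ 0 , ev₂ 1 ] [ σ₂ 0 , σ₂ 1 ] (gf-⊎ (gf F₀) (gf F₁))

  pt-join₃ : ∀ {f₀ f₁ f₂} → PT (Q ∘q residue 3 0) (σ ∘σ residue 3 0) f₀ → PT (Q ∘q residue 3 1) (σ ∘σ residue 3 1) f₁ →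
             PT (Q ∘q residue 3 2) (σ ∘σ residue 3 2) f₂ → PT Q σ (f₀ ⊕ (f₁ ⊕ f₂))
  pt-join₃ F₀ F₁ F₂ = push thirds≅ [ ev₃ 0 , [ ev₃ 1 , ev₃ 2 ] ] [ σ₃ 0 , [ σ₃ 1 , σ₃ 2 ] ] (gf-⊎ (gf F₀) (gf-⊎ (gf F₁) (gf F₂)))

  module _ {f} (P : PT Q σ f) where

    private
      P₂ : GF [ ⟦ Q ∘q residue 2 0 ⟧ , ⟦ Q ∘q residue 2 1 ⟧ ] [ wt (σ ∘σ residue 2 0) , wt (σ ∘σ residue 2 1) ] f
      P₂ = gf-map halves≅ [ ev₂ 0 , ev₂ 1 ] [ σ₂ 0 , σ₂ 1 ] (gf P)
      P₃ : GF [ ⟦ Q ∘q residue 3 0 ⟧ , [ ⟦ Q ∘q residue 3 1 ⟧ , ⟦ Q ∘q residue 3 2 ⟧ ] ]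
              [ wt (σ ∘σ residue 3 0) , [ wt (σ ∘σ residue 3 1) , wt (σ ∘σ residue 3 2) ] ] f
      P₃ = gf-map thirds≅ [ ev₃ 0 , [ ev₃ 1 , ev₃ 2 ] ] [ σ₃ 0 , [ σ₃ 1 , σ₃ 2 ] ] (gf P)

    pt-split₂ : Σ FPS λ f₀ → Σ FPS λ f₁ → PT (Q ∘q residue 2 0) (σ ∘σ residue 2 0) f₀ ×
                PT (Q ∘q residue 2 1) (σ ∘σ residue 2 1) f₁ × (f ≈ f₀ ⊕ f₁)
    pt-split₂ = leftPart P₂ , rightPart P₂ , pt (gf-left P₂) , pt (gf-right P₂) , gf-⊎-split P₂

    -- Yields one residue class of a given sum as a series without a formula. This is enough for the
    -- classes which are then shown to vanish by `pt-zero`.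
    pt-second : Σ FPS λ f₁ → PT (Q ∘q residue 3 1) (σ ∘σ residue 3 1) f₁
    pt-second = leftPart (gf-right P₃) , pt (gf-left (gf-right P₃))

    pt-third : Σ FPS λ f₂ → PT (Q ∘q residue 3 2) (σ ∘σ residue 3 2) f₂
    pt-third = rightPart (gf-right P₃) , pt (gf-right (gf-right P₃))

-- Vanishing by symmetry, and parity dissection of binary theta series.

gf-ev : ∀ {I : Set} {e w : I → ℤ} {f} → GF (λ i → + 2 * e i) w f → GF e w (ev f)
gf-ev {I} {e} {w} {f} F = record
  { nonneg = λ i → nn (e i) (nonneg F i)
  ; fib = λ N → fib F (2 ℕ.* N) ; unique = λ N → unique F (2 ℕ.* N)
  ; sound = λ {N} i∈ → ℤP.*-cancelˡ-≡ (+ 2) _ (+ N) (trans (sound F i∈) (ℤP.pos-* 2 N))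
  ; complete = λ {N} i p → complete F i (trans (cong (+ 2 *_) p) (sym (ℤP.pos-* 2 N)))
  ; value = λ N → value F (2 ℕ.* N) }
  where
  nn : ∀ z → + 2 * z ≡ + ∣ + 2 * z ∣ → z ≡ + ∣ z ∣
  nn (+ n) _ = refl

module _ {I : Set} {e w : I → ℤ} {f} (F : GF (λ i → + 2 * e i + + 1) w f) where

  gf-odd-ev : ev f ≈ 0F
  gf-odd-ev N with fib F (2 ℕ.* N) in eq | value F (2 ℕ.* N)
  ... | []    | v = v
  ... | i ∷ _ | _ = ⊥-elim (bad (sound F {2 ℕ.* N} {i} (subst (i ∈_) (sym eq) (here refl))))
    where
    bad : ¬ (+ 2 * e i + + 1 ≡ + (2 ℕ.* N))
    bad p = residue-disjoint 2 (+ N) (e i) (s≤s z≤n) (s≤s (s≤s z≤n)) (s≤s z≤n)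
      (sym (trans p (trans (ℤP.pos-* 2 N) (sym (ℤP.+-identityʳ _)))))

  gf-odd-od : (∀ i → e i ≡ + ∣ e i ∣) → GF e w (od f)
  gf-odd-od nn = record
    { nonneg = nn
    ; fib = λ N → fib F (suc (2 ℕ.* N)) ; unique = λ N → unique F (suc (2 ℕ.* N))
    ; sound = λ {N} {i} i∈ → ℤP.*-cancelˡ-≡ (+ 2) _ (+ N) (trans (cancel (trans (sound F i∈) (1+ N))) (ℤP.pos-* 2 N))
    ; complete = λ {N} i p → complete F i (trans (cong (λ z → + 2 * z + + 1) p) (trans (cong (_+ + 1) (sym (ℤP.pos-* 2 N))) (sym (1+ N))))
    ; value = λ N → value F (suc (2 ℕ.* N)) }
    where
    1+ : ∀ N → + suc (2 ℕ.* N) ≡ + (2 ℕ.* N) + + 1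
    1+ N = ℤP.+-comm (+ 1) (+ (2 ℕ.* N))
    l : ∀ x → x + + 1 - + 1 ≡ x
    l = solve-∀
    cancel : ∀ {x y} → x + + 1 ≡ y + + 1 → x ≡ y
    cancel {x} {y} p = trans (sym (l x)) (trans (cong (λ z → z - + 1) p) (l y))

gf-even-od : ∀ {I : Set} {e w : I → ℤ} {f} → GF (λ i → + 2 * e i) w f → od f ≈ 0F
gf-even-od {I} {e} {w} {f} F N with fib F (suc (2 ℕ.* N)) in eq | value F (suc (2 ℕ.* N))
... | []    | v = v
... | i ∷ _ | _ = ⊥-elim (bad (sound F {suc (2 ℕ.* N)} {i} (subst (i ∈_) (sym eq) (here refl))))
  where
  bad : ¬ (+ 2 * e i ≡ + suc (2 ℕ.* N))
  bad p = residue-disjoint 2 (e i) (+ N) (s≤s z≤n) (s≤s (s≤s z≤n)) (s≤s z≤n)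
    (trans (ℤP.+-identityʳ _) (trans p (trans (ℤP.+-comm (+ 1) (+ (2 ℕ.* N))) (cong (_+ + 1) (ℤP.pos-* 2 N)))))

infixr 7 _•_
_•_ : ℤ → Quad → Quad
k • quad a b c d e f = quad (k * a) (k * b) (k * c) (k * d) (k * e) (k * f)

infixl 6 _⊹_
_⊹_ : Quad → ℤ → Quad
quad a b c d e f ⊹ k = quad a b c d e (f + k)

•-eval : ∀ k Q v → k * ⟦ Q ⟧ v ≡ ⟦ k • Q ⟧ v
•-eval k (quad a b c d e f) (x , y) = lemma k a b c d e f x y
  where
  lemma : ∀ k a b c d e f x y → k * (a * (x * x) + b * (x * y) + c * (y * y) + d * x + e * y + f)
        ≡ k * a * (x * x) + k * b * (x * y) + k * c * (y * y) + k * d * x + k * e * y + k * f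
  lemma = solve-∀

⊹-eval : ∀ k Q v → ⟦ Q ⟧ v + k ≡ ⟦ Q ⊹ k ⟧ v
⊹-eval k (quad a b c d e f) (x , y) = ℤP.+-assoc (a * (x * x) + b * (x * y) + c * (y * y) + d * x + e * y) f k

pt-dilate : ∀ k .{{_ : NonZero k}} {Q σ f} → PT Q σ f → PT (+ k • Q) σ (dilate k f)
pt-dilate k {Q} P = pt (gf-cong (•-eval (+ k) Q) (λ _ → refl) (gf-dilate k (gf P)))

pt-mono : ∀ c {Q σ f} → PT Q σ f → PT (Q ⊹ + c) σ (mono c ⊛ f)
pt-mono c {Q} P = pt (gf-cong (λ v → trans (ℤP.+-comm (+ c) (⟦ Q ⟧ v)) (⊹-eval (+ c) Q v)) (λ _ → refl) (gf-mono⊛ c (gf P)))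

neg-sign : Sign → Sign
neg-sign (sg p r c) = sg p r (not c)

neg-sign-eval : ∀ σ v → - wt σ v ≡ wt (neg-sign σ) v
neg-sign-eval (sg p r c) (x , y) = trans (ℤP.neg-distribʳ-* (χ p x * χ r y) (χ c (+ 1))) (cong (χ p x * χ r y *_) (l c))
  where
  l : ∀ c → - χ c (+ 1) ≡ χ (not c) (+ 1)
  l false = refl
  l true  = refl

gf-neg : ∀ {I : Set} {e w : I → ℤ} {f} → GF e w f → GF e (λ i → - w i) (negF f)
gf-neg {w = w} F = record
  { nonneg = nonneg F ; fib = fib F ; unique = unique F ; sound = sound F ; complete = complete F
  ; value = λ N → trans (cong -_ (value F N)) (sym (sumOver-neg w (fib F N))) }

pt-neg : ∀ {Q σ f} → PT Q σ f → PT Q (neg-sign σ) (negF f)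
pt-neg {σ = σ} P = pt (gf-cong (λ _ → refl) (neg-sign-eval σ) (gf-neg (gf P)))

-- A symmetry of the exponent that reverses the sign gives f = -f, and ℤ has no 2-torsion.
pt-zero : ∀ {Q σ f} M → det M * det M ≡ + 1 → Q ∘q M ≡ Q → σ ∘σ M ≡ neg-sign σ → PT Q σ f → f ≈ 0F
pt-zero {Q} {σ} {f} M unit qq ss P n = zero-of (f n) (pt-unique P′ (pt-neg P) n)
  where
  P′ : PT Q (neg-sign σ) f
  P′ = subst (λ R → PT R (neg-sign σ) f) qq (subst (λ τ → PT (Q ∘q M) τ f) ss (pt-aff M unit P))
  zero-of : ∀ z → z ≡ - z → z ≡ + 0
  zero-of (+ zero) _ = refl

module _ {Q Q₀ Q₁ : Quad} {σ f} (P : PT Q σ f) (q₀ : Q ∘q residue 2 0 ≡ + 2 • Q₀) (q₁ : Q ∘q residue 2 1 ≡ + 2 • Q₁ ⊹ + 1) where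

  private
    S = pt-split₂ Q σ P
    f₀ = proj₁ S
    f₁ = proj₁ (proj₂ S)
    F₀ : GF (λ v → + 2 * ⟦ Q₀ ⟧ v) (wt (σ ∘σ residue 2 0)) f₀
    F₀ = gf-cong (λ v → trans (cong (λ R → ⟦ R ⟧ v) q₀) (sym (•-eval (+ 2) Q₀ v))) (λ _ → refl) (gf (proj₁ (proj₂ (proj₂ S))))
    F₁ : GF (λ v → + 2 * ⟦ Q₁ ⟧ v + + 1) (wt (σ ∘σ residue 2 1)) f₁
    F₁ = gf-cong (λ v → trans (cong (λ R → ⟦ R ⟧ v) q₁) (sym (trans (cong (_+ + 1) (•-eval (+ 2) Q₁ v)) (⊹-eval (+ 1) (+ 2 • Q₁) v))))
           (λ _ → refl) (gf (proj₁ (proj₂ (proj₂ (proj₂ S)))))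
    f≈ : f ≈ f₀ ⊕ f₁
    f≈ = proj₂ (proj₂ (proj₂ (proj₂ S)))
    nn₁ : ∀ z → + 2 * z + + 1 ≡ + ∣ + 2 * z + + 1 ∣ → z ≡ + ∣ z ∣
    nn₁ (+ n) _ = refl
    nn₁ -[1+ zero ] ()
    nn₁ -[1+ suc n ] ()

  -- The two hypotheses say that the parity of the exponent is the parity of x, so the part with x
  -- even is exactly the even part of f; `pt-od` is the same for x odd.
  pt-ev : PT Q₀ (σ ∘σ residue 2 0) (ev f)
  pt-ev = pt (gf-resp (λ n → sym (trans (f≈ (2 ℕ.* n))
    (trans (cong (_+_ (ev f₀ n)) (gf-odd-ev {e = ⟦ Q₁ ⟧} F₁ n)) (ℤP.+-identityʳ _)))) (gf-ev {e = ⟦ Q₀ ⟧} F₀))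

  pt-od : PT Q₁ (σ ∘σ residue 2 1) (od f)
  pt-od = pt (gf-resp (λ n → sym (trans (f≈ (suc (2 ℕ.* n)))
    (trans (cong (_+ od f₁ n) (gf-even-od {e = ⟦ Q₀ ⟧} F₀ n)) (ℤP.+-identityˡ _))))
    (gf-odd-od {e = ⟦ Q₁ ⟧} F₁ (λ v → nn₁ (⟦ Q₁ ⟧ v) (nonneg F₁ v))))

-- Unary theta series and the effect of q ↦ -q on signs.

record LT (a d : ℤ) (p : Bool) (f : FPS) : Set where
  constructor lt
  field gf : GF (λ k → a * (k * k) + d * k) (χ p) f

lt-dilate : ∀ k .{{_ : NonZero k}} {a d p f} → LT a d p f → LT (+ k * a) (+ k * d) p (dilate k f)
lt-dilate k {a} {d} F = lt (gf-cong (λ x → lemma (+ k) a d x) (λ _ → refl) (gf-dilate k (LT.gf F)))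
  where
  lemma : ∀ k a d x → k * (a * (x * x) + d * x) ≡ k * a * (x * x) + k * d * x
  lemma = solve-∀

lt-⊛ : ∀ {a d p f a′ d′ p′ g} → LT a d p f → LT a′ d′ p′ g → PT (quad a (+ 0) a′ d d′ (+ 0)) (sg p p′ false) (f ⊛ g)
lt-⊛ {a} {d} {p} {f} {a′} {d′} {p′} F G = pt (gf-cong
  (λ (x , y) → lemma a d a′ d′ x y) (λ (x , y) → sym (ℤP.*-identityʳ (χ p x * χ p′ y))) (gf-⊛ (LT.gf F) (LT.gf G)))
  where
  lemma : ∀ a d a′ d′ x y → a * (x * x) + d * x + (a′ * (y * y) + d′ * y) ≡ a * (x * x) + + 0 * (x * y) + a′ * (y * y) + d * x + d′ * y + + 0
  lemma = solve-∀

even-sgnℕ : ∀ n → χ (oddℕ n) (+ 1) ≡ sgnℕ n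
even-sgnℕ zero    = refl
even-sgnℕ (suc n) = trans (lemma (oddℕ n)) (cong -_ (even-sgnℕ n))
  where
  lemma : ∀ b → χ (not b) (+ 1) ≡ - χ b (+ 1)
  lemma false = refl
  lemma true  = refl

sgn-sq : ∀ x → sgn (x * x) ≡ sgn x
sgn-sq x = trans (sgn-* x x) (lemma (odd? x) (even-sgnℕ ∣ x ∣))
  where
  lemma : ∀ b → χ b (+ 1) ≡ sgn x → χ b x ≡ sgn x
  lemma false p = p
  lemma true  p = refl

-- Modulo 2 the term in x y drops out, as its coefficient is even, and x² and y² agree with x and y.
-- So the parity of the exponent is affine, and the twist only changes the `Sign`.
sgn-quad : ∀ a b c d e f v →
  sgn (⟦ quad a (+ 2 * b) c d e f ⟧ v) ≡ wt (sg (odd? a xor odd? d) (odd? c xor odd? e) (odd? f)) v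
sgn-quad a b c d e f (x , y) = begin
  sgn (a * (x * x) + + 2 * b * (x * y) + c * (y * y) + d * x + e * y + f)
    ≡⟨ cong sgn (reorder a b c d e f x y) ⟩
  sgn (+ 2 * (b * (x * y)) + (a * (x * x) + c * (y * y) + d * x + e * y + f * + 1))
    ≡⟨ trans (sgn-+ (+ 2 * (b * (x * y))) _) (trans (cong (_* sgn (a * (x * x) + c * (y * y) + d * x + e * y + f * + 1)) (sgn-* (+ 2) (b * (x * y)))) (ℤP.*-identityˡ _)) ⟩
  sgn (a * (x * x) + c * (y * y) + d * x + e * y + f * + 1)
    ≡⟨ sgn-+ (a * (x * x) + c * (y * y) + d * x + e * y) (f * + 1) ⟩
  sgn (a * (x * x) + c * (y * y) + d * x + e * y) * sgn (f * + 1)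
    ≡⟨ cong₂ _*_ (trans (sgn-+ (a * (x * x) + c * (y * y) + d * x) (e * y)) (cong₂ _*_
         (trans (sgn-+ (a * (x * x) + c * (y * y)) (d * x)) (cong₂ _*_ (trans (sgn-+ (a * (x * x)) (c * (y * y)))
           (cong₂ _*_ (sq a x) (sq c y))) (sgn-* d x))) (sgn-* e y))) (sgn-* f (+ 1)) ⟩
  χ (odd? a) x * χ (odd? c) y * χ (odd? d) x * χ (odd? e) y * χ (odd? f) (+ 1)
    ≡⟨ collect (χ (odd? a) x) (χ (odd? c) y) (χ (odd? d) x) (χ (odd? e) y) (χ (odd? f) (+ 1)) ⟩
  χ (odd? a) x * χ (odd? d) x * (χ (odd? c) y * χ (odd? e) y) * χ (odd? f) (+ 1)
    ≡⟨ cong (_* χ (odd? f) (+ 1)) (cong₂ _*_ (χ-xor (odd? a) (odd? d) x) (χ-xor (odd? c) (odd? e) y)) ⟨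
  wt (sg (odd? a xor odd? d) (odd? c xor odd? e) (odd? f)) (x , y) ∎
  where
  open ≡-Reasoning
  reorder : ∀ a b c d e f x y → a * (x * x) + + 2 * b * (x * y) + c * (y * y) + d * x + e * y + f
    ≡ + 2 * (b * (x * y)) + (a * (x * x) + c * (y * y) + d * x + e * y + f * + 1)
  reorder = solve-∀
  collect : ∀ a b c d e → a * b * c * d * e ≡ a * c * (b * d) * e
  collect = solve-∀
  sq : ∀ a x → sgn (a * (x * x)) ≡ χ (odd? a) x
  sq a x = trans (sgn-* a (x * x)) (lemma (odd? a))
    where
    lemma : ∀ b → χ b (x * x) ≡ χ b x
    lemma false = refl
    lemma true  = sgn-sq x

wt-* : ∀ p r c p′ r′ c′ v → wt (sg p r c) v * wt (sg p′ r′ c′) v ≡ wt (sg (p xor p′) (r xor r′) (c xor c′)) v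
wt-* p r c p′ r′ c′ (x , y) = trans
  (lemma (χ p x) (χ r y) (χ c (+ 1)) (χ p′ x) (χ r′ y) (χ c′ (+ 1)))
  (sym (cong₂ _*_ (cong₂ _*_ (χ-xor p p′ x) (χ-xor r r′ y)) (χ-xor c c′ (+ 1))))
  where
  lemma : ∀ a b c d e f → a * b * c * (d * e * f) ≡ a * d * (b * e) * (c * f)
  lemma = solve-∀

pt-twist : ∀ {a c d e f p r s g} b → PT (quad a (+ 2 * b) c d e f) (sg p r s) g →
  PT (quad a (+ 2 * b) c d e f) (sg ((odd? a xor odd? d) xor p) ((odd? c xor odd? e) xor r) (odd? f xor s)) (twist g)
pt-twist {a} {c} {d} {e} {f} {p} {r} {s} b P = pt (gf-cong (λ _ → refl)
  (λ v → trans (cong (_* wt (sg p r s) v) (sgn-quad a b c d e f v)) (wt-* (odd? a xor odd? d) (odd? c xor odd? e) (odd? f) p r s v))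
  (gf-twist (gf P)))

lt-unique : ∀ {a d p f g} → LT a d p f → LT a d p g → f ≈ g
lt-unique F G = gf-unique (LT.gf F) (LT.gf G)

lt-resp : ∀ {a d p f g} → f ≈ g → LT a d p f → LT a d p g
lt-resp p F = lt (gf-resp p (LT.gf F))

sgn-lin : ∀ a d x → sgn (a * (x * x) + d * x) ≡ χ (odd? a xor odd? d) x
sgn-lin a d x = trans (sgn-+ (a * (x * x)) (d * x)) (trans (cong₂ _*_ (trans (sgn-* a (x * x)) (lemma (odd? a))) (sgn-* d x))
  (sym (χ-xor (odd? a) (odd? d) x)))
  where
  lemma : ∀ b → χ b (x * x) ≡ χ b x
  lemma false = refl
  lemma true  = sgn-sq x

lt-twist : ∀ {a d p f} → LT a d p f → LT a d ((odd? a xor odd? d) xor p) (twist f)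
lt-twist {a} {d} {p} F = lt (gf-cong (λ _ → refl)
  (λ x → trans (cong (_* χ p x) (sgn-lin a d x)) (sym (χ-xor (odd? a xor odd? d) p x))) (gf-twist (LT.gf F)))

halves₁≅ : (ℤ ⊎ ℤ) ≅ ℤ
halves₁≅ = bijection t (λ z → proj₁ (choose z)) (λ z → proj₂ (choose z)) inj
  where
  t : ℤ ⊎ ℤ → ℤ
  t = [ (λ x → + 2 * x) , (λ x → + 2 * x + + 1) ]
  choose : ∀ z → Σ (ℤ ⊎ ℤ) λ j → t j ≡ z
  choose z with z %ℕ 2 | n%ℕd<d z 2 | a≡a%ℕn+[a/ℕn]*n z 2
  ... | 0 | _ | p = inj₁ (z /ℕ 2) , sym (trans p (trans (ℤP.+-identityˡ _) (ℤP.*-comm (z /ℕ 2) (+ 2))))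
  ... | 1 | _ | p = inj₂ (z /ℕ 2) , sym (trans p (trans (ℤP.+-comm (+ 1) ((z /ℕ 2) * + 2)) (cong (_+ + 1) (ℤP.*-comm (z /ℕ 2) (+ 2)))))
  ... | suc (suc _) | s≤s (s≤s ()) | _
  inj : ∀ {j k} → t j ≡ t k → j ≡ k
  inj {inj₁ x} {inj₁ y} p = cong inj₁ (ℤP.*-cancelˡ-≡ (+ 2) x y p)
  inj {inj₂ x} {inj₂ y} p = cong inj₂ (ℤP.*-cancelˡ-≡ (+ 2) x y (trans (sym (l (+ 2 * x))) (trans (cong (λ z → z - + 1) p) (l (+ 2 * y)))))
    where
    l : ∀ x → x + + 1 - + 1 ≡ x
    l = solve-∀
  inj {inj₁ x} {inj₂ y} p = ⊥-elim (residue-disjoint 2 x y (s≤s z≤n) (s≤s (s≤s z≤n)) (s≤s z≤n) (trans (ℤP.+-identityʳ _) p))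
  inj {inj₂ x} {inj₁ y} p = ⊥-elim (residue-disjoint 2 y x (s≤s z≤n) (s≤s (s≤s z≤n)) (s≤s z≤n) (trans (ℤP.+-identityʳ _) (sym p)))

-- One-dimensional theta series

triℕ : ℕ → ℕ
triℕ zero    = 0
triℕ (suc n) = suc n ℕ.+ triℕ n

-- tri k = k (k + 1) / 2, also for negative k.
sq tri : ℤ → ℕ
sq k = ∣ k ∣ ℕ.* ∣ k ∣
tri (+ n)    = triℕ n
tri -[1+ n ] = triℕ n

-- `ex 1 1 k` is the pentagonal number k(3k+1)/2 and `ex 1 2 k` is 2k² + k. Triangular numbers keep
-- the halved exponents natural without a division.
ex : ℕ → ℕ → ℤ → ℕ
ex a b k = a ℕ.* sq k ℕ.+ b ℕ.* tri k

ball : ℕ → List ℤ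
ball zero    = + 0 ∷ []
ball (suc n) = + suc n ∷ -[1+ n ] ∷ ball n

∈-ball⁻ : ∀ {k} n → k ∈ ball n → ∣ k ∣ ≤ n
∈-ball⁻ zero    (here refl)         = z≤n
∈-ball⁻ (suc n) (here refl)         = ℕP.≤-refl
∈-ball⁻ (suc n) (there (here refl)) = ℕP.≤-refl
∈-ball⁻ (suc n) (there (there p))   = ℕP.m≤n⇒m≤1+n (∈-ball⁻ n p)

∈-ball⁺ : ∀ k n → ∣ k ∣ ≤ n → k ∈ ball n
∈-ball⁺ (+ zero) zero    _ = here refl
∈-ball⁺ k        (suc n) p with ∣ k ∣ ℕ.≤? n
... | yes q = there (there (∈-ball⁺ k n q))
∈-ball⁺ (+ m)    (suc n) p | no ¬q with ℕP.≤-antisym p (ℕP.≰⇒> ¬q)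
...   | refl = here refl
∈-ball⁺ -[1+ m ] (suc n) p | no ¬q with ℕP.≤-antisym p (ℕP.≰⇒> ¬q)
...   | refl = there (here refl)

ball-unique : ∀ n → Unique (ball n)
ball-unique zero    = [] ∷ []
ball-unique (suc n) = ((λ ()) ∷ fresh (+ suc n) refl) ∷ fresh -[1+ n ] refl ∷ ball-unique n
  where
  fresh : ∀ k → ∣ k ∣ ≡ suc n → All (k ≢_) (ball n)
  fresh k p = All.tabulate (λ j∈ k≡j → ℕP.<⇒≱ (ℕP.≤-reflexive (sym p)) (subst (λ z → ∣ z ∣ ≤ n) (sym k≡j) (∈-ball⁻ n j∈)))

partial : Bool → ℕ → ℕ → ℕ → FPS
partial p a b n N = sumOver (λ k → χ p k * mono (ex a b k) N) (ball n)

-- The diagonal of the partial sums: for a > 0 the exponent is at least |k|, so only |k| ≤ N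
-- contribute to q^N. `partial` keeps its length separate because the finite identities fix it while
-- the coefficient varies.
theta₁ : Bool → ℕ → ℕ → FPS
theta₁ p a b N = partial p a b N N

mono-same : ∀ N → mono N N ≡ + 1
mono-same N with N ℕ.≟ N
... | yes _ = refl
... | no ¬p = contradiction refl ¬p

mono-≢ : ∀ {c N} → N ≢ c → mono c N ≡ + 0
mono-≢ {c} {N} N≢c with N ℕ.≟ c
... | yes p = contradiction p N≢c
... | no  _ = refl

module _ (p : Bool) (a b : ℕ) where

  private
    e? : ∀ N k → _
    e? N k = ex a b k ℕ.≟ N

  sumOver-filter : ∀ N ks → sumOver (λ k → χ p k * mono (ex a b k) N) ks ≡ sumOver (χ p) (filter (e? N) ks)
  sumOver-filter N []       = refl
  sumOver-filter N (k ∷ ks) with ex a b k ℕ.≟ N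
  ... | yes q = trans (cong₂ _+_ (trans (cong (χ p k *_) (trans (cong (λ z → mono z N) q) (mono-same N))) (ℤP.*-identityʳ (χ p k))) (sumOver-filter N ks))
            (cong (sumOver (χ p)) (sym (LP.filter-accept (e? N) q)))
  ... | no ¬q = trans (trans (cong₂ _+_ (trans (cong (χ p k *_) (mono-≢ (λ r → ¬q (sym r)))) (ℤP.*-zeroʳ (χ p k))) (sumOver-filter N ks)) (ℤP.+-identityˡ _))
            (cong (sumOver (χ p)) (sym (LP.filter-reject (e? N) ¬q)))

module _ (p : Bool) (a b : ℕ) .{{_ : NonZero a}} where

  private
    e? : ∀ N k → _
    e? N k = ex a b k ℕ.≟ N

  ∣k∣≤ex : ∀ k → ∣ k ∣ ≤ ex a b k
  ∣k∣≤ex k = ℕP.≤-trans (square ∣ k ∣) (ℕP.≤-trans (ℕP.m≤n*m (sq k) a) (ℕP.m≤m+n (a ℕ.* sq k) (b ℕ.* tri k)))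
    where
    square : ∀ n → n ≤ n ℕ.* n
    square zero    = z≤n
    square (suc n) = ℕP.m≤m+n (suc n) (n ℕ.* suc n)

  gf-partial : ∀ N n → N ≤ n → ∀ k → + ex a b k ≡ + N → k ∈ filter (e? N) (ball n)
  gf-partial N n N≤n k q = ∈-filter⁺ (e? N) (∈-ball⁺ k n (ℕP.≤-trans (∣k∣≤ex k) (ℕP.≤-trans (ℕP.≤-reflexive (ℤP.+-injective q)) N≤n))) (ℤP.+-injective q)

  gf₁ : GF (λ k → + ex a b k) (χ p) (theta₁ p a b)
  gf₁ = record
    { nonneg   = λ _ → refl
    ; fib      = λ N → filter (e? N) (ball N)
    ; unique   = λ N → UP.filter⁺ (e? N) (ball-unique N)
    ; sound    = λ {N} k∈ → cong +_ (proj₂ (∈-filter⁻ (e? N) {xs = ball N} k∈))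
    ; complete = λ {N} → gf-partial N N ℕP.≤-refl
    ; value    = λ N → sumOver-filter p a b N (ball N) }

  partial-stable : ∀ {N n} → N ≤ n → partial p a b n N ≡ theta₁ p a b N
  partial-stable {N} {n} N≤n = trans (sumOver-filter p a b N (ball n)) (trans
    (sumOver-set (χ p) (UP.filter⁺ (e? N) (ball-unique n)) (UP.filter⁺ (e? N) (ball-unique N))
      (λ k∈ → gf-partial N N ℕP.≤-refl _ (cong +_ (proj₂ (∈-filter⁻ (e? N) {xs = ball n} k∈))))
      (λ k∈ → gf-partial N n N≤n _ (cong +_ (proj₂ (∈-filter⁻ (e? N) {xs = ball N} k∈)))))
    (sym (sumOver-filter p a b N (ball N))))

+sq : ∀ k → + sq k ≡ k * k
+sq k = trans (cong +_ (sym (ℤP.abs-* k k))) (lemma k)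
  where
  lemma : ∀ k → + ∣ k * k ∣ ≡ k * k
  lemma (+ zero)  = refl
  lemma (+ suc n) = refl
  lemma -[1+ n ]  = refl

2triℕ : ∀ n → 2 ℕ.* triℕ n ≡ n ℕ.* suc n
2triℕ zero    = refl
2triℕ (suc n) = trans (ℕP.*-distribˡ-+ 2 (suc n) (triℕ n)) (trans (cong (2 ℕ.* suc n ℕ.+_) (2triℕ n)) (lemma n))
  where
  lemma : ∀ n → 2 ℕ.* suc n ℕ.+ n ℕ.* suc n ≡ suc n ℕ.* suc (suc n)
  lemma = ℕR.solve-∀

+2tri : ∀ k → + 2 * + tri k ≡ k * k + k
+2tri (+ n) = trans (sym (ℤP.pos-* 2 (triℕ n))) (trans (cong +_ (2triℕ n)) (trans (ℤP.pos-* n (suc n)) (lemma (+ n))))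
  where
  lemma : ∀ x → x * (+ 1 + x) ≡ x * x + x
  lemma = solve-∀
+2tri -[1+ n ] = trans (sym (ℤP.pos-* 2 (triℕ n))) (trans (cong +_ (2triℕ n)) (trans (ℤP.pos-* n (suc n)) (lemma (+ n))))
  where
  lemma : ∀ x → x * (+ 1 + x) ≡ (- (+ 1 + x)) * (- (+ 1 + x)) + - (+ 1 + x)
  lemma = solve-∀

-- Doubling b makes the exponent polynomial integral, since 2 b k(k+1)/2 = b k² + b k. For instance
-- `theta₁ false 1 4` has the exponent 3k² + 2k.
lt-theta₁ : ∀ p a b .{{_ : NonZero a}} → LT (+ (a ℕ.+ b)) (+ b) p (theta₁ p a (2 ℕ.* b))
lt-theta₁ p a b = lt (gf-cong eq (λ _ → refl) (gf₁ p a (2 ℕ.* b)))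
  where
  lemma : ∀ a b s t k → t ≡ k * k + k → s ≡ k * k → a * s + b * t ≡ (a + b) * (k * k) + b * k
  lemma a b s t k refl refl = lemma′ a b k
    where
    lemma′ : ∀ a b k → a * (k * k) + b * (k * k + k) ≡ (a + b) * (k * k) + b * k
    lemma′ = solve-∀
  eq : ∀ k → + ex a (2 ℕ.* b) k ≡ + (a ℕ.+ b) * (k * k) + + b * k
  eq k = trans (cong₂ _+_ (ℤP.pos-* a (sq k)) (trans (cong +_ (trans (cong (ℕ._* tri k) (ℕP.*-comm 2 b)) (ℕP.*-assoc b 2 (tri k))))
           (trans (ℤP.pos-* b (2 ℕ.* tri k)) (cong (+ b *_) (ℤP.pos-* 2 (tri k))))))
         (lemma (+ a) (+ b) (+ sq k) (+ 2 * + tri k) k (+2tri k) (+sq k))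

-- Agreement up to q^n and the finite products converging to E.

infix 4 _≈[_]_
_≈[_]_ : FPS → ℕ → FPS → Set
f ≈[ n ] g = ∀ m → m ≤ n → f m ≡ g m

⊛-cong[] : ∀ {n f f′ g g′} → f ≈[ n ] f′ → g ≈[ n ] g′ → f ⊛ g ≈[ n ] f′ ⊛ g′
⊛-cong[] {n} p q m m≤n = sumOver-cong-∈ (upTo (suc m)) (λ {i} i∈ →
  cong₂ _*_ (p i (ℕP.≤-trans (ℕ.≤-pred (∈-upTo⁻ i∈)) m≤n)) (q (m ∸ i) (ℕP.≤-trans (ℕP.m∸n≤m m i) m≤n)))

⊛mono-< : ∀ f {c m} → m < c → (f ⊛ mono c) m ≡ + 0
⊛mono-< f {c} {m} m<c = trans (⊛-comm f (mono c) m) (sm c m m<c)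
  where
  sm : ∀ c m → m < c → (mono c ⊛ f) m ≡ + 0
  sm (suc c) zero    _         = sym (gf-unique
    (gf-cong (λ i → sym (ℤP.+-assoc (+ 1) (+ c) (+ i))) (λ _ → refl) (gf-qmul (gf-mono⊛ c (gf-ℕ f)))) (gf-mono⊛ (suc c) (gf-ℕ f)) 0)
  sm (suc c) (suc m) (s≤s m<c) = trans (mono-suc c f m) (sm c m m<c)

dilate-cong[] : ∀ k .{{_ : NonZero k}} {n f g} → f ≈[ n ] g → dilate k f ≈[ n ] dilate k g
dilate-cong[] k p m m≤n with k ∣? m
... | yes _ = p _ (ℕP.≤-trans (ℕD.m/n≤m m k) m≤n)
... | no  _ = refl

1-q^ : ℕ → FPS
1-q^ k = one ⊖ mono k

-- The product of 1 - q^j over s < j ≤ s + r, peeled from its smallest factor; `Pr-top` peels the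
-- largest one. The telescoping arguments need both.
Pr : ℕ → ℕ → FPS
Pr s zero    = one
Pr s (suc r) = 1-q^ (suc s) ⊛ Pr (suc s) r

Pr-top : ∀ s r → Pr s (suc r) ≈ Pr s r ⊛ 1-q^ (suc (s ℕ.+ r))
Pr-top s zero    = ≈-trans (⊛-comm (1-q^ (suc s)) one)
  (λ n → cong (λ k → (one ⊛ 1-q^ (suc k)) n) (sym (ℕP.+-identityʳ s)))
Pr-top s (suc r) = ≈-trans (⊛-cong (≈-refl {1-q^ (suc s)}) (Pr-top (suc s) r))
  (≈-trans (swap-last (Pr (suc s) r) (1-q^ (suc s)) (1-q^ (suc (suc s ℕ.+ r))))
    (λ n → cong (λ k → (1-q^ (suc s) ⊛ Pr (suc s) r ⊛ 1-q^ (suc k)) n) (sym (ℕP.+-suc s r))))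

Efin≈ : ∀ n → Efin n ≈ Pr 0 n
Efin≈ zero    = ≈-refl
Efin≈ (suc n) = ≈-trans (⊛-cong (Efin≈ n) (≈-refl {1-q^ (suc n)})) (≈-sym (Pr-top 0 n))

Efin-suc : ∀ n → Efin (suc n) ≈[ n ] Efin n
Efin-suc n m m≤n = trans (expand m) (trans (cong (λ z → Efin n m - z) (⊛mono-< (Efin n) (s≤s m≤n))) (ℤP.+-identityʳ _))
  where
  expand : Efin n ⊛ (one ⊖ mono (suc n)) ≈ Efin n ⊖ (Efin n ⊛ mono (suc n))
  expand = expand-1- (Efin n) (mono (suc n))

Efin-stable : ∀ {m} k → Efin (k ℕ.+ m) m ≡ E m
Efin-stable     zero    = refl
Efin-stable {m} (suc k) = trans (Efin-suc (k ℕ.+ m) m (ℕP.m≤n+m m k)) (Efin-stable k)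

E≈[] : ∀ n → E ≈[ n ] Efin n
E≈[] n m m≤n = sym (subst (λ z → Efin z m ≡ E m) (ℕP.m∸n+n≡m m≤n) (Efin-stable (n ∸ m)))

-- Euler's pentagonal number theorem, through Shanks's finite identity
-- Σ_{|k| ≤ n} (-1)^k q^{k(3k+1)/2} = Σ_{s ≤ n} (-1)^s (q^{s+1};q)_{n-s} q^{sn+s(s+1)/2}.

sgnF : ℕ → FPS
sgnF zero    = one
sgnF (suc s) = negF (sgnF s)

sgnF⊛ : ∀ s f n → (sgnF s ⊛ f) n ≡ sgnℕ s * f n
sgnF⊛ zero    f n = trans (one⊛ f n) (sym (ℤP.*-identityˡ (f n)))
sgnF⊛ (suc s) f n = trans (neg-⊛ (sgnF s) f n) (trans (cong -_ (sgnF⊛ s f n)) (ℤP.neg-distribˡ-* (sgnℕ s) (f n)))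

module Pentagonal where

  term : ℕ → ℕ → FPS
  term n s = sgnF s ⊛ Pr s (n ∸ s) ⊛ mono (s ℕ.* n ℕ.+ triℕ s)

  S : ℕ → ℕ → FPS
  S n zero    = term n 0
  S n (suc t) = S n t ⊕ term n (suc t)

  -- A closed form of the difference between `S n t` and `S (suc n) t`, which makes the comparison
  -- of consecutive n an induction on t.
  g : ℕ → ℕ → FPS
  g n t = sgnF t ⊛ Pr t (n ∸ t) ⊛ mono (suc t ℕ.* suc n ℕ.+ triℕ t)

  telescope : ∀ n t → t ≤ n → S (suc n) t ⊕ g n t ≈ S n t
  telescope n zero _ = ≈-trans
    (⊕-cong (≈-trans (simp (Pr 0 (suc n))) (Pr-top 0 n))
            (⊛-cong (one⊛ (Pr 0 n)) (λ m → cong (λ k → mono k m) (trans (ℕP.+-identityʳ _) (ℕP.+-identityʳ (suc n))))))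
    (≈-trans (pent-base (Pr 0 n) (mono (suc n))) (≈-sym (simp (Pr 0 n))))
    where
    simp : ∀ P → one ⊛ P ⊛ one ≈ P
    simp = one-one
  telescope n (suc t) t<n = ≈-trans
    (⊕-cong (⊕-cong (≈-refl {S (suc n) t}) (⊛-cong (⊛-cong (≈-refl {sgnF (suc t)}) top) Mw)) (⊛-cong (≈-refl {sgnF (suc t) ⊛ X}) Mwy))
    (≈-trans (pent-step (S (suc n) t) (sgnF t) X M w y)
      (⊕-cong (≈-trans (⊕-cong (≈-refl {S (suc n) t}) (⊛-cong (⊛-cong (≈-refl {sgnF t}) (≈-sym bottom)) (≈-refl {M}))) (telescope n t (ℕP.<⇒≤ t<n)))
              (⊛-cong (≈-refl {sgnF (suc t) ⊛ X}) (λ m → cong (λ k → mono k m) (exps₀ n t (triℕ t))))))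
    where
    r = n ∸ suc t
    X = Pr (suc t) r
    M = mono (suc t ℕ.* suc n ℕ.+ triℕ t)
    w = mono (suc t)
    y = mono (suc n)
    n∸t : n ∸ t ≡ suc r
    n∸t = ℕP.+-∸-assoc 1 t<n
    top : Pr (suc t) (n ∸ t) ≈ X ⊛ 1-q^ (suc n)
    top = subst (λ k → Pr (suc t) k ≈ X ⊛ 1-q^ (suc n)) (sym n∸t)
      (subst (λ k → Pr (suc t) (suc r) ≈ X ⊛ 1-q^ (suc k)) (ℕP.m+[n∸m]≡n t<n) (Pr-top (suc t) r))
    bottom : Pr t (n ∸ t) ≈ 1-q^ (suc t) ⊛ X
    bottom m = cong (λ k → Pr t k m) n∸t
    exps₀ : ∀ n t u → suc t ℕ.* suc n ℕ.+ u ≡ suc t ℕ.* n ℕ.+ (suc t ℕ.+ u)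
    exps₀ = ℕR.solve-∀
    exps₁ : ∀ n t u → suc t ℕ.* suc n ℕ.+ (suc t ℕ.+ u) ≡ suc t ℕ.* suc n ℕ.+ u ℕ.+ suc t
    exps₁ = ℕR.solve-∀
    exps₂ : ∀ n t u → suc (suc t) ℕ.* suc n ℕ.+ (suc t ℕ.+ u) ≡ suc t ℕ.* suc n ℕ.+ u ℕ.+ suc t ℕ.+ suc n
    exps₂ = ℕR.solve-∀
    Mw : mono (suc t ℕ.* suc n ℕ.+ triℕ (suc t)) ≈ M ⊛ w
    Mw = ≈-trans (λ m → cong (λ k → mono k m) (exps₁ n t (triℕ t))) (≈-sym (mono-⊛ (suc t ℕ.* suc n ℕ.+ triℕ t) (suc t)))
    Mwy : mono (suc (suc t) ℕ.* suc n ℕ.+ triℕ (suc t)) ≈ M ⊛ w ⊛ y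
    Mwy = ≈-trans (λ m → cong (λ k → mono k m) (exps₂ n t (triℕ t))) (≈-trans (≈-sym (mono-⊛ (suc t ℕ.* suc n ℕ.+ triℕ t ℕ.+ suc t) (suc n)))
            (⊛-cong (≈-sym (mono-⊛ (suc t ℕ.* suc n ℕ.+ triℕ t) (suc t))) (≈-refl {y})))

  -- At t = n the passage from n to n + 1 adds the last term of `S (suc n)` and subtracts `g n n`.
  -- Both have an empty product, and they are the two pentagonal terms with index n + 1 and -(n +
  -- 1).
  finite : ∀ n → partial true 1 1 n ≈ S n n
  finite zero    m = trans (cong (_+ + 0) (ℤP.*-identityˡ (one m))) (trans (ℤP.+-identityʳ (one m)) (sym (one-one one m)))
  finite (suc n) m = begin
    sgnℕ (suc n) * mono (ex 1 1 (+ suc n)) m + (sgnℕ (suc n) * mono (ex 1 1 -[1+ n ]) m + partial true 1 1 n m)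
      ≡⟨ cong₂ _+_ (sym topterm) (cong₂ _+_ (sym gterm) (trans (finite n m) (sym (telescope n n ℕP.≤-refl m)))) ⟩
    term (suc n) (suc n) m + (- g n n m + (S (suc n) n m + g n n m))
      ≡⟨ lemma (term (suc n) (suc n) m) (g n n m) (S (suc n) n m) ⟩
    S (suc n) n m + term (suc n) (suc n) m ∎
    where
    open ≡-Reasoning
    lemma : ∀ a b c → a + (- b + (c + b)) ≡ c + a
    lemma = solve-∀
    exp₁ : ∀ n → n ℕ.* n ≡ 1 ℕ.* (n ℕ.* n)
    exp₁ = ℕR.solve-∀
    close : ∀ s k c → k ≡ 0 → (sgnF s ⊛ Pr s k ⊛ mono c) m ≡ sgnℕ s * mono c m
    close s .0 c refl = trans (⊛-assoc (sgnF s) one (mono c) m) (trans (sgnF⊛ s (one ⊛ mono c) m) (cong (sgnℕ s *_) (one⊛ (mono c) m)))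
    topterm : term (suc n) (suc n) m ≡ sgnℕ (suc n) * mono (ex 1 1 (+ suc n)) m
    topterm = trans (close (suc n) (n ∸ n) _ (ℕP.n∸n≡0 n)) (cong (λ k → sgnℕ (suc n) * mono k m)
      (cong₂ ℕ._+_ (exp₁ (suc n)) (sym (ℕP.*-identityˡ (triℕ (suc n))))))
    gterm : - g n n m ≡ sgnℕ (suc n) * mono (ex 1 1 -[1+ n ]) m
    gterm = trans (cong -_ (close n (n ∸ n) _ (ℕP.n∸n≡0 n))) (trans (ℤP.neg-distribˡ-* (sgnℕ n) _) (cong (λ k → sgnℕ (suc n) * mono k m)
      (cong₂ ℕ._+_ (exp₁ (suc n)) (sym (ℕP.*-identityˡ (triℕ n))))))

  -- Every term with s ≥ 1 begins at an exponent larger than n, so up to q^n only the term s = 0,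
  -- which is (q;q)_n, is left.
  limit : ∀ n t → S n t ≈[ n ] Efin n
  limit n zero    m _   = trans (one-one (Pr 0 n) m) (sym (Efin≈ n m))
  limit n (suc t) m m≤n = trans (cong₂ _+_ (limit n t m m≤n) (⊛mono-< (sgnF (suc t) ⊛ Pr (suc t) (n ∸ suc t)) big)) (ℤP.+-identityʳ _)
    where
    big : m < suc t ℕ.* n ℕ.+ triℕ (suc t)
    big = ℕP.≤-trans (s≤s (ℕP.≤-trans m≤n (ℕP.m≤m+n n (t ℕ.* n)))) (ℕP.≤-trans (ℕP.≤-reflexive (ℕP.+-comm 1 (suc t ℕ.* n)))
            (ℕP.+-monoʳ-≤ (suc t ℕ.* n) (s≤s z≤n)))

E≈theta₁ : E ≈ theta₁ true 1 1
E≈theta₁ N = sym (trans (Pentagonal.finite N N) (Pentagonal.limit N N N ℕP.≤-refl))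

mono-cong : ∀ {a b} → a ≡ b → mono a ≈ mono b
mono-cong p m = cong (λ k → mono k m) p

dilate-1-q^ : ∀ k .{{_ : NonZero k}} c → dilate k (1-q^ c) ≈ 1-q^ (k ℕ.* c)
dilate-1-q^ k c = ≈-trans (dilate-⊖ k one (mono c)) (⊖-cong (≈-trans (dilate-mono k 0) (mono-cong (ℕP.*-zeroʳ k))) (dilate-mono k c))

Odd : ℕ → FPS
Odd zero    = one
Odd (suc n) = Odd n ⊛ 1-q^ (suc (2 ℕ.* n))

-- Gauss's theorem Σ_k q^{2k²+k} · (q;q²)_∞ = (q²;q²)_∞, through Shanks's finite identity
-- (q;q²)_n Σ_{|k| ≤ n} q^{2k²+k} = Σ_{s ≤ n} (q^{2s+2};q²)_{n-s} (q;q²)_s q^{s(2n+1)}.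
module Gauss where

  W : ℕ → ℕ → FPS
  W s r = dilate 2 (Pr s r)

  term : ℕ → ℕ → FPS
  term n s = W s (n ∸ s) ⊛ Odd s ⊛ mono (s ℕ.* suc (2 ℕ.* n))

  T : ℕ → ℕ → FPS
  T n zero    = term n 0
  T n (suc t) = T n t ⊕ term n (suc t)

  -- The difference `T (suc n) t` - (1 - q^(2n+1)) `T n t` in closed form; the factor is the one by
  -- which `Odd` grows.
  h : ℕ → ℕ → FPS
  h n t = W t (n ∸ t) ⊛ Odd (suc t) ⊛ mono (suc t ℕ.* suc (2 ℕ.* n))

  W-top : ∀ s r → W s (suc r) ≈ W s r ⊛ 1-q^ (2 ℕ.* suc (s ℕ.+ r))
  W-top s r = ≈-trans (dilate-cong 2 (Pr-top s r)) (≈-trans (dilate-⊛ 2 (Pr s r) (1-q^ (suc (s ℕ.+ r))))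
    (⊛-cong (≈-refl {W s r}) (dilate-1-q^ 2 (suc (s ℕ.+ r)))))

  W-bottom : ∀ s r → W s (suc r) ≈ 1-q^ (2 ℕ.* suc s) ⊛ W (suc s) r
  W-bottom s r = ≈-trans (dilate-⊛ 2 (1-q^ (suc s)) (Pr (suc s) r)) (⊛-cong (dilate-1-q^ 2 (suc s)) (≈-refl {W (suc s) r}))

  1-q^-cong : ∀ {k f} → mono k ≈ f → 1-q^ k ≈ one ⊖ f
  1-q^-cong = ⊖-cong (≈-refl {one})

  telescope : ∀ n t → t ≤ n → T (suc n) t ≈ 1-q^ (suc (2 ℕ.* n)) ⊛ T n t ⊕ h n t
  telescope n zero _ = ≈-trans (simp (W 0 (suc n)))
    (≈-trans (≈-trans (W-top 0 n) (⊛-cong (≈-refl {W 0 n}) (1-q^-cong az)))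
      (≈-trans (gauss-base (W 0 n) (mono 1) z)
        (⊕-cong (⊛-cong (≈-refl {1-q^ (suc (2 ℕ.* n))}) (≈-sym (simp (W 0 n))))
                (⊛-cong (⊛-cong (≈-refl {W 0 n}) (≈-sym (one⊛ (1-q^ 1)))) (mono-cong (sym (ℕP.+-identityʳ (suc (2 ℕ.* n)))))))))
    where
    z = mono (suc (2 ℕ.* n))
    simp : ∀ P → P ⊛ one ⊛ one ≈ P
    simp = one-one′
    ex₀ : ∀ n → 2 ℕ.* suc n ≡ 1 ℕ.+ suc (2 ℕ.* n)
    ex₀ = ℕR.solve-∀
    az : mono (2 ℕ.* suc n) ≈ mono 1 ⊛ z
    az = ≈-trans (mono-cong (ex₀ n)) (≈-sym (mono-⊛ 1 (suc (2 ℕ.* n))))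
  telescope n (suc t) t<n = ≈-trans
    (⊕-cong (≈-trans (telescope n t (ℕP.<⇒≤ t<n)) (⊕-cong (≈-refl {1-q^ (suc (2 ℕ.* n)) ⊛ T n t}) (⊛-cong (⊛-cong bottom (≈-refl {Y})) (≈-refl {M}))))
            (⊛-cong (⊛-cong top (≈-refl {Y})) Mv))
    (≈-trans (gauss-step (T n t) X Y M v (mono 1) z)
      (⊕-cong (≈-refl {1-q^ (suc (2 ℕ.* n)) ⊛ (T n t ⊕ X ⊛ Y ⊛ M)}) (⊛-cong (⊛-cong (≈-refl {X}) (⊛-cong (≈-refl {Y}) (≈-sym (1-q^-cong av)))) (≈-sym Mz))))
    where
    r = n ∸ suc t
    X = W (suc t) r
    Y = Odd (suc t)
    M = mono (suc t ℕ.* suc (2 ℕ.* n))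
    v = mono (2 ℕ.* suc t)
    z = mono (suc (2 ℕ.* n))
    n∸t : n ∸ t ≡ suc r
    n∸t = ℕP.+-∸-assoc 1 t<n
    ex₀ : ∀ n → 2 ℕ.* suc n ≡ 1 ℕ.+ suc (2 ℕ.* n)
    ex₀ = ℕR.solve-∀
    bottom : W t (n ∸ t) ≈ (one ⊖ v) ⊛ X
    bottom = subst (λ k → W t k ≈ (one ⊖ v) ⊛ X) (sym n∸t) (W-bottom t r)
    top : W (suc t) (n ∸ t) ≈ X ⊛ (one ⊖ (mono 1 ⊛ z))
    top = subst (λ k → W (suc t) k ≈ X ⊛ (one ⊖ (mono 1 ⊛ z))) (sym n∸t)
      (≈-trans (W-top (suc t) r) (⊛-cong (≈-refl {X}) (1-q^-cong
        (≈-trans (mono-cong (trans (cong (λ k → 2 ℕ.* suc k) (ℕP.m+[n∸m]≡n t<n)) (ex₀ n))) (≈-sym (mono-⊛ 1 (suc (2 ℕ.* n))))))))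
    av : mono (suc (2 ℕ.* suc t)) ≈ mono 1 ⊛ v
    av = ≈-sym (mono-⊛ 1 (2 ℕ.* suc t))
    exv : ∀ n t → suc t ℕ.* suc (2 ℕ.* suc n) ≡ suc t ℕ.* suc (2 ℕ.* n) ℕ.+ 2 ℕ.* suc t
    exv = ℕR.solve-∀
    exz : ∀ n t → suc (suc t) ℕ.* suc (2 ℕ.* n) ≡ suc t ℕ.* suc (2 ℕ.* n) ℕ.+ suc (2 ℕ.* n)
    exz = ℕR.solve-∀
    Mv : mono (suc t ℕ.* suc (2 ℕ.* suc n)) ≈ M ⊛ v
    Mv = ≈-trans (mono-cong (exv n t)) (≈-sym (mono-⊛ (suc t ℕ.* suc (2 ℕ.* n)) (2 ℕ.* suc t)))
    Mz : mono (suc (suc t) ℕ.* suc (2 ℕ.* n)) ≈ M ⊛ z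
    Mz = ≈-trans (mono-cong (exz n t)) (≈-sym (mono-⊛ (suc t ℕ.* suc (2 ℕ.* n)) (suc (2 ℕ.* n))))

  -- At t = n the correction `h n n` and the last term of `T (suc n)` are both `Odd (suc n)` times a
  -- monomial, with exponents (n+1)(2n+1) and (n+1)(2n+3). These are the values of 2k² + k at k =
  -- -(n+1) and k = n+1.
  shanks : ∀ n → T n n ≈ Odd n ⊛ partial false 1 2 n
  shanks zero    = ≈-trans (one-one′ (W 0 0)) (≈-trans (≈-trans (dilate-mono 2 0) λ m → sym (trans (ℤP.+-identityʳ (+ 1 * one m)) (ℤP.*-identityˡ (one m))))
    (≈-sym (one⊛ (partial false 1 2 0))))
  shanks (suc n) = ≈-trans
    (⊕-cong (≈-trans (telescope n n ℕP.≤-refl) (⊕-cong (⊛-cong (≈-refl {1-q^ (suc (2 ℕ.* n))}) (shanks n))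
              (close n (mono (suc n ℕ.* suc (2 ℕ.* n))))))
            (close′ (mono (suc n ℕ.* suc (2 ℕ.* suc n)))))
    (≈-trans (gauss-end (Odd n) (partial false 1 2 n) (mono (suc (2 ℕ.* n))) (mono (suc n ℕ.* suc (2 ℕ.* n))) (mono (suc n ℕ.* suc (2 ℕ.* suc n))))
      (⊛-cong (≈-refl {Odd (suc n)}) λ m → cong₂ _+_ (trans (mono-cong e₊ m) (sym (ℤP.*-identityˡ _)))
        (cong (λ s → s + partial false 1 2 n m) (trans (mono-cong e₋ m) (sym (ℤP.*-identityˡ _))))))
    where
    W0 : ∀ k s → k ≡ 0 → W s k ≈ one
    W0 .0 s refl = dilate-mono 2 0
    close : ∀ k M → W k (k ∸ k) ⊛ Odd (suc n) ⊛ M ≈ Odd (suc n) ⊛ M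
    close k M = ⊛-cong (≈-trans (⊛-cong (W0 (k ∸ k) k (ℕP.n∸n≡0 k)) (≈-refl {Odd (suc n)})) (one⊛ (Odd (suc n)))) (≈-refl {M})
    close′ : ∀ M → W (suc n) (n ∸ n) ⊛ Odd (suc n) ⊛ M ≈ Odd (suc n) ⊛ M
    close′ = close (suc n)
    l₊ : ∀ n u → u ≡ n ℕ.* suc n → suc n ℕ.* suc (2 ℕ.* suc n) ≡ 1 ℕ.* (suc n ℕ.* suc n) ℕ.+ (2 ℕ.* suc n ℕ.+ u)
    l₊ n .(n ℕ.* suc n) refl = l n
      where
      l : ∀ n → suc n ℕ.* suc (2 ℕ.* suc n) ≡ 1 ℕ.* (suc n ℕ.* suc n) ℕ.+ (2 ℕ.* suc n ℕ.+ n ℕ.* suc n)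
      l = ℕR.solve-∀
    l₋ : ∀ n u → u ≡ n ℕ.* suc n → suc n ℕ.* suc (2 ℕ.* n) ≡ 1 ℕ.* (suc n ℕ.* suc n) ℕ.+ u
    l₋ n .(n ℕ.* suc n) refl = l n
      where
      l : ∀ n → suc n ℕ.* suc (2 ℕ.* n) ≡ 1 ℕ.* (suc n ℕ.* suc n) ℕ.+ n ℕ.* suc n
      l = ℕR.solve-∀
    e₊ : suc n ℕ.* suc (2 ℕ.* suc n) ≡ ex 1 2 (+ suc n)
    e₊ = trans (l₊ n (2 ℕ.* triℕ n) (2triℕ n)) (cong (λ z → 1 ℕ.* (suc n ℕ.* suc n) ℕ.+ z) (sym (ℕP.*-distribˡ-+ 2 (suc n) (triℕ n))))
    e₋ : suc n ℕ.* suc (2 ℕ.* n) ≡ ex 1 2 -[1+ n ]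
    e₋ = l₋ n (2 ℕ.* triℕ n) (2triℕ n)

  limit : ∀ n t → T n t ≈[ 2 ℕ.* n ] W 0 n
  limit n zero    m _    = one-one′ (W 0 n) m
  limit n (suc t) m m≤2n = trans (cong₂ _+_ (limit n t m m≤2n) (⊛mono-< (W (suc t) (n ∸ suc t) ⊛ Odd (suc t))
    (ℕP.≤-trans (s≤s m≤2n) (ℕP.m≤m+n (suc (2 ℕ.* n)) (t ℕ.* suc (2 ℕ.* n)))))) (ℤP.+-identityʳ _)

-- Defined by recursion so that `Efin (dbl (suc n))` unfolds by itself to two further factors, one
-- odd and one even.
dbl : ℕ → ℕ
dbl zero    = zero
dbl (suc n) = suc (suc (dbl n))

dbl≡ : ∀ n → dbl n ≡ 2 ℕ.* n
dbl≡ zero    = refl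
dbl≡ (suc n) = trans (cong (λ k → suc (suc k)) (dbl≡ n)) (sym (ℕP.*-suc 2 n))

n≤dbl : ∀ n → n ≤ dbl n
n≤dbl n = ℕP.≤-trans (ℕP.m≤m+n n (n ℕ.+ 0)) (ℕP.≤-reflexive (sym (dbl≡ n)))

dilate-Efin : ∀ k .{{_ : NonZero k}} n → dilate k (Efin (suc n)) ≈ dilate k (Efin n) ⊛ 1-q^ (k ℕ.* suc n)
dilate-Efin k n = ≈-trans (dilate-⊛ k (Efin n) (1-q^ (suc n))) (⊛-cong (≈-refl {dilate k (Efin n)}) (dilate-1-q^ k (suc n)))

Odd-even : ∀ n → Odd n ⊛ dilate 2 (Efin n) ≈ Efin (dbl n)
Odd-even zero    = ≈-trans (one⊛ (dilate 2 one)) (dilate-mono 2 0)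
Odd-even (suc n) = ≈-trans (⊛-cong (≈-refl {Odd (suc n)}) (dilate-Efin 2 n))
  (≈-trans (odd-even-step (Odd n) (dilate 2 (Efin n)) (1-q^ (suc (2 ℕ.* n))) (1-q^ (2 ℕ.* suc n)))
    (⊛-cong (⊛-cong (Odd-even n) (⊖-cong (≈-refl {one}) (mono-cong (cong suc (sym (dbl≡ n))))))
      (⊖-cong (≈-refl {one}) (mono-cong (sym (dbl≡ (suc n)))))))

ψ : FPS
ψ = theta₁ false 1 2

-- The coefficient of q^N is read off with E cut at 2N factors, because these are `Odd N` times
-- (q²;q²)_N. `Odd N` turns the partial sum of ψ into `T N N`, which agrees with E(q²) up to q^(2N).
gauss : ψ ⊛ E ≈ dilate 2 E ⊛ dilate 2 E
gauss N = begin
  (ψ ⊛ E) N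
    ≡⟨ ⊛-cong[] {N} {ψ} {partial false 1 2 N} {E} {Efin (dbl N)} (λ m m≤N → sym (partial-stable false 1 2 m≤N))
         (λ m m≤N → E≈[] (dbl N) m (ℕP.≤-trans m≤N (n≤dbl N))) N ℕP.≤-refl ⟩
  (partial false 1 2 N ⊛ Efin (dbl N)) N
    ≡⟨ ⊛-cong (≈-refl {partial false 1 2 N}) (≈-sym (Odd-even N)) N ⟩
  (partial false 1 2 N ⊛ (Odd N ⊛ dilate 2 (Efin N))) N
    ≡⟨ rot (partial false 1 2 N) (Odd N) (dilate 2 (Efin N)) N ⟩
  ((Odd N ⊛ partial false 1 2 N) ⊛ dilate 2 (Efin N)) N
    ≡⟨ ⊛-cong (≈-sym (Gauss.shanks N)) (≈-refl {dilate 2 (Efin N)}) N ⟩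
  (Gauss.T N N ⊛ dilate 2 (Efin N)) N
    ≡⟨ ⊛-cong[] {N} {Gauss.T N N} {dilate 2 E} {dilate 2 (Efin N)} {dilate 2 E}
         (λ m m≤N → trans (Gauss.limit N N m (ℕP.≤-trans m≤N (ℕP.m≤m+n N (N ℕ.+ 0)))) (trans (sym (dilate-cong 2 (Efin≈ N) m)) (sym (E2 m m≤N))))
         (λ m m≤N → sym (E2 m m≤N)) N ℕP.≤-refl ⟩
  (dilate 2 E ⊛ dilate 2 E) N ∎
  where
  open ≡-Reasoning
  E2 : dilate 2 E ≈[ N ] dilate 2 (Efin N)
  E2 = dilate-cong[] 2 (E≈[] N)

twist-mono : ∀ c m → twist (mono c) m ≡ sgnℕ c * mono c m
twist-mono c m with m ℕ.≟ c
... | yes refl = refl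
... | no _     = trans (ℤP.*-zeroʳ (sgnℕ m)) (sym (ℤP.*-zeroʳ (sgnℕ c)))

twist-1-q^ : ∀ c → twist (1-q^ c) ≈ λ m → one m - sgnℕ c * mono c m
twist-1-q^ c m = trans (twist-⊖ one (mono c) m) (cong₂ _-_ (trans (twist-mono 0 m) (ℤP.*-identityˡ (one m))) (twist-mono c m))

-- The product E(-q) E(q) E(q⁴) = E(q²)³.

D : FPS
D = twist E

module TripleProduct where

  twist-odd : ∀ n → twist (1-q^ (suc (2 ℕ.* n))) ≈ one ⊕ mono (suc (2 ℕ.* n))
  twist-odd n m = trans (twist-1-q^ (suc (2 ℕ.* n)) m) (trans (cong (λ s → one m - - s * mono (suc (2 ℕ.* n)) m) (sgnℕ-2* n)) (lemma (one m) _))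
    where
    lemma : ∀ a b → a - - (+ 1) * b ≡ a + b
    lemma = solve-∀

  twist-even : ∀ n → twist (1-q^ (2 ℕ.* n)) ≈ 1-q^ (2 ℕ.* n)
  twist-even n m = trans (twist-1-q^ (2 ℕ.* n) m) (cong (λ s → one m - s) (trans (cong (_* mono (2 ℕ.* n) m) (sgnℕ-2* n)) (ℤP.*-identityˡ _)))

  Efin-dbl : ∀ n → Efin (dbl (suc n)) ≈ Efin (dbl n) ⊛ 1-q^ (suc (2 ℕ.* n)) ⊛ 1-q^ (2 ℕ.* suc n)
  Efin-dbl n = ⊛-cong (⊛-cong (≈-refl {Efin (dbl n)}) (⊖-cong (≈-refl {one}) (mono-cong (cong suc (dbl≡ n)))))
    (⊖-cong (≈-refl {one}) (mono-cong (dbl≡ (suc n))))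

  -- Factors are added in pairs with odd and even exponent, since only the odd ones change under the
  -- twist; hence 2n factors of E(-q) and E(q) face n factors of E(q⁴).
  finite : ∀ n → twist (Efin (dbl n)) ⊛ Efin (dbl n) ⊛ dilate 4 (Efin n)
               ≈ dilate 2 (Efin (dbl n)) ⊛ (dilate 2 (Efin n) ⊛ dilate 2 (Efin n))
  finite zero = ≈-trans (⊛-cong (⊛-cong twist-one (≈-refl {one})) (dilate-mono 4 0))
    (≈-trans (one-one one) (≈-sym (≈-trans (⊛-cong (dilate-mono 2 0) (⊛-cong (dilate-mono 2 0) (dilate-mono 2 0)))
      (≈-trans (one⊛ (one ⊛ one)) (one⊛ one)))))
    where
    twist-one : twist one ≈ one
    twist-one m = trans (twist-mono 0 m) (ℤP.*-identityˡ (one m))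
  finite (suc n) = ≈-trans
    (⊛-cong (⊛-cong twisted (Efin-dbl n)) (≈-trans (dilate-Efin 4 n) (⊛-cong (≈-refl {G}) (⊖-cong (≈-refl {one}) bb))))
    (≈-trans (twist-step T F G a b)
      (≈-trans (⊛-cong (finite n) (≈-refl {(one ⊕ a) ⊛ (one ⊖ b) ⊛ ((one ⊖ a) ⊛ (one ⊖ b)) ⊛ (one ⊖ b ⊛ b)}))
        (≈-trans (twist-step′ H K a b) (≈-sym (⊛-cong doubled (⊛-cong (dilate-Efin 2 n) (dilate-Efin 2 n)))))))
    where
    T = twist (Efin (dbl n))
    F = Efin (dbl n)
    G = dilate 4 (Efin n)
    H = dilate 2 (Efin (dbl n))
    K = dilate 2 (Efin n)
    a = mono (suc (2 ℕ.* n))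
    b = mono (2 ℕ.* suc n)
    twisted : twist (Efin (dbl (suc n))) ≈ T ⊛ (one ⊕ a) ⊛ (one ⊖ b)
    twisted = ≈-trans (twist-cong (Efin-dbl n)) (≈-trans (twist-⊛ (F ⊛ 1-q^ (suc (2 ℕ.* n))) (1-q^ (2 ℕ.* suc n)))
      (⊛-cong (≈-trans (twist-⊛ F (1-q^ (suc (2 ℕ.* n)))) (⊛-cong (≈-refl {T}) (twist-odd n))) (twist-even (suc n))))
    ex₄ : ∀ n → 4 ℕ.* suc n ≡ 2 ℕ.* suc n ℕ.+ 2 ℕ.* suc n
    ex₄ = ℕR.solve-∀
    bb : mono (4 ℕ.* suc n) ≈ b ⊛ b
    bb = ≈-trans (mono-cong (ex₄ n)) (≈-sym (mono-⊛ (2 ℕ.* suc n) (2 ℕ.* suc n)))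
    double : ∀ k → mono (2 ℕ.* k) ≈ mono k ⊛ mono k
    double k = ≈-trans (mono-cong (cong (k ℕ.+_) (ℕP.+-identityʳ k))) (≈-sym (mono-⊛ k k))
    doubled : dilate 2 (Efin (dbl (suc n))) ≈ H ⊛ (one ⊖ a ⊛ a) ⊛ (one ⊖ b ⊛ b)
    doubled = ≈-trans (dilate-cong 2 (Efin-dbl n)) (≈-trans (dilate-⊛ 2 (F ⊛ 1-q^ (suc (2 ℕ.* n))) (1-q^ (2 ℕ.* suc n)))
      (⊛-cong (≈-trans (dilate-⊛ 2 F (1-q^ (suc (2 ℕ.* n)))) (⊛-cong (≈-refl {H})
          (≈-trans (dilate-1-q^ 2 (suc (2 ℕ.* n))) (⊖-cong (≈-refl {one}) (double (suc (2 ℕ.* n)))))))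
        (≈-trans (dilate-1-q^ 2 (2 ℕ.* suc n)) (⊖-cong (≈-refl {one}) (double (2 ℕ.* suc n))))))

triple : D ⊛ E ⊛ dilate 4 E ≈ dilate 2 E ⊛ (dilate 2 E ⊛ dilate 2 E)
triple N = begin
  (D ⊛ E ⊛ dilate 4 E) N
    ≡⟨ ⊛-cong[] {N} {D ⊛ E} {twist (Efin (dbl N)) ⊛ Efin (dbl N)} {dilate 4 E} {dilate 4 (Efin N)}
         (⊛-cong[] {N} {D} {twist (Efin (dbl N))} {E} {Efin (dbl N)} (λ m m≤N → cong (sgnℕ m *_) (E≈ m m≤N)) E≈)
         (dilate-cong[] 4 (E≈[] N)) N ℕP.≤-refl ⟩
  (twist (Efin (dbl N)) ⊛ Efin (dbl N) ⊛ dilate 4 (Efin N)) N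
    ≡⟨ TripleProduct.finite N N ⟩
  (dilate 2 (Efin (dbl N)) ⊛ (dilate 2 (Efin N) ⊛ dilate 2 (Efin N))) N
    ≡⟨ ⊛-cong[] {N} {dilate 2 E} {dilate 2 (Efin (dbl N))} {dilate 2 E ⊛ dilate 2 E} {dilate 2 (Efin N) ⊛ dilate 2 (Efin N)}
         (dilate-cong[] 2 E≈) (⊛-cong[] {N} {dilate 2 E} {dilate 2 (Efin N)} {dilate 2 E} {dilate 2 (Efin N)}
           (dilate-cong[] 2 (E≈[] N)) (dilate-cong[] 2 (E≈[] N))) N ℕP.≤-refl ⟨
  (dilate 2 E ⊛ (dilate 2 E ⊛ dilate 2 E)) N ∎
  where
  open ≡-Reasoning
  E≈ : E ≈[ N ] Efin (dbl N)
  E≈ m m≤N = E≈[] (dbl N) m (ℕP.≤-trans m≤N (n≤dbl N))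

-- The concrete theta series and their products.

private
  -2ℤ -3ℤ -4ℤ : ℤ
  -2ℤ = - + 2
  -3ℤ = - + 3
  -4ℤ = - + 4

-- In Ramanujan's notation κ = f(q,q⁵). The remaining four are the two halves of the pentagonal
-- series: E(q) = ε₀ - q ε₁ and E(-q) = δ₀ + q δ₁.
φ φ⁻ ψ⁻ κ δ₀ δ₁ ε₀ ε₁ : FPS
φ  = theta₁ false 1 0
φ⁻ = theta₁ true 1 0
ψ⁻ = theta₁ true 1 2
κ  = theta₁ false 1 4
δ₀ = theta₁ true 5 2
δ₁ = theta₁ true 1 10
ε₀ = theta₁ false 5 2
ε₁ = theta₁ false 1 10

lt-φ : LT (+ 1) (+ 0) false φ
lt-φ = lt-theta₁ false 1 0

lt-φ⁻ : LT (+ 1) (+ 0) true φ⁻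
lt-φ⁻ = lt-theta₁ true 1 0

lt-ψ : LT (+ 2) (+ 1) false ψ
lt-ψ = lt-theta₁ false 1 1

lt-ψ⁻ : LT (+ 2) (+ 1) true ψ⁻
lt-ψ⁻ = lt-theta₁ true 1 1

lt-κ : LT (+ 3) (+ 2) false κ
lt-κ = lt-theta₁ false 1 2

lt-δ₀ : LT (+ 6) (+ 1) true δ₀
lt-δ₀ = lt-theta₁ true 5 1

lt-δ₁ : LT (+ 6) (+ 5) true δ₁
lt-δ₁ = lt-theta₁ true 1 5

lt-ε₀ : LT (+ 6) (+ 1) false ε₀
lt-ε₀ = lt-theta₁ false 5 1

lt-ε₁ : LT (+ 6) (+ 5) false ε₁
lt-ε₁ = lt-theta₁ false 1 5

twist-φ⁻ : twist φ⁻ ≈ φ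
twist-φ⁻ = lt-unique (lt-twist lt-φ⁻) lt-φ

twist-ψ : twist ψ ≈ ψ⁻
twist-ψ = lt-unique (lt-twist lt-ψ) lt-ψ⁻

twist-ψ⁻ : twist ψ⁻ ≈ ψ
twist-ψ⁻ = lt-unique (lt-twist lt-ψ⁻) lt-ψ

2pentagonal : ∀ k → + 2 * + ex 1 1 k ≡ + 3 * (k * k) + k
2pentagonal k = trans (cong (+ 2 *_) (cong₂ _+_ (ℤP.pos-* 1 (sq k)) (ℤP.pos-* 1 (tri k))))
  (trans (l (+ sq k) (+ tri k)) (trans (cong₂ (λ a b → + 2 * a + b) (+sq k) (+2tri k)) (l′ k)))
  where
  l : ∀ s t → + 2 * (+ 1 * s + + 1 * t) ≡ + 2 * s + + 2 * t
  l = solve-∀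
  l′ : ∀ k → + 2 * (k * k) + (k * k + k) ≡ + 3 * (k * k) + k
  l′ = solve-∀

-- The exponent k(3k+1)/2 has coefficients in ½ℤ and does not fit `LT`, but its double does. E(q)
-- and E(q⁷) therefore enter the lattice identities through ε₀ and ε₁, whereas the even dilates
-- enter directly.
lt-E₂ : LT (+ 3) (+ 1) true (dilate 2 E)
lt-E₂ = lt (gf-cong (λ k → trans (2pentagonal k) (cong (λ z → + 3 * (k * k) + z) (sym (ℤP.*-identityˡ k)))) (λ _ → refl)
  (gf-dilate 2 (gf-resp (≈-sym E≈theta₁) (gf₁ true 1 1))))

lt-E : ∀ m .{{_ : NonZero m}} .{{_ : NonZero (m ℕ.* 2)}} → LT (+ m * + 3) (+ m * + 1) true (dilate (m ℕ.* 2) E)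
lt-E m = lt-resp (dilate-dilate m 2 E) (lt-dilate m lt-E₂)

E-split : E ≈ ε₀ ⊕ negF (mono 1 ⊛ ε₁)
E-split = gf-unique E-parts (gf-⊎ (LT.gf lt-ε₀) odd-part)
  where
  refl≅ : ℤ ≅ ℤ
  refl≅ = record { to = r ; from = r ; to∘from = rr ; from∘to = rr }
    where
    r : ℤ → ℤ
    r x = -1ℤ - x
    rr : ∀ x → r (r x) ≡ x
    rr = l
      where
      l : ∀ x → -1ℤ - (-1ℤ - x) ≡ x
      l = solve-∀
  -- Odd indices k = 2x + 1 give the exponent 6x² + 7x + 2, which the reflection x ↦ -1 - x turns
  -- into 1 + 6x² + 5x, the exponent of q ε₁.
  odd-part : GF (λ x → + 6 * (x * x) + + 7 * x + + 2) (λ x → -1ℤ) (negF (mono 1 ⊛ ε₁))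
  odd-part = gf-map refl≅ l (λ _ → refl) (gf-neg (gf-mono⊛ 1 (LT.gf lt-ε₁)))
    where
    l : ∀ x → + 1 + (+ 6 * ((-1ℤ - x) * (-1ℤ - x)) + + 5 * (-1ℤ - x)) ≡ + 6 * (x * x) + + 7 * x + + 2
    l = solve-∀
  even-e : ∀ x → + ex 1 1 (+ 2 * x) ≡ + 6 * (x * x) + + 1 * x
  even-e x = ℤP.*-cancelˡ-≡ (+ 2) _ _ (trans (2pentagonal (+ 2 * x)) (l x))
    where
    l : ∀ x → + 3 * (+ 2 * x * (+ 2 * x)) + + 2 * x ≡ + 2 * (+ 6 * (x * x) + + 1 * x)
    l = solve-∀
  odd-e : ∀ x → + ex 1 1 (+ 2 * x + + 1) ≡ + 6 * (x * x) + + 7 * x + + 2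
  odd-e x = ℤP.*-cancelˡ-≡ (+ 2) _ _ (trans (2pentagonal (+ 2 * x + + 1)) (l x))
    where
    l : ∀ x → + 3 * ((+ 2 * x + + 1) * (+ 2 * x + + 1)) + (+ 2 * x + + 1) ≡ + 2 * (+ 6 * (x * x) + + 7 * x + + 2)
    l = solve-∀
  E-parts : GF [ (λ k → + 6 * (k * k) + + 1 * k) , (λ x → + 6 * (x * x) + + 7 * x + + 2) ] [ χ false , (λ x → -1ℤ) ] E
  E-parts = gf-map halves₁≅ [ even-e , odd-e ] [ sgn-* (+ 2) , (λ x → trans (sgn-+ (+ 2 * x) (+ 1)) (cong (_* sgn (+ 1)) (sgn-* (+ 2) x))) ]
    (gf-resp (≈-sym E≈theta₁) (gf₁ true 1 1))

twist-neg : ∀ f → twist (negF f) ≈ negF (twist f)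
twist-neg f n = sym (ℤP.neg-distribʳ-* (sgnℕ n) (f n))

D-split : D ≈ δ₀ ⊕ (mono 1 ⊛ δ₁)
D-split = ≈-trans (twist-cong E-split) (≈-trans (twist-⊕ ε₀ (negF (mono 1 ⊛ ε₁)))
  (⊕-cong (lt-unique (lt-twist lt-ε₀) lt-δ₀) (≈-trans (twist-neg (mono 1 ⊛ ε₁)) λ n → trans (cong -_ (twist-⊛ (mono 1) ε₁ n)) (step n))))
  where
  step : negF (twist (mono 1) ⊛ twist ε₁) ≈ mono 1 ⊛ δ₁
  step = ≈-trans (λ n → cong -_ (⊛-cong {twist (mono 1)} {negF (mono 1)} (λ m → trans (twist-mono 1 m) (ℤP.-1*i≡-i (mono 1 m)))
                                        (lt-unique (lt-twist lt-ε₁) lt-δ₁) n))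
    (neg-neg (mono 1) δ₁)

-- The new first coordinate is the sum of the two old ones, so that splitting by its residue sorts
-- the pairs by their sum.
shear : Aff
shear = aff (+ 1) -1ℤ (+ 0) (+ 0) (+ 1) (+ 0)

flip : Aff
flip = aff (+ 0) (+ 1) (+ 0) (+ 1) (+ 0) (+ 0)

⊕-zeroʳ : ∀ {f g h} → f ≈ g ⊕ h → h ≈ 0F → f ≈ g
⊕-zeroʳ {g = g} p z n = trans (p n) (trans (cong (_+_ (g n)) (z n)) (ℤP.+-identityʳ (g n)))

-- The terms with odd index sum cancel in pairs (x , y) ↔ (y , x).
ψψ⁻ : ψ ⊛ ψ⁻ ≈ dilate 2 ψ⁻ ⊛ dilate 4 φ⁻
ψψ⁻ = ⊕-zeroʳ {g = dilate 2 ψ⁻ ⊛ dilate 4 φ⁻} {h = f₁}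
        (≈-trans (proj₂ (proj₂ (proj₂ (proj₂ S)))) (⊕-cong (pt-unique (proj₁ (proj₂ (proj₂ S))) P₀) (≈-refl {f₁})))
        (pt-zero (aff (+ 1) (+ 0) (+ 0) (+ 2) -1ℤ (+ 1)) refl refl refl (proj₁ (proj₂ (proj₂ (proj₂ S)))))
  where
  S  = pt-split₂ _ _ (pt-aff shear refl (lt-⊛ lt-ψ lt-ψ⁻))
  f₁ = proj₁ (proj₂ S)
  P₀ : PT (quad (+ 8) -[1+ 7 ] (+ 4) (+ 2) (+ 0) (+ 0)) (sg false true false) (dilate 2 ψ⁻ ⊛ dilate 4 φ⁻)
  P₀ = pt-aff (aff (+ 1) (+ 0) (+ 0) (+ 1) -1ℤ (+ 0)) refl (lt-⊛ (lt-dilate 2 lt-ψ⁻) (lt-dilate 4 lt-φ⁻))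

-- If x + y is even, then x = a - b and y = a + b turn 3x² + 3y² + y into (6a² + a) + (6b² + b). If
-- it is odd, then y = -(a + b + 1) gives 2 + (6a² + 5a) + (6b² + 5b) and one more sign.
φ₃E₂ : dilate 3 φ ⊛ dilate 2 E ≈ δ₀ ⊛ δ₀ ⊕ negF (mono 2 ⊛ (δ₁ ⊛ δ₁))
φ₃E₂ = pt-unique (pt-aff shear refl (lt-⊛ (lt-dilate 3 lt-φ) lt-E₂)) (pt-join₂ _ _
  (pt-aff (aff (+ 1) (+ 0) (+ 0) -1ℤ (+ 1) (+ 0)) refl (lt-⊛ lt-δ₀ lt-δ₀))
  (pt-aff (aff -1ℤ (+ 0) -1ℤ (+ 1) -1ℤ (+ 0)) refl (pt-neg (pt-mono 2 (lt-⊛ lt-δ₁ lt-δ₁)))))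

-- The same rotation as for `φ₃E₂`: with x = a + b and y = a - b the exponent 3x² + 2x + 3y² + y
-- becomes 3(2a² + a) + (6b² + b), so one coordinate carries ψ⁻(q³) in both parities.
κE₂ : κ ⊛ dilate 2 E ≈ δ₀ ⊛ dilate 3 ψ⁻ ⊕ mono 1 ⊛ (δ₁ ⊛ dilate 3 ψ⁻)
κE₂ = pt-unique (pt-aff shear refl (lt-⊛ lt-κ lt-E₂)) (pt-join₂ _ _
  (pt-aff (aff (+ 1) -1ℤ (+ 0) (+ 1) (+ 0) (+ 0)) refl (lt-⊛ lt-δ₀ (lt-dilate 3 lt-ψ⁻)))
  (pt-aff (aff -1ℤ (+ 1) -1ℤ -1ℤ (+ 0) -1ℤ) refl (pt-mono 1 (lt-⊛ lt-δ₁ (lt-dilate 3 lt-ψ⁻)))))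

-- A = (1,0,14) and B = (2,0,7); C and C′ are both (3,2,5), since 3 (3n² + 2nm + 5m²)
-- = (3n + m)² + 14 m² = 2 (n - 2m)² + 7 (n + m)², split by the residue of m or n + m modulo 3.

A B C C′ : FPS
A  = φ ⊛ dilate 14 φ
B  = dilate 2 φ ⊛ dilate 7 φ
C  = dilate 3 φ ⊛ dilate 42 φ ⊕ (mono 5 ⊛ (κ ⊛ dilate 14 κ) ⊕ mono 5 ⊛ (κ ⊛ dilate 14 κ))
C′ = dilate 6 φ ⊛ dilate 21 φ ⊕ (mono 3 ⊛ (dilate 2 κ ⊛ dilate 7 κ) ⊕ mono 3 ⊛ (dilate 2 κ ⊛ dilate 7 κ))

form : ℤ → ℤ → ℤ → Quad
form a b c = quad a b c (+ 0) (+ 0) (+ 0)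

plus : Sign
plus = sg false false false

pt-A : PT (form (+ 1) (+ 0) (+ 14)) plus A
pt-A = lt-⊛ lt-φ (lt-dilate 14 lt-φ)

pt-B : PT (form (+ 2) (+ 0) (+ 7)) plus B
pt-B = lt-⊛ (lt-dilate 2 lt-φ) (lt-dilate 7 lt-φ)

pt-C : PT (form (+ 3) (+ 2) (+ 5)) plus C
pt-C = pt-aff flip refl (pt-join₃ (form (+ 5) (+ 2) (+ 3)) plus
  (pt-aff (aff (+ 1) (+ 1) (+ 0) (+ 1) (+ 0) (+ 0)) refl (lt-⊛ (lt-dilate 3 lt-φ) (lt-dilate 42 lt-φ)))
  (pt-aff (aff (+ 1) (+ 1) (+ 0) (+ 1) (+ 0) (+ 0)) refl (pt-mono 5 (lt-⊛ lt-κ (lt-dilate 14 lt-κ))))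
  (pt-aff (aff -1ℤ -1ℤ -1ℤ -1ℤ (+ 0) -1ℤ) refl (pt-mono 5 (lt-⊛ lt-κ (lt-dilate 14 lt-κ)))))

pt-C′ : PT (form (+ 3) (+ 2) (+ 5)) plus C′
pt-C′ = pt-aff (aff (+ 1) (+ 1) (+ 0) (+ 0) (+ 1) (+ 0)) refl (pt-join₃ (form (+ 3) -4ℤ (+ 6)) plus
  (pt-aff (aff -1ℤ (+ 1) (+ 0) (+ 1) (+ 0) (+ 0)) refl (lt-⊛ (lt-dilate 6 lt-φ) (lt-dilate 21 lt-φ)))
  (pt-aff (aff (+ 1) -1ℤ (+ 0) (+ 1) (+ 0) (+ 0)) refl (pt-mono 3 (lt-⊛ (lt-dilate 2 lt-κ) (lt-dilate 7 lt-κ))))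
  (pt-aff (aff -1ℤ (+ 1) -1ℤ -1ℤ (+ 0) -1ℤ) refl (pt-mono 3 (lt-⊛ (lt-dilate 2 lt-κ) (lt-dilate 7 lt-κ)))))

-- Both shapes are needed: `C` uses the dilations 1 and 14 and can be combined with A, `C′` uses 2
-- and 7 and can be combined with B.
C≈C′ : C ≈ C′
C≈C′ = pt-unique pt-C pt-C′

-- E(q⁸) E(q⁷) and q² E(q) E(q⁵⁶): a sum over ℤ² is split modulo 3 along two different
-- directions; along the second one, the remaining class has a sign-reversing symmetry.

E₈E₇ : δ₀ ⊛ dilate 14 δ₀ ⊕ (mono 15 ⊛ (δ₁ ⊛ dilate 14 δ₁) ⊕ mono 5 ⊛ (dilate 3 ψ⁻ ⊛ dilate 42 ψ⁻))
     ≈ dilate 8 E ⊛ dilate 7 ε₀ ⊕ negF (mono 7 ⊛ (dilate 8 E ⊛ dilate 7 ε₁))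
E₈E₇ = ≈-trans (pt-unique P (pt-join₃ _ _
    (pt-aff (aff (+ 2) (+ 1) (+ 0) (+ 1) (+ 0) (+ 0)) refl (lt-⊛ (lt-E 4) (lt-dilate 7 lt-ε₀)))
    (pt-aff (aff -2ℤ -1ℤ -1ℤ (+ 1) (+ 0) (+ 0)) refl (pt-neg (pt-mono 7 (lt-⊛ (lt-E 4) (lt-dilate 7 lt-ε₁)))))
    (proj₂ Z)))
  (⊕-cong (≈-refl {dilate 8 E ⊛ dilate 7 ε₀}) (⊕-zeroʳ {g = negF (mono 7 ⊛ (dilate 8 E ⊛ dilate 7 ε₁))} {h = proj₁ Z} (λ _ → refl)
    (pt-zero (aff (+ 1) (+ 0) (+ 0) -4ℤ -1ℤ -3ℤ) refl refl refl (proj₂ Z))))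
  where
  P : PT _ _ _
  P = pt-aff (aff (+ 1) (+ 1) (+ 0) (+ 0) (+ 1) (+ 0)) refl
    (pt-join₃ (quad (+ 10) -4ℤ (+ 6) (+ 5) -1ℤ (+ 0)) (sg false true false)
      (pt-aff (aff (+ 1) -1ℤ (+ 0) (+ 1) (+ 0) (+ 0)) refl (lt-⊛ lt-δ₀ (lt-dilate 14 lt-δ₀)))
      (pt-aff (aff (+ 1) -1ℤ (+ 0) (+ 1) (+ 0) (+ 0)) refl (pt-mono 15 (lt-⊛ lt-δ₁ (lt-dilate 14 lt-δ₁))))
      (pt-aff (aff -1ℤ (+ 1) -1ℤ -1ℤ (+ 0) -1ℤ) refl (pt-mono 5 (lt-⊛ (lt-dilate 3 lt-ψ⁻) (lt-dilate 42 lt-ψ⁻)))))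
  Z = pt-third _ _ P

E₁E₅₆ : mono 7 ⊛ (dilate 2 δ₀ ⊛ dilate 7 δ₁) ⊕ (mono 2 ⊛ (dilate 2 δ₁ ⊛ dilate 7 δ₀) ⊕ negF (mono 3 ⊛ (dilate 6 ψ⁻ ⊛ dilate 21 ψ⁻)))
      ≈ mono 2 ⊛ (ε₀ ⊛ dilate 56 E) ⊕ negF (mono 3 ⊛ (ε₁ ⊛ dilate 56 E))
E₁E₅₆ = ≈-trans (pt-unique P (pt-join₃ _ _
    (pt-aff (aff -1ℤ (+ 1) (+ 0) (+ 1) (+ 0) (+ 0)) refl (pt-mono 2 (lt-⊛ lt-ε₀ (lt-E 28))))
    (proj₂ Z)
    (pt-aff (aff -1ℤ (+ 1) -1ℤ -1ℤ (+ 0) -1ℤ) refl (pt-neg (pt-mono 3 (lt-⊛ lt-ε₁ (lt-E 28)))))))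
  (⊕-cong (≈-refl {mono 2 ⊛ (ε₀ ⊛ dilate 56 E)})
    (λ n → trans (cong (_+ negF (mono 3 ⊛ (ε₁ ⊛ dilate 56 E)) n)
      (pt-zero (aff -1ℤ (+ 0) -1ℤ -2ℤ (+ 1) -1ℤ) refl refl refl (proj₂ Z) n)) (ℤP.+-identityˡ _)))
  where
  P : PT _ _ _
  P = pt-aff (aff (+ 2) (+ 1) (+ 1) (+ 1) (+ 0) (+ 0)) refl
    (pt-join₃ (quad (+ 6) (- + 28) (+ 42) (- + 11) (+ 35) (+ 7)) (sg false true false)
      (pt-aff (aff (+ 1) (+ 0) (+ 0) -1ℤ (+ 1) (+ 0)) refl (pt-mono 7 (lt-⊛ (lt-dilate 2 lt-δ₀) (lt-dilate 7 lt-δ₁))))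
      (pt-aff (aff (+ 1) (+ 0) (+ 0) -1ℤ (+ 1) (+ 0)) refl (pt-mono 2 (lt-⊛ (lt-dilate 2 lt-δ₁) (lt-dilate 7 lt-δ₀))))
      (pt-aff (aff -1ℤ (+ 0) -1ℤ (+ 1) -1ℤ (+ 0)) refl (pt-neg (pt-mono 3 (lt-⊛ (lt-dilate 6 lt-ψ⁻) (lt-dilate 21 lt-ψ⁻))))))
  Z = pt-second _ _ P

-- Dissection of A, B, C and Ψ modulo 2 and 4.

ev-A : ev A ≈ B
ev-A = pt-unique (pt-ev {Q₀ = form (+ 2) (+ 0) (+ 7)} {Q₁ = quad (+ 2) (+ 0) (+ 7) (+ 2) (+ 0) (+ 0)} pt-A refl refl) pt-B

pt-odA : PT (quad (+ 2) (+ 0) (+ 7) (+ 2) (+ 0) (+ 0)) plus (od A)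
pt-odA = pt-od {Q₀ = form (+ 2) (+ 0) (+ 7)} pt-A refl refl

pt-evodA : PT (quad (+ 1) (+ 0) (+ 14) (+ 1) (+ 0) (+ 0)) plus (ev (od A))
pt-evodA = pt-aff flip refl (pt-ev {Q₀ = quad (+ 14) (+ 0) (+ 1) (+ 0) (+ 1) (+ 0)} {Q₁ = quad (+ 14) (+ 0) (+ 1) (+ 14) (+ 1) (+ 3)}
  (pt-aff flip refl pt-odA) refl refl)

ev-B : ev B ≈ A
ev-B = pt-unique (pt-aff flip refl (pt-ev {Q₀ = form (+ 14) (+ 0) (+ 1)} {Q₁ = quad (+ 14) (+ 0) (+ 1) (+ 14) (+ 0) (+ 3)}
  (pt-aff flip refl pt-B) refl refl)) pt-A

pt-odB : PT (quad (+ 14) (+ 0) (+ 1) (+ 14) (+ 0) (+ 3)) plus (od B)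
pt-odB = pt-od {Q₀ = form (+ 14) (+ 0) (+ 1)} (pt-aff flip refl pt-B) refl refl

pt-ododB : PT (quad (+ 7) (+ 0) (+ 2) (+ 7) (+ 0) (+ 1)) plus (od (od B))
pt-ododB = pt-aff (aff (+ 0) (+ 1) -1ℤ (+ 1) (+ 0) (+ 0)) refl
  (pt-od {Q₀ = quad (+ 2) (+ 0) (+ 7) (+ 2) (+ 7) (+ 2)} {Q₁ = quad (+ 2) (+ 0) (+ 7) (+ 4) (+ 7) (+ 3)}
    (pt-aff (aff (+ 0) (+ 1) (+ 0) (+ 1) (+ 0) (+ 1)) refl pt-odB) refl refl)

private
  C₀ C₁ : Quad
  C₀ = form (+ 6) -4ℤ (+ 3)
  C₁ = quad (+ 6) -4ℤ (+ 3) (+ 6) -2ℤ (+ 1)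

  sheared-C : PT (form (+ 3) -4ℤ (+ 6)) plus C
  sheared-C = pt-aff shear refl pt-C

ev-C : ev C ≈ C
ev-C = pt-unique (pt-aff (aff (+ 0) (+ 1) (+ 0) (+ 1) (+ 1) (+ 0)) refl (pt-ev {Q₀ = C₀} {Q₁ = C₁} sheared-C refl refl)) pt-C

private
  S₀ S₁ : Quad
  S₀ = quad (+ 6) -4ℤ (+ 3) (+ 4) (+ 1) (+ 1)
  S₁ = quad (+ 6) -4ℤ (+ 3) (+ 10) -1ℤ (+ 4)

  pt-odC : PT (quad (+ 3) -4ℤ (+ 6) (+ 4) (+ 2) (+ 2)) plus (od C)
  pt-odC = pt-aff (aff (+ 0) (+ 1) (+ 0) (+ 1) (+ 0) (+ 1)) refl (pt-od {Q₀ = C₀} {Q₁ = C₁} sheared-C refl refl)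

pt-evodC : PT (quad (+ 5) (+ 2) (+ 3) (+ 5) (+ 1) (+ 1)) plus (ev (od C))
pt-evodC = pt-aff (aff (+ 1) (+ 0) (+ 0) (+ 1) (+ 1) (+ 0)) refl (pt-ev {Q₀ = S₀} {Q₁ = S₁} pt-odC refl refl)

pt-ododC : PT (quad (+ 3) (+ 4) (+ 6) (+ 3) (+ 2) (+ 0)) plus (od (od C))
pt-ododC = pt-aff (aff (+ 0) (+ 1) -1ℤ -1ℤ (+ 0) -1ℤ) refl (pt-od {Q₀ = S₀} {Q₁ = S₁} pt-odC refl refl)

-- x² + x + 14 y² is always even, while the exponents in `pt-evodC` are always odd, because 5x² + 5x
-- and 3y² + y are even. In the class 3 it is B that has odd and C that has even exponents. So the
-- twist exchanges sum and difference in these classes.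
twist-evodA : twist (ev (od A)) ≈ ev (od A)
twist-evodA = pt-unique (pt-twist (+ 0) pt-evodA) pt-evodA

twist-evodC : twist (ev (od C)) ≈ negF (ev (od C))
twist-evodC = pt-unique (pt-twist (+ 1) pt-evodC) (pt-neg pt-evodC)

twist-ododB : twist (od (od B)) ≈ negF (od (od B))
twist-ododB = pt-unique (pt-twist (+ 0) pt-ododB) (pt-neg pt-ododB)

twist-ododC : twist (od (od C)) ≈ od (od C)
twist-ododC = pt-unique (pt-twist (+ 2) pt-ododC) pt-ododC

Ψ : FPS
Ψ = ψ ⊛ dilate 7 ψ⁻

private
  Ψ₀ Ψ₁ Ψ₁₀ Ψ₁₁ : Quad
  Ψ₀  = quad (+ 4) -4ℤ (+ 8) (+ 1) (+ 3) (+ 0)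
  Ψ₁  = quad (+ 4) -4ℤ (+ 8) (+ 5) (+ 1) (+ 1)
  Ψ₁₀ = quad (+ 8) (- + 12) (+ 8) (+ 13) (- + 8) (+ 5)
  Ψ₁₁ = quad (+ 8) (- + 12) (+ 8) (+ 21) (- + 14) (+ 13)

  pt-Ψ : PT (quad (+ 2) -4ℤ (+ 16) (+ 1) (+ 6) (+ 0)) (sg false true false) Ψ
  pt-Ψ = pt-aff shear refl (lt-⊛ lt-ψ (lt-dilate 7 lt-ψ⁻))

-- For the indices x, y of the two factors of `Ψ` the exponent satisfies 8 N + 8 = s² + 7 t² with s
-- = 4x + 1 and t = 4y + 1. N = 2M gives 16 M + 8 and N = 4M + 1 gives twice that, so an element of
-- norm 2 relates the two parts. The substitution is multiplication by (1 + √-7)/2, sending s, t to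
-- (s - 7t)/2, (s + t)/2. In the coordinates of `Ψ₀` the signs become (-1)^y and (-1)^x, and M has
-- the parity of x + y; hence the twist.
twist-evodΨ : twist (ev (od Ψ)) ≈ ev Ψ
twist-evodΨ = pt-unique
  (pt-aff (aff (+ 1) -1ℤ -1ℤ (+ 1) (+ 0) (+ 0)) refl (pt-twist (- + 6)
    (pt-ev {Q₀ = Ψ₁₀} {Q₁ = Ψ₁₁} (pt-aff (aff (+ 1) -1ℤ (+ 1) (+ 0) (+ 1) (+ 0)) refl
      (pt-od {Q₀ = Ψ₀} {Q₁ = Ψ₁} pt-Ψ refl refl)) refl refl)))
  (pt-ev {Q₀ = Ψ₀} {Q₁ = Ψ₁} pt-Ψ refl refl)

-- The series (a,b,c) of the statement

∈-symRange : ∀ k B → ∣ k ∣ ℕ.≤ B → k ∈ symRange B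
∈-symRange k B p = subst (_∈ symRange B) (eq k p) (∈-map⁺ (λ i → + i - + B) (∈-upTo⁺ (s≤s bound)))
  where
  sum-nonneg : ∀ k → ∣ k ∣ ℕ.≤ B → k + + B ≡ + ∣ k + + B ∣
  sum-nonneg (+ n)    _ = refl
  sum-nonneg -[1+ n ] p = trans (ℤP.⊖-≥ p) (cong (λ z → + ∣ z ∣) (sym (ℤP.⊖-≥ p)))
  eq : ∀ k → ∣ k ∣ ℕ.≤ B → + ∣ k + + B ∣ - + B ≡ k
  eq k p = trans (cong (λ z → z - + B) (sym (sum-nonneg k p))) (l k (+ B))
    where
    l : ∀ k b → k + b - b ≡ k
    l = solve-∀
  bound : ∣ k + + B ∣ ℕ.≤ 2 ℕ.* B
  bound = ℕP.≤-trans (ℤP.∣i+j∣≤∣i∣+∣j∣ k (+ B)) (ℕP.≤-trans (ℕP.+-monoˡ-≤ B p) (ℕP.≤-reflexive (cong (B ℕ.+_) (sym (ℕP.+-identityʳ B)))))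

symRange-unique : ∀ B → Unique (symRange B)
symRange-unique B = UP.map⁺ inj (UP.upTo⁺ (suc (2 ℕ.* B)))
  where
  l : ∀ k b → k - b + b ≡ k
  l = solve-∀
  inj : ∀ {i j} → + i - + B ≡ + j - + B → i ≡ j
  inj {i} {j} p = ℤP.+-injective (trans (sym (l (+ i) (+ B))) (trans (cong (_+ + B) p) (l (+ j) (+ B))))

concatMap-pairs : {I J : Set} (xs : List I) (ys : List J) → concatMap (λ x → map (λ y → x , y) ys) xs ≡ cartesianProduct xs ys
concatMap-pairs []       ys = refl
concatMap-pairs (x ∷ xs) ys = cong (map (x ,_) ys ++_) (concatMap-pairs xs ys)

length-sumOver : {I : Set} {w : I → ℤ} → (∀ i → w i ≡ + 1) → ∀ xs → + length xs ≡ sumOver w xs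
length-sumOver p []       = refl
length-sumOver p (x ∷ xs) = cong₂ _+_ (sym (p x)) (length-sumOver p xs)

module _ (a b c : ℤ) (r : ℤ → ℤ → ℕ) (pos : ∀ n m → qform a b c n m ≡ + (sq n ℕ.+ sq m ℕ.+ r n m))
         .{{_ : NonZero (4 ℕ.* (∣ a ∣ ℕ.+ ∣ c ∣))}} where

  private
    box : ℕ → List (ℤ × ℤ)
    box N = concatMap (λ n → map (λ m → n , m) (symRange (4 ℕ.* (∣ a ∣ ℕ.+ ∣ c ∣) ℕ.* N))) (symRange (4 ℕ.* (∣ a ∣ ℕ.+ ∣ c ∣) ℕ.* N))
    qf : ℤ × ℤ → ℤ
    qf (n , m) = qform a b c n m
    qf? : ∀ N p → _
    qf? N p = qf p ℤ.≟ + N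

    square : ∀ n → n ℕ.≤ n ℕ.* n
    square zero    = z≤n
    square (suc n) = ℕP.m≤m+n (suc n) (n ℕ.* suc n)

    ∈-box : ∀ N n m → qf (n , m) ≡ + N → (n , m) ∈ box N
    ∈-box N n m p = subst ((n , m) ∈_) (sym (concatMap-pairs (symRange B₀) (symRange B₀)))
      (∈-cartesianProduct⁺ (∈-symRange n B₀ (ℕP.≤-trans (square ∣ n ∣) (ℕP.≤-trans (ℕP.m≤m+n (sq n) (sq m)) le)))
                           (∈-symRange m B₀ (ℕP.≤-trans (square ∣ m ∣) (ℕP.≤-trans (ℕP.m≤n+m (sq m) (sq n)) le))))
      where
      B₀ = 4 ℕ.* (∣ a ∣ ℕ.+ ∣ c ∣) ℕ.* N
      le : sq n ℕ.+ sq m ℕ.≤ B₀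
      le = ℕP.≤-trans (ℕP.m≤m+n (sq n ℕ.+ sq m) (r n m)) (ℕP.≤-trans (ℕP.≤-reflexive (ℤP.+-injective (trans (sym (pos n m)) p)))
             (ℕP.m≤n*m N (4 ℕ.* (∣ a ∣ ℕ.+ ∣ c ∣))))

    box-unique : ∀ N → Unique (box N)
    box-unique N = subst Unique (sym (concatMap-pairs (symRange B₀) (symRange B₀))) (UP.cartesianProduct⁺ (symRange-unique B₀) (symRange-unique B₀))
      where B₀ = 4 ℕ.* (∣ a ∣ ℕ.+ ∣ c ∣) ℕ.* N

    eval : ∀ v → qf v ≡ ⟦ form a b c ⟧ v
    eval (n , m) = l a b c n m
      where
      l : ∀ a b c n m → a * n * n + b * n * m + c * m * m ≡ a * (n * n) + b * (n * m) + c * (m * m) + + 0 * n + + 0 * m + + 0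
      l = solve-∀

  -- Since the form is n² + m² + r with r ≥ 0, a solution for N has |n|, |m| ≤ N. The radius of the
  -- box is a positive multiple of N, so no solution is missed.
  pt-theta : PT (form a b c) plus (theta a b c)
  pt-theta = pt (gf-cong eval (λ _ → refl) gfθ)
    where
    gfθ : GF qf (wt plus) (theta a b c)
    gfθ = record
      { nonneg   = λ (n , m) → trans (pos n m) (cong (λ z → + ∣ z ∣) (sym (pos n m)))
      ; fib      = λ N → filter (qf? N) (box N)
      ; unique   = λ N → UP.filter⁺ (qf? N) (box-unique N)
      ; sound    = λ {N} v∈ → proj₂ (∈-filter⁻ (qf? N) {xs = box N} v∈)
      ; complete = λ {N} (n , m) p → ∈-filter⁺ (qf? N) (∈-box N n m p) p
      ; value    = λ N → length-sumOver (λ _ → refl) (filter (qf? N) (box N)) }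

private
  from-sq : ∀ a b c n m x → + 1 * (n * n) + + 1 * (m * m) + x ≡ qform a b c n m → + (sq n) + + (sq m) + x ≡ qform a b c n m
  from-sq a b c n m x p = trans (cong₂ (λ s t → s + t + x) (trans (+sq n) (sym (ℤP.*-identityˡ (n * n)))) (trans (+sq m) (sym (ℤP.*-identityˡ (m * m))))) p

pt-1-0-56 : PT (form (+ 1) (+ 0) (+ 56)) plus (theta (+ 1) (+ 0) (+ 56))
pt-1-0-56 = pt-theta (+ 1) (+ 0) (+ 56) (λ n m → 55 ℕ.* sq m) λ n m → sym (from-sq (+ 1) (+ 0) (+ 56) n m _
  (trans (cong (λ z → + 1 * (n * n) + + 1 * (m * m) + z) (trans (ℤP.pos-* 55 (sq m)) (cong (+ 55 *_) (+sq m)))) (l n m)))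
  where
  l : ∀ n m → + 1 * (n * n) + + 1 * (m * m) + + 55 * (m * m) ≡ + 1 * n * n + + 0 * n * m + + 56 * m * m
  l = solve-∀

pt-7-0-8 : PT (form (+ 7) (+ 0) (+ 8)) plus (theta (+ 7) (+ 0) (+ 8))
pt-7-0-8 = pt-theta (+ 7) (+ 0) (+ 8) (λ n m → 6 ℕ.* sq n ℕ.+ 7 ℕ.* sq m) λ n m → sym (from-sq (+ 7) (+ 0) (+ 8) n m _
  (trans (cong (λ z → + 1 * (n * n) + + 1 * (m * m) + z) (cong₂ _+_ (trans (ℤP.pos-* 6 (sq n)) (cong (+ 6 *_) (+sq n))) (trans (ℤP.pos-* 7 (sq m)) (cong (+ 7 *_) (+sq m))))) (l n m)))
  where
  l : ∀ n m → + 1 * (n * n) + + 1 * (m * m) + (+ 6 * (n * n) + + 7 * (m * m)) ≡ + 7 * n * n + + 0 * n * m + + 8 * m * m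
  l = solve-∀

pt-5-4-12 : PT (form (+ 5) (+ 4) (+ 12)) plus (theta (+ 5) (+ 4) (+ 12))
pt-5-4-12 = pt-theta (+ 5) (+ 4) (+ 12) (λ n m → sq (+ 2 * n + m) ℕ.+ 10 ℕ.* sq m) λ n m → sym (from-sq (+ 5) (+ 4) (+ 12) n m _
  (trans (cong (λ z → + 1 * (n * n) + + 1 * (m * m) + z) (cong₂ _+_ (+sq (+ 2 * n + m)) (trans (ℤP.pos-* 10 (sq m)) (cong (+ 10 *_) (+sq m))))) (l n m)))
  where
  l : ∀ n m → + 1 * (n * n) + + 1 * (m * m) + ((+ 2 * n + m) * (+ 2 * n + m) + + 10 * (m * m)) ≡ + 5 * n * n + + 4 * n * m + + 12 * m * m
  l = solve-∀

pt-3-2-19 : PT (form (+ 3) (+ 2) (+ 19)) plus (theta (+ 3) (+ 2) (+ 19))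
pt-3-2-19 = pt-theta (+ 3) (+ 2) (+ 19) (λ n m → sq (n + m) ℕ.+ (sq n ℕ.+ 17 ℕ.* sq m)) λ n m → sym (from-sq (+ 3) (+ 2) (+ 19) n m _
  (trans (cong (λ z → + 1 * (n * n) + + 1 * (m * m) + z) (cong₂ _+_ (+sq (n + m)) (cong₂ _+_ (+sq n) (trans (ℤP.pos-* 17 (sq m)) (cong (+ 17 *_) (+sq m)))))) (l n m)))
  where
  l : ∀ n m → + 1 * (n * n) + + 1 * (m * m) + ((n + m) * (n + m) + (n * n + + 17 * (m * m))) ≡ + 3 * n * n + + 2 * n * m + + 19 * m * m
  l = solve-∀

-- The residue of n² + 56 m² modulo 4 depends only on the parity of n: even n give 4 (n² + 14 m²),
-- odd n the class 1. The other three forms behave alike, those of the denominator with the class 3.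
θ-1-0-56 : theta (+ 1) (+ 0) (+ 56) ≈ dilate 4 A ⊕ mono 1 ⊛ dilate 4 (ev (od A))
θ-1-0-56 = pt-unique pt-1-0-56 (pt-join₂ _ _ (pt-dilate 4 pt-A) (pt-mono 1 (pt-dilate 4 pt-evodA)))

θ-5-4-12 : theta (+ 5) (+ 4) (+ 12) ≈ dilate 4 C ⊕ mono 1 ⊛ dilate 4 (ev (od C))
θ-5-4-12 = pt-unique pt-5-4-12 (pt-join₂ _ _ (pt-dilate 4 (pt-aff flip refl pt-C)) (pt-mono 1 (pt-dilate 4 pt-evodC)))

θ-7-0-8 : theta (+ 7) (+ 0) (+ 8) ≈ dilate 4 B ⊕ mono 3 ⊛ dilate 4 (od (od B))
θ-7-0-8 = pt-unique pt-7-0-8 (pt-join₂ _ _ (pt-dilate 4 (pt-aff flip refl pt-B)) (pt-mono 3 (pt-dilate 4 pt-ododB)))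

θ-3-2-19 : theta (+ 3) (+ 2) (+ 19) ≈ dilate 4 C ⊕ mono 3 ⊛ dilate 4 (od (od C))
-- The shear turns the form into 3x² + 8xy + 24y², whose residue modulo 4 depends on x alone.
θ-3-2-19 = pt-unique (pt-aff (aff (+ 1) (+ 1) (+ 0) (+ 0) (+ 1) (+ 0)) refl pt-3-2-19) (pt-join₂ _ _
  (pt-dilate 4 (pt-aff (aff (+ 1) (+ 1) (+ 0) (+ 0) -1ℤ (+ 0)) refl pt-C)) (pt-mono 3 (pt-dilate 4 pt-ododC)))

-- Product formulas for A + C and B - C.

private
  E₂ E₄ E₇ E₈ E₁₄ E₂₈ E₅₆ D₂ D₇ D₁₄ : FPS
  E₂  = dilate 2 E
  E₄  = dilate 4 E
  E₇  = dilate 7 E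
  E₈  = dilate 8 E
  E₁₄ = dilate 14 E
  E₂₈ = dilate 28 E
  E₅₆ = dilate 56 E
  D₂  = dilate 2 D
  D₇  = dilate 7 D
  D₁₄ = dilate 14 D

E-unit : ∀ k .{{_ : NonZero k}} → dilate k E 0 ≡ + 1
E-unit k = dilate-0 k E

D-unit : ∀ k .{{_ : NonZero k}} → dilate k D 0 ≡ + 1
D-unit k = dilate-0 k D

dilate-identity : ∀ k .{{_ : NonZero k}} {f g h l f′ g′ h′ l′} → f ⊛ g ≈ h ⊛ l → dilate k f ≈ f′ → dilate k g ≈ g′ → dilate k h ≈ h′ → dilate k l ≈ l′ →
      f′ ⊛ g′ ≈ h′ ⊛ l′
dilate-identity k {f} {g} {h} {l} p a b c d = ≈-trans (⊛-cong (≈-sym a) (≈-sym b)) (≈-trans (≈-sym (dilate-⊛ k f g))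
  (≈-trans (dilate-cong k p) (≈-trans (dilate-⊛ k h l) (⊛-cong c d))))

dilate-⊛-cong : ∀ k .{{_ : NonZero k}} {f g f′ g′} → dilate k f ≈ f′ → dilate k g ≈ g′ → dilate k (f ⊛ g) ≈ f′ ⊛ g′
dilate-⊛-cong k {f} {g} a b = ≈-trans (dilate-⊛ k f g) (⊛-cong a b)

DEE : ∀ k .{{_ : NonZero k}} .{{_ : NonZero (k ℕ.* 2)}} .{{_ : NonZero (k ℕ.* 4)}} →
      dilate k D ⊛ dilate k E ⊛ dilate (k ℕ.* 4) E ≈ dilate (k ℕ.* 2) E ⊛ (dilate (k ℕ.* 2) E ⊛ dilate (k ℕ.* 2) E)
DEE k = dilate-identity k {D ⊛ E} {dilate 4 E} {dilate 2 E} {dilate 2 E ⊛ dilate 2 E} triple (dilate-⊛ k D E) (dilate-dilate k 4 E) (dilate-dilate k 2 E)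
  (dilate-⊛-cong k {dilate 2 E} {dilate 2 E} (dilate-dilate k 2 E) (dilate-dilate k 2 E))

twist-E₂ : twist E₂ ≈ E₂
twist-E₂ = twist-dilate-even 1 E

ψ⁻D : ψ⁻ ⊛ D ≈ E₂ ⊛ E₂
ψ⁻D = ≈-trans (⊛-cong (≈-sym twist-ψ) (≈-refl {D})) (≈-trans (≈-sym (twist-⊛ ψ E)) (≈-trans (twist-cong gauss)
  (≈-trans (twist-⊛ E₂ E₂) (⊛-cong twist-E₂ twist-E₂))))

DE₄ : D ⊛ E₄ ≈ ψ ⊛ E₂
DE₄ = ⊛-cancelʳ E refl (DE₄-ψE₂ {D} {E} {E₂} {E₄} {ψ} triple gauss)

ψ⁻E₂ : ψ⁻ ⊛ E₂ ≈ E ⊛ E₄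
ψ⁻E₂ = ⊛-cancelʳ D refl (ψ⁻E₂-E₁E₄ {D} {E} {E₂} {E₄} {ψ⁻} triple ψ⁻D)

ED₂E₈ : E ⊛ D₂ ⊛ E₈ ≈ ψ⁻ ⊛ (E₄ ⊛ E₄)
ED₂E₈ = ⊛-cancelʳ E₂ (E-unit 2) (E₁D₂E₈-ψ⁻E₄² {D₂} {E} {E₂} {E₄} {E₈} {ψ⁻} (DEE 2) ψ⁻E₂)

-- `ψψ⁻` contains φ only as φ(-q⁴), so the product is first found in q⁴, then reduced by injectivity
-- of the dilation, and finally twisted from φ(-q) to φ(q).
φE₂ : φ ⊛ E₂ ≈ D ⊛ D
φE₂ = ≈-trans (⊛-cong (≈-sym twist-φ⁻) (≈-sym twist-E₂)) (≈-trans (≈-sym (twist-⊛ φ⁻ E₂)) (≈-trans (twist-cong φ⁻E₂) (twist-⊛ E E)))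
  where
  unit : (E₄ ⊛ E₄ ⊛ (E ⊛ D)) 0 ≡ + 1
  unit = ⊛-unit {E₄ ⊛ E₄} {E ⊛ D} (⊛-unit {E₄} {E₄} (E-unit 4) (E-unit 4)) (⊛-unit {E} {D} refl refl)
  φ⁻₄E₈ : dilate 4 φ⁻ ⊛ E₈ ≈ E₄ ⊛ E₄
  φ⁻₄E₈ = ⊛-cancelʳ (E₄ ⊛ E₄ ⊛ (E ⊛ D)) unit (φ⁻₄E₈-E₄² {D} {D₂} {E} {E₂} {E₄} {E₈} {ψ} {ψ⁻} {dilate 2 ψ⁻} {dilate 4 φ⁻}
    ψψ⁻ (dilate-identity 2 {ψ⁻} {D} {E₂} {E₂} ψ⁻D (≈-refl {dilate 2 ψ⁻}) (≈-refl {D₂}) (dilate-dilate 2 2 E) (dilate-dilate 2 2 E)) gauss ψ⁻D (DEE 2) triple)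
  φ⁻E₂ : φ⁻ ⊛ E₂ ≈ E ⊛ E
  φ⁻E₂ = dilate-injective 4 (≈-trans (dilate-⊛-cong 4 {φ⁻} {E₂} (≈-refl {dilate 4 φ⁻}) (dilate-dilate 4 2 E)) (≈-trans φ⁻₄E₈ (≈-sym (dilate-⊛ 4 E E))))

D̄ : FPS
D̄ = δ₀ ⊕ negF (mono 1 ⊛ δ₁)

φ₃E₂-DD̄ : dilate 3 φ ⊛ E₂ ≈ D ⊛ D̄
φ₃E₂-DD̄ = ≈-trans φ₃E₂ (DD̄ {D} {D̄} {δ₀} {δ₁} {mono 1} {mono 2} D-split (≈-refl {D̄}) (mono-⊛ 1 1))

κE₂-Dψ⁻ : κ ⊛ E₂ ≈ D ⊛ dilate 3 ψ⁻
κE₂-Dψ⁻ = ≈-trans κE₂ (Dp {D} {δ₀} {δ₁} {mono 1} (dilate 3 ψ⁻) D-split)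

dilate-neg : ∀ k .{{_ : NonZero k}} f → dilate k (negF f) ≈ negF (dilate k f)
dilate-neg k f n with k ∣? n
... | yes _ = refl
... | no  _ = refl

module _ (k : ℕ) .{{_ : NonZero k}} where

  split-shift : ∀ f → dilate k (mono 1 ⊛ f) ≈ mono k ⊛ dilate k f
  split-shift f = dilate-⊛-cong k {mono 1} {f} (≈-trans (dilate-mono k 1) (mono-cong (ℕP.*-identityʳ k))) (≈-refl {dilate k f})

  D-splitₖ : dilate k D ≈ dilate k δ₀ ⊕ mono k ⊛ dilate k δ₁
  D-splitₖ = ≈-trans (dilate-cong k D-split) (≈-trans (dilate-⊕ k δ₀ (mono 1 ⊛ δ₁)) (⊕-cong (≈-refl {dilate k δ₀}) (split-shift δ₁)))

  D̄-splitₖ : dilate k D̄ ≈ dilate k δ₀ ⊕ negF (mono k ⊛ dilate k δ₁)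
  D̄-splitₖ = ≈-trans (dilate-⊕ k δ₀ (negF (mono 1 ⊛ δ₁))) (⊕-cong (≈-refl {dilate k δ₀})
    (≈-trans (dilate-neg k (mono 1 ⊛ δ₁)) λ n → cong -_ (split-shift δ₁ n)))

  E-splitₖ : dilate k E ≈ dilate k ε₀ ⊕ negF (mono k ⊛ dilate k ε₁)
  E-splitₖ = ≈-trans (dilate-cong k E-split) (≈-trans (dilate-⊕ k ε₀ (negF (mono 1 ⊛ ε₁))) (⊕-cong (≈-refl {dilate k ε₀})
    (≈-trans (dilate-neg k (mono 1 ⊛ ε₁)) λ n → cong -_ (split-shift ε₁ n))))

  φEₖ : .{{_ : NonZero (k ℕ.* 2)}} → dilate k φ ⊛ dilate (k ℕ.* 2) E ≈ dilate k D ⊛ dilate k D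
  φEₖ = dilate-identity k {φ} {E₂} {D} {D} φE₂ (≈-refl {dilate k φ}) (dilate-dilate k 2 E) (≈-refl {dilate k D}) (≈-refl {dilate k D})

  φ₃Eₖ : .{{_ : NonZero (k ℕ.* 2)}} .{{_ : NonZero (k ℕ.* 3)}} → dilate (k ℕ.* 3) φ ⊛ dilate (k ℕ.* 2) E ≈ dilate k D ⊛ dilate k D̄
  φ₃Eₖ = dilate-identity k {dilate 3 φ} {E₂} {D} {D̄} φ₃E₂-DD̄ (dilate-dilate k 3 φ) (dilate-dilate k 2 E) (≈-refl {dilate k D}) (≈-refl {dilate k D̄})

  κEₖ : .{{_ : NonZero (k ℕ.* 2)}} .{{_ : NonZero (k ℕ.* 3)}} → dilate k κ ⊛ dilate (k ℕ.* 2) E ≈ dilate k D ⊛ dilate (k ℕ.* 3) ψ⁻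
  κEₖ = dilate-identity k {κ} {E₂} {D} {dilate 3 ψ⁻} κE₂-Dψ⁻ (≈-refl {dilate k κ}) (dilate-dilate k 2 E) (≈-refl {dilate k D}) (dilate-dilate k 3 ψ⁻)

-- Taking out D D₁₄ leaves D D₁₄ + D̄ D̄₁₄ + 2 q⁵ ψ⁻(q³) ψ⁻(q⁴²), and `sum-EE` applies. The factor
-- `one` in front of C is the sign parameter of `combine`.
A+C-product : (A ⊕ one ⊛ C) ⊛ (E₂ ⊛ E₂₈) ≈ D ⊛ D₁₄ ⊛ (E₈ ⊛ E₇ ⊕ E₈ ⊛ E₇)
A+C-product = combine {φ} {dilate 14 φ} {dilate 3 φ} {dilate 42 φ} {κ} {dilate 14 κ} {E₂} {E₂₈} {D} {D̄} {D₁₄} {dilate 14 D̄} {dilate 3 ψ⁻} {dilate 42 ψ⁻}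
  {mono 5} {E₈ ⊛ E₇ ⊕ E₈ ⊛ E₇} one φE₂ (φEₖ 14) φ₃E₂-DD̄ (φ₃Eₖ 14) κE₂-Dψ⁻ (κEₖ 14)
  (≈-trans (⊕-cong (≈-refl {D ⊛ D₁₄}) (one⊛ _)) (sum-EE {D} {D̄} {D₁₄} {dilate 14 D̄} {δ₀} {δ₁} {dilate 14 δ₀} {dilate 14 δ₁} {mono 1} {mono 14} {mono 15}
    {mono 5} {dilate 3 ψ⁻ ⊛ dilate 42 ψ⁻} {E₈} {E₇} {dilate 7 ε₀} {dilate 7 ε₁} {mono 7}
    D-split (≈-refl {D̄}) (D-splitₖ 14) (D̄-splitₖ 14) (mono-⊛ 1 14) E₈E₇ (E-splitₖ 7)))

B-C-product : (B ⊕ negF one ⊛ C′) ⊛ (E₄ ⊛ E₁₄) ≈ D₂ ⊛ D₇ ⊛ (mono 2 ⊛ (E ⊛ E₅₆) ⊕ mono 2 ⊛ (E ⊛ E₅₆))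
B-C-product = combine {dilate 2 φ} {dilate 7 φ} {dilate 6 φ} {dilate 21 φ} {dilate 2 κ} {dilate 7 κ} {E₄} {E₁₄} {D₂} {dilate 2 D̄} {D₇} {dilate 7 D̄} {dilate 6 ψ⁻} {dilate 21 ψ⁻}
  {mono 3} {mono 2 ⊛ (E ⊛ E₅₆) ⊕ mono 2 ⊛ (E ⊛ E₅₆)} (negF one) (φEₖ 2) (φEₖ 7) (φ₃Eₖ 2) (φ₃Eₖ 7) (κEₖ 2) (κEₖ 7)
  (diff-EE {D₂} {dilate 2 D̄} {D₇} {dilate 7 D̄} {dilate 2 δ₀} {dilate 2 δ₁} {dilate 7 δ₀} {dilate 7 δ₁} {mono 2} {mono 7}
    {mono 3} {dilate 6 ψ⁻ ⊛ dilate 21 ψ⁻} {E} {E₅₆} {ε₀} {ε₁} {mono 1} {mono 3}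
    (D-splitₖ 2) (D̄-splitₖ 2) (D-splitₖ 7) (D̄-splitₖ 7) E₁E₅₆ E-split (mono-⊛ 2 1))

Ψ′ : FPS
Ψ′ = ψ⁻ ⊛ dilate 7 ψ

E-unit₂ : ∀ k l .{{_ : NonZero k}} .{{_ : NonZero l}} → (dilate k E ⊛ dilate l E) 0 ≡ + 1
E-unit₂ k l = ⊛-unit {dilate k E} {dilate l E} (E-unit k) (E-unit l)

A+C : (A ⊕ C) ⊛ (E₄ ⊛ E₅₆) ≈ (Ψ ⊕ Ψ) ⊛ (E₈ ⊛ E₂₈)
A+C = ⊛-cancelʳ (E₂ ⊛ E₂₈) (E-unit₂ 2 28) (A+C-clear {A ⊕ C} {D} {D₁₄} {E₂} {E₄} {E₇} {E₈} {E₂₈} {E₅₆} {ψ} {dilate 7 ψ⁻}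
  (≈-trans (⊛-cong (⊕-cong (≈-refl {A}) (≈-sym (one⊛ C))) (≈-refl {E₂ ⊛ E₂₈})) A+C-product) DE₄
  (dilate-identity 7 {E ⊛ D₂} {E₈} {ψ⁻} {E₄ ⊛ E₄} ED₂E₈ (dilate-⊛-cong 7 {E} {D₂} (≈-refl {E₇}) (dilate-dilate 7 2 D)) (dilate-dilate 7 8 E) (≈-refl {dilate 7 ψ⁻})
    (dilate-⊛-cong 7 {E₄} {E₄} (dilate-dilate 7 4 E) (dilate-dilate 7 4 E))))

B-C : (B ⊖ C) ⊛ (E₈ ⊛ E₂₈) ≈ (Ψ′ ⊕ Ψ′) ⊛ (mono 2 ⊛ (E₄ ⊛ E₅₆))
B-C = ⊛-cancelʳ (E₄ ⊛ E₁₄) (E-unit₂ 4 14) (B-C-clear {B ⊖ C} {D₂} {D₇} {E} {E₄} {E₈} {E₁₄} {E₂₈} {E₅₆} {mono 2} {ψ⁻} {dilate 7 ψ}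
  (≈-trans (⊛-cong (⊕-cong (≈-refl {B}) minus) (≈-refl {E₄ ⊛ E₁₄})) B-C-product) ED₂E₈
  (dilate-identity 7 {D} {E₄} {ψ} {E₂} DE₄ (≈-refl {D₇}) (dilate-dilate 7 4 E) (≈-refl {dilate 7 ψ}) (dilate-dilate 7 2 E)))
  where
  minus : negF C ≈ negF one ⊛ C′
  minus = ≈-sym (≈-trans (neg-⊛ one C′) λ n → cong -_ (trans (one⊛ C′ n) (sym (C≈C′ n))))

-- The four residue classes as multiples of s, and the quotient.

EE₂ : ∀ k l .{{_ : NonZero k}} .{{_ : NonZero l}} .{{_ : NonZero (2 ℕ.* k)}} .{{_ : NonZero (2 ℕ.* l)}} →
      dilate (2 ℕ.* k) E ⊛ dilate (2 ℕ.* l) E ≈ dilate 2 (dilate k E ⊛ dilate l E)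
EE₂ k l = ≈-sym (dilate-⊛-cong 2 {dilate k E} {dilate l E} (dilate-dilate 2 k E) (dilate-dilate 2 l E))

ev-cong : ∀ {f g} → f ≈ g → ev f ≈ ev g
ev-cong p n = p (2 ℕ.* n)

od-cong : ∀ {f g} → f ≈ g → od f ≈ od g
od-cong p n = p (suc (2 ℕ.* n))

module _ {f g a b : FPS} (p : f ⊛ dilate 2 a ≈ g ⊛ dilate 2 b) where

  ev-identity : ev f ⊛ a ≈ ev g ⊛ b
  ev-identity = ≈-trans (≈-sym (ev-⊛-dilate f a)) (≈-trans (ev-cong p) (ev-⊛-dilate g b))

  od-identity : od f ⊛ a ≈ od g ⊛ b
  od-identity = ≈-trans (≈-sym (od-⊛-dilate f a)) (≈-trans (od-cong p) (od-⊛-dilate g b))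

s : FPS
s = ev Ψ

private
  A+C₂ : (A ⊕ C) ⊛ dilate 2 (E₂ ⊛ E₂₈) ≈ (Ψ ⊕ Ψ) ⊛ dilate 2 (E₄ ⊛ E₁₄)
  A+C₂ = ≈-trans (⊛-cong (≈-refl {A ⊕ C}) (≈-sym (EE₂ 2 28))) (≈-trans A+C (⊛-cong (≈-refl {Ψ ⊕ Ψ}) (EE₂ 4 14)))

  EE₁ : E₂ ⊛ E₂₈ ≈ dilate 2 (E ⊛ E₁₄)
  EE₁ = ≈-sym (dilate-⊛-cong 2 {E} {E₁₄} (≈-refl {E₂}) (dilate-dilate 2 14 E))

  2q : mono 2 ⊛ (E₄ ⊛ E₅₆) ≈ dilate 2 (mono 1 ⊛ (E₂ ⊛ E₂₈))
  2q = ≈-sym (dilate-⊛-cong 2 {mono 1} {E₂ ⊛ E₂₈} (dilate-mono 2 1) (≈-sym (EE₂ 2 28)))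

  B-C₂ : (B ⊖ C) ⊛ dilate 2 (E₄ ⊛ E₁₄) ≈ (Ψ′ ⊕ Ψ′) ⊛ dilate 2 (mono 1 ⊛ (E₂ ⊛ E₂₈))
  B-C₂ = ≈-trans (⊛-cong (≈-refl {B ⊖ C}) (≈-sym (EE₂ 4 14))) (≈-trans B-C (⊛-cong (≈-refl {Ψ′ ⊕ Ψ′}) 2q))

twist-Ψ : twist Ψ ≈ Ψ′
twist-Ψ = ≈-trans (twist-⊛ ψ (dilate 7 ψ⁻)) (⊛-cong twist-ψ (≈-trans (twist-dilate-odd 3 ψ⁻) (dilate-cong 7 twist-ψ⁻)))

evΨ′ : ev Ψ′ ≈ s
evΨ′ n = trans (sym (twist-Ψ (2 ℕ.* n))) (trans (cong (_* Ψ (2 ℕ.* n)) (sgnℕ-2* n)) (ℤP.*-identityˡ _))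

odΨ′ : od Ψ′ ≈ negF (od Ψ)
odΨ′ n = trans (sym (twist-Ψ (suc (2 ℕ.* n)))) (trans (cong (λ z → - z * od Ψ n) (sgnℕ-2* n)) (ℤP.-1*i≡-i (od Ψ n)))

D₀-id : (B ⊕ C) ⊛ (E₂ ⊛ E₂₈) ≈ (s ⊕ s) ⊛ (E₄ ⊛ E₁₄)
D₀-id = ≈-trans (⊛-cong (⊕-cong (≈-sym ev-A) (≈-sym ev-C)) (≈-refl {E₂ ⊛ E₂₈}))
  (ev-identity {A ⊕ C} {Ψ ⊕ Ψ} {E₂ ⊛ E₂₈} {E₄ ⊛ E₁₄} A+C₂)

N₀-id : (A ⊖ C) ⊛ (E₄ ⊛ E₁₄) ≈ (s ⊕ s) ⊛ (mono 1 ⊛ (E₂ ⊛ E₂₈))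
N₀-id = ≈-trans (⊛-cong (⊖-cong (≈-sym ev-B) (≈-sym ev-C)) (≈-refl {E₄ ⊛ E₁₄}))
  (≈-trans (ev-identity {B ⊖ C} {Ψ′ ⊕ Ψ′} {E₄ ⊛ E₁₄} {mono 1 ⊛ (E₂ ⊛ E₂₈)} B-C₂)
    (⊛-cong (⊕-cong evΨ′ evΨ′) (≈-refl {mono 1 ⊛ (E₂ ⊛ E₂₈)})))

-- The class 1 of the numerator and the class 3 of the denominator, as series in q⁴; the classes 0
-- are `A ⊖ C` and `B ⊕ C`.
N₁ D₃ t₀ : FPS
N₁ = ev (od A) ⊖ ev (od C)
D₃ = od (od B) ⊕ od (od C)
t₀ = ev (od Ψ)

twist-E₁₄ : twist E₁₄ ≈ E₁₄
twist-E₁₄ = twist-dilate-even 7 E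

twist-E₇ : twist E₇ ≈ D₇
twist-E₇ = twist-dilate-odd 3 E

-- The class 1 of the formula for A + C, with -q for q: the part of A is fixed, the part of C
-- changes sign, and the class 1 of `Ψ` becomes s.
N₁-id : N₁ ⊛ (D ⊛ E₁₄) ≈ (s ⊕ s) ⊛ (E₂ ⊛ D₇)
N₁-id = ≈-trans (⊛-cong N₁≈ (⊛-cong (≈-refl {D}) (≈-sym twist-E₁₄))) (≈-trans
  (≈-trans (⊛-cong (≈-refl {twist (ev (od A) ⊕ ev (od C))}) (≈-sym (twist-⊛ E E₁₄))) (≈-sym (twist-⊛ (ev (od A) ⊕ ev (od C)) (E ⊛ E₁₄))))
  (≈-trans (twist-cong before) (≈-trans (twist-⊛ (t₀ ⊕ t₀) (E₂ ⊛ E₇)) (⊛-cong (≈-trans (twist-⊕ t₀ t₀) (⊕-cong twist-evodΨ twist-evodΨ))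
    (≈-trans (twist-⊛ E₂ E₇) (⊛-cong twist-E₂ twist-E₇))))))
  where
  N₁≈ : N₁ ≈ twist (ev (od A) ⊕ ev (od C))
  N₁≈ = ≈-sym (≈-trans (twist-⊕ (ev (od A)) (ev (od C))) (⊕-cong twist-evodA twist-evodC))
  before : (ev (od A) ⊕ ev (od C)) ⊛ (E ⊛ E₁₄) ≈ (t₀ ⊕ t₀) ⊛ (E₂ ⊛ E₇)
  before = ev-identity {od (A ⊕ C)} {od (Ψ ⊕ Ψ)} {E ⊛ E₁₄} {E₂ ⊛ E₇}
    (≈-trans (⊛-cong (≈-refl {od (A ⊕ C)}) (≈-sym EE₁)) (≈-trans (od-identity {A ⊕ C} {Ψ ⊕ Ψ} {E₂ ⊛ E₂₈} {E₄ ⊛ E₁₄} A+C₂)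
      (⊛-cong (≈-refl {od (Ψ ⊕ Ψ)}) (EE₂ 2 7))))

-- The class 3 of the formula for B - C, twisted. Here the part of B changes sign and that of C does
-- not, so both sides come out negated.
D₃-id : D₃ ⊛ (E₂ ⊛ D₇) ≈ (s ⊕ s) ⊛ (D ⊛ E₁₄)
D₃-id n = ℤP.neg-injective (negated n)
  where
  X = od Ψ′ ⊕ od Ψ′
  before : od (od B ⊖ od C) ⊛ (E₂ ⊛ E₇) ≈ ev X ⊛ (E ⊛ E₁₄)
  before = ≈-trans (≈-sym (od-⊛-dilate (od B ⊖ od C) (E₂ ⊛ E₇))) (≈-trans (od-cong
      (≈-trans (⊛-cong (≈-refl {od B ⊖ od C}) (≈-sym (EE₂ 2 7)))
      (≈-trans (od-identity {B ⊖ C} {Ψ′ ⊕ Ψ′} {E₄ ⊛ E₁₄} {mono 1 ⊛ (E₂ ⊛ E₂₈)} B-C₂)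
      (≈-trans (rot X (mono 1) (E₂ ⊛ E₂₈)) (≈-trans (⊛-assoc (mono 1) X (E₂ ⊛ E₂₈)) (⊛-cong (≈-refl {mono 1}) (⊛-cong (≈-refl {X}) EE₁)))))))
    -- The factor q on the right shifts parity: the class 3 of B - C meets the class 1 of `Ψ′`,
    -- which is the negative of `t₀` and hence accessible through `twist-evodΨ`.
    (≈-trans (λ m → mono-shift 1 (X ⊛ dilate 2 (E ⊛ E₁₄)) (2 ℕ.* m)) (ev-⊛-dilate X (E ⊛ E₁₄))))
  lhs : twist (od (od B ⊖ od C)) ≈ negF D₃
  lhs = ≈-trans (twist-⊖ (od (od B)) (od (od C))) (≈-trans (⊖-cong twist-ododB twist-ododC) (λ m → sym (ℤP.neg-distrib-+ (od (od B) m) (od (od C) m))))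
  rhs : twist (ev X) ≈ negF (s ⊕ s)
  rhs = ≈-trans (twist-cong {ev X} {negF (t₀ ⊕ t₀)} (λ m → trans (cong₂ _+_ (odΨ′ (2 ℕ.* m)) (odΨ′ (2 ℕ.* m))) (sym (ℤP.neg-distrib-+ (t₀ m) (t₀ m)))))
    (≈-trans (twist-neg (t₀ ⊕ t₀)) λ m → cong -_ (trans (twist-⊕ t₀ t₀ m) (cong₂ _+_ (twist-evodΨ m) (twist-evodΨ m))))
  negated : negF (D₃ ⊛ (E₂ ⊛ D₇)) ≈ negF ((s ⊕ s) ⊛ (D ⊛ E₁₄))
  negated = ≈-trans (≈-sym (neg-⊛ D₃ (E₂ ⊛ D₇))) (≈-trans (⊛-cong (≈-sym lhs) (⊛-cong (≈-sym twist-E₂) (≈-sym twist-E₇)))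
    (≈-trans (⊛-cong (≈-refl {twist (od (od B ⊖ od C))}) (≈-sym (twist-⊛ E₂ E₇))) (≈-trans (≈-sym (twist-⊛ (od (od B ⊖ od C)) (E₂ ⊛ E₇)))
    (≈-trans (twist-cong before) (≈-trans (twist-⊛ (ev X) (E ⊛ E₁₄)) (≈-trans (⊛-cong rhs (≈-trans (twist-⊛ E E₁₄) (⊛-cong (≈-refl {D}) twist-E₁₄)))
    (neg-⊛ (s ⊕ s) (D ⊛ E₁₄))))))))

D₇E₇E₂₈ : D₇ ⊛ E₇ ⊛ E₂₈ ≈ E₁₄ ⊛ (E₁₄ ⊛ E₁₄)
D₇E₇E₂₈ = DEE 7

-- s disappears between `N₁-id` and `D₀-id`. It need not have constant term 1 itself; only the
-- products of E and D that were multiplied in have to be cancelled.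
residue-1-identity : N₁ ⊛ (E₂ ⊛ E₇) ≈ (B ⊕ C) ⊛ (E ⊛ E₁₄)
residue-1-identity = ⊛-cancelʳ (D ⊛ E₁₄ ⊛ (E₂ ⊛ E₂₈)) (⊛-unit {D ⊛ E₁₄} {E₂ ⊛ E₂₈} (⊛-unit {D} {E₁₄} refl (E-unit 14)) (E-unit₂ 2 28))
  (residue₁ {N₁} {B ⊕ C} {s ⊕ s} {D} {D₇} {E} {E₂} {E₄} {E₇} {E₁₄} {E₂₈} N₁-id D₀-id triple D₇E₇E₂₈)

residue-0-identity : (A ⊖ C) ⊛ (E₂ ⊛ E₇) ≈ mono 1 ⊛ D₃ ⊛ (E ⊛ E₁₄)
residue-0-identity = ⊛-cancelʳ (E₄ ⊛ E₁₄ ⊛ (E₂ ⊛ D₇)) (⊛-unit {E₄ ⊛ E₁₄} {E₂ ⊛ D₇} (E-unit₂ 4 14) (⊛-unit {E₂} {D₇} (E-unit 2) (D-unit 7)))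
  (residue₀ {A ⊖ C} {D₃} {s ⊕ s} {mono 1} {D} {D₇} {E} {E₂} {E₄} {E₇} {E₁₄} {E₂₈} N₀-id D₃-id triple D₇E₇E₂₈)

numerator : theta (+ 1) (+ 0) (+ 56) ⊖ theta (+ 5) (+ 4) (+ 12) ≈ dilate 4 (A ⊖ C) ⊕ mono 1 ⊛ dilate 4 N₁
numerator = ≈-trans (⊖-cong θ-1-0-56 θ-5-4-12) (≈-trans
  (theta-diff (dilate 4 A) (dilate 4 (ev (od A))) (dilate 4 C) (dilate 4 (ev (od C))) (mono 1))
  (⊕-cong (≈-sym (dilate-⊖ 4 A C)) (⊛-cong (≈-refl {mono 1}) (≈-sym (dilate-⊖ 4 (ev (od A)) (ev (od C)))))))

denominator : theta (+ 7) (+ 0) (+ 8) ⊕ theta (+ 3) (+ 2) (+ 19) ≈ dilate 4 (B ⊕ C) ⊕ mono 3 ⊛ dilate 4 D₃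
denominator = ≈-trans (⊕-cong θ-7-0-8 θ-3-2-19) (≈-trans
  (theta-sum (dilate 4 B) (dilate 4 (od (od B))) (dilate 4 C) (dilate 4 (od (od C))) (mono 3))
  (⊕-cong (≈-sym (dilate-⊕ 4 B C)) (⊛-cong (≈-refl {mono 3}) (≈-sym (dilate-⊕ 4 (od (od B)) (od (od C)))))))

theorem4p5 : (N : ℕ) →
    ((theta (+ 1) (+ 0) (+ 56) ⊖ theta (+ 5) (+ 4) (+ 12)) ⊛ (dilate 8 E ⊛ dilate 28 E)) N
    ≡ (qmul (dilate 4 E ⊛ dilate 56 E) ⊛ (theta (+ 7) (+ 0) (+ 8) ⊕ theta (+ 3) (+ 2) (+ 19))) N
theorem4p5 = ≈-trans (⊛-cong numerator EE)
  (≈-trans (assemble-dissection {dilate 4 (A ⊖ C)} {dilate 4 N₁} {dilate 4 (B ⊕ C)} {dilate 4 D₃} {dilate 4 (E₂ ⊛ E₇)} {dilate 4 (E ⊛ E₁₄)} {mono 1} {mono 3} {mono 4}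
    (dilate-identity 4 {A ⊖ C} {E₂ ⊛ E₇} {mono 1 ⊛ D₃} {E ⊛ E₁₄} residue-0-identity (≈-refl {dilate 4 (A ⊖ C)}) (≈-refl {dilate 4 (E₂ ⊛ E₇)})
      (dilate-⊛-cong 4 {mono 1} {D₃} (dilate-mono 4 1) (≈-refl {dilate 4 D₃})) (≈-refl {dilate 4 (E ⊛ E₁₄)}))
    (dilate-identity 4 {N₁} {E₂ ⊛ E₇} {B ⊕ C} {E ⊛ E₁₄} residue-1-identity (≈-refl {dilate 4 N₁}) (≈-refl {dilate 4 (E₂ ⊛ E₇)}) (≈-refl {dilate 4 (B ⊕ C)}) (≈-refl {dilate 4 (E ⊛ E₁₄)}))
    (mono-⊛ 1 3))
  (⊛-cong (≈-trans (⊛-cong (≈-refl {mono 1}) EE′) (≈-sym (qmul≈ (E₄ ⊛ E₅₆)))) (≈-sym denominator)))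
  where
  EE : E₈ ⊛ E₂₈ ≈ dilate 4 (E₂ ⊛ E₇)
  EE = ≈-sym (dilate-⊛-cong 4 {E₂} {E₇} (dilate-dilate 4 2 E) (dilate-dilate 4 7 E))
  EE′ : dilate 4 (E ⊛ E₁₄) ≈ E₄ ⊛ E₅₆
  EE′ = dilate-⊛-cong 4 {E} {E₁₄} (≈-refl {E₄}) (dilate-dilate 4 14 E)
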